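{- Let $a_3(n)$ be defined by $\sum_{n\geq 0}a_3(n)q^n=\frac{f_3f_6}{f_1f_2}$, where $f_k=\prod_{m\geq1}(1-q^{km})$. Define integers $m_{i,j}$ for $i,j\geq 1$ as follows: $m_{i,j}=0$ whenever $j>i$; $m_{1,1}=3$; $m_{2,1}=2$, $m_{2,2}=3^3$; $m_{3,1}=1$, $m_{3,2}=3^3$, $m_{3,3}=3^5$; and for $i\geq 4$, $m_{i,1}=0$ and for $j\geq 2$, \[m_{i,j}=9m_{i-1,j-1}+3m_{i-2,j-1}+m_{i-3,j-1}.\] Define infinite matrices $A=(a_{i,j})_{i,j\geq1}$ and $B=(b_{i,j})_{i,j\geq1}$ by $a_{i,j}=m_{4i-3,\,i+j-1}$ and $b_{i,j}=m_{4i-1,\,i+j-1}$. Define row vectors $\mathbf{x}_\alpha=(x_{\alpha,1},x_{\alpha,2},\dots)$ by $\mathbf{x}_0=(1,0,0,\dots)$, $\mathbf{x}_{\alpha+1}=\mathbf{x}_\alpha A$ if $\alpha$ is even, and $\mathbf{x}_{\alpha+1}=\mathbf{x}_\alpha B$ if $\alpha$ is odd. Then for each $\alpha\geq 0$, \[\sum_{n\geq0}a_3\left(3^{2\alpha}n+\frac{3^{2\alpha}-1}{4}\right)q^n=\sum_{i\geq1}x_{2\alpha,i}\,q^{i-1}\left(\frac{f_3f_6}{f_1f_2}\right)^{4i-3}\] and \[\sum_{n\geq0}a_3\left(3^{2\alpha+1}n+\frac{3^{2\alpha+2}-1}{4}\right)q^n=\sum_{i\geq1}x_{2\alpha+1,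i}\,q^{i-1}\left(\frac{f_3f_6}{f_1f_2}\right)^{4i-1}.\]
   Context: $a_3(n)$ counts 3-regular cubic partitions of $n$. The vector-matrix products $\mathbf{x}_\alpha A$, $\mathbf{x}_\alpha B$ are finite sums since each $\mathbf{x}_\alpha$ has finitely many nonzero entries. -}

module Defs where

open import Algebra.Bundles using (CommutativeRing)
open import Algebra.Bundles.Raw using (RawRing)
import Algebra.Definitions.RawSemiring as RawSemiringDefs
import Algebra.Properties.Semiring.Sum as SemiringSum
open import Data.Bool.Base using (if_then_else_)
open import Data.Fin.Base using (Fin; toℕ)
open import Data.Fin.Properties using (toℕ<n)
open import Data.Integer.Base as ℤ using (ℤ; 0ℤ; 1ℤ)
import Data.Integer.Properties as ℤ
open import Data.Nat.Base
open import Data.Nat.Properties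
open import Data.Parity.Base using (0ℙ; 1ℙ)
open import Function.Base using (_∘_)
open import Level using (0ℓ)
open import Relation.Binary.PropositionalEquality
open import Relation.Nullary.Decidable.Core using (⌊_⌋)

open SemiringSum (CommutativeRing.semiring ℤ.+-*-commutativeRing) using (sum; sum-syntax; sum⁺-syntax; sum-cong-≗; sum-replicate-zero)

-- Formal power series over ℤ: the function sending n to the coefficient of qⁿ.

Series : Set
Series = ℕ → ℤ

monomial : ℕ → Series
monomial k n = if ⌊ n ≟ k ⌋ then 1ℤ else 0ℤ

seriesRawRing : RawRing 0ℓ 0ℓ
seriesRawRing = record
  { Carrier = Series
  ; _≈_     = _≗_
  ; _+_     = λ f g n → f n ℤ.+ g n
  ; _*_     = λ f g n → ∑[ i ≤ n ] (f (toℕ i) ℤ.* g (n ∸ toℕ i))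
  ; -_      = λ f n → ℤ.- f n
  ; 0#      = λ _ → 0ℤ
  ; 1#      = monomial 0
  }

open RawRing seriesRawRing public
  using ()
  renaming (_≈_ to _≈ˢ_; _+_ to _+ˢ_; _*_ to _*ˢ_; -_ to -ˢ_; 1# to 1ˢ)

open RawSemiringDefs (RawRing.rawSemiring seriesRawRing) public
  using ()
  renaming (_^_ to _^ˢ_; product to productˢ)

infixl 6 _-ˢ_
infixl 7 _·ˢ_ _/ˢ_

_-ˢ_ : Series → Series → Series
f -ˢ g = f +ˢ (-ˢ g)

_·ˢ_ : ℤ → Series → Series
(c ·ˢ f) n = c ℤ.* f n

q : Series
q = monomial 1

-- The q-adically convergent sum of s 0, s 1, s 2, …, for families in which
-- s k is divisible by qᵏ; the terms with k > n then do not contribute to the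
-- coefficient of qⁿ.

∑ˢ : (ℕ → Series) → Series
∑ˢ s n = ∑[ k ≤ n ] s (toℕ k) n

-- s 1 + s 2 + s 3 + …, where s i is divisible by q^(i-1).

∑ˢ₁ : (ℕ → Series) → Series
∑ˢ₁ s = ∑ˢ (s ∘ suc)

-- The q-adically convergent product of s 1, s 2, s 3, …, for families in which
-- s m - 1 is divisible by qᵐ; the factors with m > n then do not contribute to
-- the coefficient of qⁿ.

∏ˢ₁ : (ℕ → Series) → Series
∏ˢ₁ s n = productˢ {n} (λ m → s (suc (toℕ m))) n

-- The inverse of a series with constant term 1, as the geometric series
-- 1 / (1 - g) = 1 + g + g² + … in g = 1 - f, where gᵏ is divisible by qᵏ.

inverse : Series → Series
inverse f = ∑ˢ (λ k → (1ˢ -ˢ f) ^ˢ k)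

_/ˢ_ : Series → Series → Series
f /ˢ g = f *ˢ inverse g

f : (k : ℕ) .{{_ : NonZero k}} → Series
f k = ∏ˢ₁ (λ m → 1ˢ -ˢ q ^ˢ (k * m))

G : Series
G = (f 3 *ˢ f 6) /ˢ (f 1 *ˢ f 2)

a₃ : ℕ → ℤ
a₃ n = G n

-- Matrices and row vectors are indexed from 1 as usual: the entries at an index
-- 0 have no meaning, and all sums run over indices starting at 1.

-- m i j ≡ 0 for all j > i also when 4 ≤ i, where it follows from the
-- recurrence (see m-upper).

m : ℕ → ℕ → ℤ
m 1 1 = ℤ.+ 3
m 2 1 = ℤ.+ 2
m 2 2 = ℤ.+ (3 ^ 3)
m 3 1 = ℤ.+ 1
m 3 2 = ℤ.+ (3 ^ 3)
m 3 3 = ℤ.+ (3 ^ 5)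
m (suc (suc (suc (suc i)))) (suc (suc j)) =
  ℤ.+ 9 ℤ.* m (suc (suc (suc i))) (suc j) ℤ.+ ℤ.+ 3 ℤ.* m (suc (suc i)) (suc j) ℤ.+ m (suc i) (suc j)
m _ _ = 0ℤ

A : ℕ → ℕ → ℤ
A i j = m (4 * i ∸ 3) (i + j ∸ 1)

B : ℕ → ℕ → ℤ
B i j = m (4 * i ∸ 1) (i + j ∸ 1)

step : ℕ → ℕ → ℕ → ℤ
step α with parity α
... | 0ℙ = A
... | 1ℙ = B

-- The vector-matrix product: x α vanishes beyond index 3 ^ α (see x-support),
-- so the sum over 1 ≤ i ≤ 3 ^ α is the sum over all i ≥ 1.

x : ℕ → ℕ → ℤ
x zero    1 = 1ℤ
x zero    _ = 0ℤ
x (suc α) j = ∑[ i < 3 ^ α ] (x α (suc (toℕ i)) ℤ.* step α (suc (toℕ i)) j)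

m-upper : ∀ i j → i < j → m i j ≡ 0ℤ
m-upper 0 _ _ = refl
m-upper 1 (suc (suc j)) _ = refl
m-upper 2 (suc (suc (suc j))) _ = refl
m-upper 3 (suc (suc (suc (suc j)))) _ = refl
m-upper (suc (suc (suc (suc i)))) (suc (suc j)) (s≤s (s≤s i<j)) =
  recurrence-zero (m-upper (suc (suc (suc i))) (suc j) (s≤s i<j))
                  (m-upper (suc (suc i)) (suc j) (s≤s (<⇒≤ i<j)))
                  (m-upper (suc i) (suc j) (s≤s (<⇒≤ (<⇒≤ i<j))))
  where
  recurrence-zero : ∀ {a b c} → a ≡ 0ℤ → b ≡ 0ℤ → c ≡ 0ℤ →
                    ℤ.+ 9 ℤ.* a ℤ.+ ℤ.+ 3 ℤ.* b ℤ.+ c ≡ 0ℤ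
  recurrence-zero refl refl refl = refl
m-upper 1 1 (s≤s ())
m-upper 2 1 (s≤s ())
m-upper 2 2 (s≤s (s≤s ()))
m-upper 3 1 (s≤s ())
m-upper 3 2 (s≤s (s≤s ()))
m-upper 3 3 (s≤s (s≤s (s≤s ())))
m-upper (suc (suc (suc (suc i)))) 1 (s≤s ())

step-support : ∀ α i j → 3 * suc i < j → step α (suc i) j ≡ 0ℤ
step-support α i j 3i<j with parity α
... | 0ℙ = m-upper _ _ (≤-<-trans (∸-monoʳ-≤ {1} {3} (4 * suc i) (s≤s z≤n)) 4i-1<i+j-1)
  where
  4i-1<i+j-1 : 4 * suc i ∸ 1 < suc i + j ∸ 1
  4i-1<i+j-1 = +-monoʳ-< i 3i<j
... | 1ℙ = m-upper _ _ (+-monoʳ-< i 3i<j)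

x-support : ∀ α j → 3 ^ α < j → x α j ≡ 0ℤ
x-support zero    (suc (suc j)) _ = refl
x-support zero    1 (s≤s ())
x-support (suc α) j 3^α<j = trans (sum-cong-≗ term≡0) (sum-replicate-zero (3 ^ α))
  where
  term≡0 : (i : Fin (3 ^ α)) →
           x α (suc (toℕ i)) ℤ.* step α (suc (toℕ i)) j ≡ 0ℤ
  term≡0 i = trans
    (cong (x α (suc (toℕ i)) ℤ.*_)
      (step-support α (toℕ i) j (≤-<-trans (*-monoʳ-≤ 3 (toℕ<n i)) 3^α<j)))
    (ℤ.*-zeroʳ (x α (suc (toℕ i))))

-- Let t = q G(q)⁴ and u = q G(q) G(q³). The extraction of the coefficients of
-- q³ⁿ from q^(i-1) G^(4i-1), and of q³ⁿ⁺² from q^(i-1) G^(4i-3), reduces to the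
-- extraction of the coefficients of q³ⁿ from the powers of u, because u divided
-- by q G(q) is a series in q³. The series u satisfies the cubic equation
-- u³ = t(q³) (1 + 3 u + 9 u²), which turns into the recurrence of m: row i of m
-- consists of the coefficients of the series extracted from uⁱ as a polynomial in t.
--
-- The cubic equation comes from f₁f₂ = φ(-q) ψ(q). The trisections of the theta
-- series φ and ψ give f₁f₂ = a(q³) - q b(q³) - q² c(q³) with b = f₃f₆ and
-- a c = 2 b², where the product formulas needed are cases of the Jacobi triple
-- product. The product of f₁f₂ over q, ωq and ω²q, for a primitive cube root of
-- unity ω, is a³ - 7 q b³ - q² c³ at q³ on the one hand and (f₁f₂)⁴ / (f₃f₆) at q³
-- on the other.

module Submission where

open import Defs
open import Data.Nat using (ℕ; _+_; _*_; _∸_; _^_; _/_)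
open import Data.Product using (_×_)
open import Algebra.Bundles using (CommutativeRing)
import Algebra.Properties.CommutativeSemigroup as CommutativeSemigroupProperties
import Algebra.Properties.CommutativeSemiring.Exp as CommutativeSemiringExp
import Algebra.Properties.Semiring.Exp as SemiringExp
import Algebra.Properties.Semiring.Sum as SemiringSum
import Algebra.Solver.Ring as RingSolver
open import Algebra.Solver.Ring.AlmostCommutativeRing using (fromCommutativeRing; _-Raw-AlmostCommutative⟶_)
open import Algebra.Structures using (IsAbelianGroup)
open import Data.Bool.Base using (if_then_else_)
open import Data.Fin.Base using (toℕ)
open import Data.Integer.Base as ℤ using (ℤ; 0ℤ; 1ℤ; -1ℤ)
import Data.Integer.Properties as ℤ
open import Data.Integer.Tactic.RingSolver using (solve-∀)
open import Data.Maybe.Base using (Maybe; just; nothing)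
open import Data.Nat using (zero; suc; _≤_; _<_; z≤n; s≤s; z<s; s<s; _≤′_; ≤′-refl; ≤′-step; NonZero; >-nonZero⁻¹; parity)
open import Data.Nat.DivMod using (m*n/n≡m)
open import Data.Nat.Properties as ℕ using (≤-refl; ≤-trans; <-≤-trans; m≤n⇒m≤1+n)
import Data.Nat.Tactic.RingSolver as ℕ
open import Data.Parity.Base using (0ℙ; 1ℙ)
open import Data.Product using (_,_)
open import Function.Base using (_∘_; _⟨_⟩_)
open import Level using (0ℓ)
open import Relation.Binary.PropositionalEquality using (_≡_; refl; sym; trans; cong; cong₂; subst; module ≡-Reasoning)
import Relation.Binary.Reasoning.Setoid as SetoidReasoning
open import Relation.Nullary.Decidable using (yes; no; isYes≗does)

-- No root of unity and no negative power of `q` occurs. The norm is a cubic form in the three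
-- sections, multiplicative by a polynomial identity; it is computed for `f 1` and `f 2` factor by
-- factor, giving norm(f_k) f_{3k} = f_k⁴. The coefficients 3 and 9 come from z = f₁f₂ / q. Write A,
-- B, C for a, b, c at q³. Over the series in q³, z = A/q - B - qC has trace -3B, and its second
-- symmetric function 3(B² + AC) becomes 9B² by a c = 2 b². Since u = B / z, reversing the
-- characteristic polynomial of z yields the cubic of u. Extracting q³ⁿ from uⁱ is a third of the
-- trace of uⁱ, with q for q³. The Newton sums are 9t and 6t + 81t² for i = 1, 2, whence the rows
-- (3) and (2, 27). Row 3 is the recurrence applied to rows 2, 1 and the constant u⁰ = 1; that
-- constant belongs to column 0, which `m` does not have, so the recurrence can start only at row 4.
-- As u is known only through a quotient, its sections are reached by multiplying with series in q³
-- until only f₁f₂ is left, and cancelling afterwards.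

tail : Series → Series
tail F n = F (suc n)

scalar : ℤ → Series
scalar c zero    = c
scalar c (suc n) = 0ℤ

infix 4 _≈_
record _≈_ (F G : Series) : Set where
  constructor coefficientwise
  field at : F ≈ˢ G
open _≈_

infixl 6 _⊕_
infixl 7 _⊗_
infix  8 ⊝_

-- Opaque copies of the operations: type checking then never unfolds a product
-- into its coefficients, and implicit arguments can be inferred.
opaque
  _⊕_ _⊗_ : Series → Series → Series
  _⊕_ = _+ˢ_
  _⊗_ = _*ˢ_

  ⊝_ : Series → Series
  ⊝_ = -ˢ_

  ⊕-at : ∀ F G n → (F ⊕ G) n ≡ F n ℤ.+ G n
  ⊕-at F G n = refl

  ⊗-zero : ∀ F G → (F ⊗ G) 0 ≡ F 0 ℤ.* G 0
  ⊗-zero F G = ℤ.+-identityʳ _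

  -- Splitting off the index 0 of the convolution leaves a product with a shifted factor, so the
  -- ring laws become inductions on the coefficient index, with the series left general.
  ⊗-suc : ∀ F G n → (F ⊗ G) (suc n) ≡ F 0 ℤ.* G (suc n) ℤ.+ (tail F ⊗ G) n
  ⊗-suc F G n = refl

  ⊝-at : ∀ F n → (⊝ F) n ≡ ℤ.- F n
  ⊝-at F n = refl

𝟘 𝟙 : Series
𝟘 = scalar 0ℤ
𝟙 = scalar 1ℤ

𝟘-at : ∀ n → 𝟘 n ≡ 0ℤ
𝟘-at zero    = refl
𝟘-at (suc n) = refl

-- Ring axioms for the Cauchy product

module CauchyProduct where
  open ≡-Reasoning

  ⊗-cong : ∀ {F F′ G G′} → F ≈ˢ F′ → G ≈ˢ G′ → F ⊗ G ≈ˢ F′ ⊗ G′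
  ⊗-cong {F} {F′} {G} {G′} F≈ G≈ zero = begin
    (F ⊗ G) 0      ≡⟨ ⊗-zero F G ⟩
    F 0 ℤ.* G 0    ≡⟨ cong₂ ℤ._*_ (F≈ 0) (G≈ 0) ⟩
    F′ 0 ℤ.* G′ 0  ≡⟨ ⊗-zero F′ G′ ⟨
    (F′ ⊗ G′) 0    ∎
  ⊗-cong {F} {F′} {G} {G′} F≈ G≈ (suc n) = begin
    (F ⊗ G) (suc n)                              ≡⟨ ⊗-suc F G n ⟩
    F 0 ℤ.* G (suc n) ℤ.+ (tail F ⊗ G) n         ≡⟨ cong₂ ℤ._+_ (cong₂ ℤ._*_ (F≈ 0) (G≈ (suc n)))
                                                                (⊗-cong (F≈ ∘ suc) G≈ n) ⟩
    F′ 0 ℤ.* G′ (suc n) ℤ.+ (tail F′ ⊗ G′) n     ≡⟨ ⊗-suc F′ G′ n ⟨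
    (F′ ⊗ G′) (suc n)                            ∎

  ⊗-zeroˡ : ∀ F → (λ _ → 0ℤ) ⊗ F ≈ˢ (λ _ → 0ℤ)
  ⊗-zeroˡ F zero = ⊗-zero _ F
  ⊗-zeroˡ F (suc n) = trans (⊗-suc _ F n) (trans (ℤ.+-identityˡ _) (⊗-zeroˡ F n))

  scalar-⊗ : ∀ c F → scalar c ⊗ F ≈ˢ c ·ˢ F
  scalar-⊗ c F zero    = ⊗-zero _ F
  scalar-⊗ c F (suc n) = trans (⊗-suc _ F n)
    (trans (cong (ℤ._+_ (c ℤ.* F (suc n))) (⊗-zeroˡ F n)) (ℤ.+-identityʳ _))

  ⊗-identityˡ : ∀ F → 𝟙 ⊗ F ≈ˢ F
  ⊗-identityˡ F n = trans (scalar-⊗ 1ℤ F n) (ℤ.*-identityˡ (F n))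

  -- The mirror image of `⊗-suc`: exchanging the factors swaps the two recursions, which is what
  -- makes commutativity an induction.
  ⊗-sucʳ : ∀ F G n → (F ⊗ G) (suc n) ≡ (F ⊗ tail G) n ℤ.+ F (suc n) ℤ.* G 0
  ⊗-sucʳ F G zero    = begin
    (F ⊗ G) 1                           ≡⟨ ⊗-suc F G 0 ⟩
    F 0 ℤ.* G 1 ℤ.+ (tail F ⊗ G) 0      ≡⟨ cong₂ ℤ._+_ (⊗-zero F (tail G)) (sym (⊗-zero (tail F) G)) ⟨
    (F ⊗ tail G) 0 ℤ.+ F 1 ℤ.* G 0      ∎
  ⊗-sucʳ F G (suc n) = begin
    (F ⊗ G) (suc (suc n))
      ≡⟨ ⊗-suc F G (suc n) ⟩
    F 0 ℤ.* G (suc (suc n)) ℤ.+ (tail F ⊗ G) (suc n)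
      ≡⟨ cong (ℤ._+_ (F 0 ℤ.* G (suc (suc n)))) (⊗-sucʳ (tail F) G n) ⟩
    F 0 ℤ.* G (suc (suc n)) ℤ.+ ((tail F ⊗ tail G) n ℤ.+ F (suc (suc n)) ℤ.* G 0)
      ≡⟨ ℤ.+-assoc (F 0 ℤ.* G (suc (suc n))) _ _ ⟨
    F 0 ℤ.* G (suc (suc n)) ℤ.+ (tail F ⊗ tail G) n ℤ.+ F (suc (suc n)) ℤ.* G 0
      ≡⟨ cong (ℤ._+ (F (suc (suc n)) ℤ.* G 0)) (⊗-suc F (tail G) n) ⟨
    (F ⊗ tail G) (suc n) ℤ.+ F (suc (suc n)) ℤ.* G 0 ∎

  ⊗-comm : ∀ F G → F ⊗ G ≈ˢ G ⊗ F
  ⊗-comm F G zero    = trans (⊗-zero F G) (trans (ℤ.*-comm (F 0) (G 0)) (sym (⊗-zero G F)))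
  ⊗-comm F G (suc n) = begin
    (F ⊗ G) (suc n)                            ≡⟨ ⊗-sucʳ F G n ⟩
    (F ⊗ tail G) n ℤ.+ F (suc n) ℤ.* G 0       ≡⟨ cong₂ ℤ._+_ (⊗-comm F (tail G) n) (ℤ.*-comm (F (suc n)) (G 0)) ⟩
    (tail G ⊗ F) n ℤ.+ G 0 ℤ.* F (suc n)       ≡⟨ ℤ.+-comm ((tail G ⊗ F) n) _ ⟩
    G 0 ℤ.* F (suc n) ℤ.+ (tail G ⊗ F) n       ≡⟨ ⊗-suc G F n ⟨
    (G ⊗ F) (suc n)                            ∎

  tail-⊕ : ∀ F G → tail (F ⊕ G) ≈ˢ tail F ⊕ tail G
  tail-⊕ F G n = trans (⊕-at F G (suc n)) (sym (⊕-at (tail F) (tail G) n))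

  ⊗-distribʳ : ∀ H F G → (F ⊕ G) ⊗ H ≈ˢ F ⊗ H ⊕ G ⊗ H
  ⊗-distribʳ H F G zero    = begin
    ((F ⊕ G) ⊗ H) 0                    ≡⟨ ⊗-zero (F ⊕ G) H ⟩
    (F ⊕ G) 0 ℤ.* H 0                  ≡⟨ cong (ℤ._* H 0) (⊕-at F G 0) ⟩
    (F 0 ℤ.+ G 0) ℤ.* H 0              ≡⟨ ℤ.*-distribʳ-+ (H 0) (F 0) (G 0) ⟩
    F 0 ℤ.* H 0 ℤ.+ G 0 ℤ.* H 0        ≡⟨ cong₂ ℤ._+_ (⊗-zero F H) (⊗-zero G H) ⟨
    (F ⊗ H) 0 ℤ.+ (G ⊗ H) 0            ≡⟨ ⊕-at (F ⊗ H) (G ⊗ H) 0 ⟨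
    (F ⊗ H ⊕ G ⊗ H) 0                  ∎
  ⊗-distribʳ H F G (suc n) = begin
    ((F ⊕ G) ⊗ H) (suc n)
      ≡⟨ ⊗-suc (F ⊕ G) H n ⟩
    (F ⊕ G) 0 ℤ.* H (suc n) ℤ.+ (tail (F ⊕ G) ⊗ H) n
      ≡⟨ cong₂ (λ a b → a ℤ.* H (suc n) ℤ.+ b) (⊕-at F G 0)
           (trans (⊗-cong (tail-⊕ F G) (λ _ → refl) n)
                  (trans (⊗-distribʳ H (tail F) (tail G) n) (⊕-at _ _ n))) ⟩
    (F 0 ℤ.+ G 0) ℤ.* H (suc n) ℤ.+ ((tail F ⊗ H) n ℤ.+ (tail G ⊗ H) n)
      ≡⟨ lemma (F 0) (G 0) (H (suc n)) ((tail F ⊗ H) n) ((tail G ⊗ H) n) ⟩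
    (F 0 ℤ.* H (suc n) ℤ.+ (tail F ⊗ H) n) ℤ.+ (G 0 ℤ.* H (suc n) ℤ.+ (tail G ⊗ H) n)
      ≡⟨ cong₂ ℤ._+_ (⊗-suc F H n) (⊗-suc G H n) ⟨
    (F ⊗ H) (suc n) ℤ.+ (G ⊗ H) (suc n)
      ≡⟨ ⊕-at (F ⊗ H) (G ⊗ H) (suc n) ⟨
    (F ⊗ H ⊕ G ⊗ H) (suc n) ∎
    where
    lemma : ∀ a b c d e → (a ℤ.+ b) ℤ.* c ℤ.+ (d ℤ.+ e) ≡ (a ℤ.* c ℤ.+ d) ℤ.+ (b ℤ.* c ℤ.+ e)
    lemma = solve-∀

  ·-⊗ : ∀ c F G → (c ·ˢ F) ⊗ G ≈ˢ c ·ˢ (F ⊗ G)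
  ·-⊗ c F G zero    = begin
    ((c ·ˢ F) ⊗ G) 0          ≡⟨ ⊗-zero (c ·ˢ F) G ⟩
    c ℤ.* F 0 ℤ.* G 0         ≡⟨ ℤ.*-assoc c (F 0) (G 0) ⟩
    c ℤ.* (F 0 ℤ.* G 0)       ≡⟨ cong (c ℤ.*_) (⊗-zero F G) ⟨
    c ℤ.* (F ⊗ G) 0           ∎
  ·-⊗ c F G (suc n) = begin
    ((c ·ˢ F) ⊗ G) (suc n)                                    ≡⟨ ⊗-suc (c ·ˢ F) G n ⟩
    c ℤ.* F 0 ℤ.* G (suc n) ℤ.+ ((c ·ˢ tail F) ⊗ G) n         ≡⟨ cong (ℤ._+_ (c ℤ.* F 0 ℤ.* G (suc n))) (·-⊗ c (tail F) G n) ⟩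
    c ℤ.* F 0 ℤ.* G (suc n) ℤ.+ c ℤ.* (tail F ⊗ G) n          ≡⟨ lemma c (F 0) (G (suc n)) ((tail F ⊗ G) n) ⟩
    c ℤ.* (F 0 ℤ.* G (suc n) ℤ.+ (tail F ⊗ G) n)              ≡⟨ cong (c ℤ.*_) (⊗-suc F G n) ⟨
    c ℤ.* (F ⊗ G) (suc n)                                     ∎
    where
    lemma : ∀ a b c d → (a ℤ.* b) ℤ.* c ℤ.+ a ℤ.* d ≡ a ℤ.* (b ℤ.* c ℤ.+ d)
    lemma = solve-∀

  tail-⊗ : ∀ F G → tail (F ⊗ G) ≈ˢ (F 0 ·ˢ tail G) ⊕ tail F ⊗ G
  tail-⊗ F G n = trans (⊗-suc F G n) (sym (⊕-at (F 0 ·ˢ tail G) (tail F ⊗ G) n))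

  ⊗-assoc : ∀ F G H → (F ⊗ G) ⊗ H ≈ˢ F ⊗ (G ⊗ H)
  ⊗-assoc F G H zero    = begin
    (F ⊗ G ⊗ H) 0             ≡⟨ ⊗-zero (F ⊗ G) H ⟩
    (F ⊗ G) 0 ℤ.* H 0         ≡⟨ cong (ℤ._* H 0) (⊗-zero F G) ⟩
    F 0 ℤ.* G 0 ℤ.* H 0       ≡⟨ ℤ.*-assoc (F 0) (G 0) (H 0) ⟩
    F 0 ℤ.* (G 0 ℤ.* H 0)     ≡⟨ cong (F 0 ℤ.*_) (⊗-zero G H) ⟨
    F 0 ℤ.* (G ⊗ H) 0         ≡⟨ ⊗-zero F (G ⊗ H) ⟨
    (F ⊗ (G ⊗ H)) 0           ∎
  ⊗-assoc F G H (suc n) = begin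
    (F ⊗ G ⊗ H) (suc n)
      ≡⟨ ⊗-suc (F ⊗ G) H n ⟩
    (F ⊗ G) 0 ℤ.* H (suc n) ℤ.+ (tail (F ⊗ G) ⊗ H) n
      ≡⟨ cong₂ (λ a b → a ℤ.* H (suc n) ℤ.+ b) (⊗-zero F G)
           (trans (⊗-cong (tail-⊗ F G) (λ _ → refl) n)
           (trans (⊗-distribʳ H (F 0 ·ˢ tail G) (tail F ⊗ G) n)
           (trans (⊕-at _ _ n)
           (cong₂ ℤ._+_ (·-⊗ (F 0) (tail G) H n) (⊗-assoc (tail F) G H n))))) ⟩
    F 0 ℤ.* G 0 ℤ.* H (suc n) ℤ.+ (F 0 ℤ.* (tail G ⊗ H) n ℤ.+ (tail F ⊗ (G ⊗ H)) n)
      ≡⟨ lemma (F 0) (G 0) (H (suc n)) ((tail G ⊗ H) n) ((tail F ⊗ (G ⊗ H)) n) ⟩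
    F 0 ℤ.* (G 0 ℤ.* H (suc n) ℤ.+ (tail G ⊗ H) n) ℤ.+ (tail F ⊗ (G ⊗ H)) n
      ≡⟨ cong (λ a → F 0 ℤ.* a ℤ.+ (tail F ⊗ (G ⊗ H)) n) (⊗-suc G H n) ⟨
    F 0 ℤ.* (G ⊗ H) (suc n) ℤ.+ (tail F ⊗ (G ⊗ H)) n
      ≡⟨ ⊗-suc F (G ⊗ H) n ⟨
    (F ⊗ (G ⊗ H)) (suc n) ∎
    where
    lemma : ∀ a b c d e → a ℤ.* b ℤ.* c ℤ.+ (a ℤ.* d ℤ.+ e) ≡ a ℤ.* (b ℤ.* c ℤ.+ d) ℤ.+ e
    lemma = solve-∀

  ⊗-distribˡ : ∀ H F G → H ⊗ (F ⊕ G) ≈ˢ H ⊗ F ⊕ H ⊗ G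
  ⊗-distribˡ H F G n = begin
    (H ⊗ (F ⊕ G)) n               ≡⟨ ⊗-comm H (F ⊕ G) n ⟩
    ((F ⊕ G) ⊗ H) n               ≡⟨ ⊗-distribʳ H F G n ⟩
    (F ⊗ H ⊕ G ⊗ H) n             ≡⟨ ⊕-at (F ⊗ H) (G ⊗ H) n ⟩
    (F ⊗ H) n ℤ.+ (G ⊗ H) n       ≡⟨ cong₂ ℤ._+_ (⊗-comm F H n) (⊗-comm G H n) ⟩
    (H ⊗ F) n ℤ.+ (H ⊗ G) n       ≡⟨ ⊕-at (H ⊗ F) (H ⊗ G) n ⟨
    (H ⊗ F ⊕ H ⊗ G) n             ∎

  opaque
    unfolding _⊕_

    ⊕-isAbelianGroup : IsAbelianGroup _≈_ _⊕_ 𝟘 ⊝_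
    ⊕-isAbelianGroup = record
      { isGroup = record
        { isMonoid = record
          { isSemigroup = record
            { isMagma = record
              { isEquivalence = record
                { refl  = coefficientwise λ _ → refl
                ; sym   = λ F≈G → coefficientwise λ n → sym (at F≈G n)
                ; trans = λ F≈G G≈H → coefficientwise λ n → trans (at F≈G n) (at G≈H n)
                }
              ; ∙-cong = λ F≈ G≈ → coefficientwise λ n → cong₂ ℤ._+_ (at F≈ n) (at G≈ n)
              }
            ; assoc = λ F G H → coefficientwise λ n → ℤ.+-assoc (F n) (G n) (H n)
            }
          ; identity = (λ F → coefficientwise λ n → trans (cong (ℤ._+ F n) (𝟘-at n)) (ℤ.+-identityˡ (F n)))
                     , (λ F → coefficientwise λ n → trans (cong (ℤ._+_ (F n)) (𝟘-at n)) (ℤ.+-identityʳ (F n)))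
          }
        ; inverse = (λ F → coefficientwise λ n → trans (ℤ.+-inverseˡ (F n)) (sym (𝟘-at n)))
                  , (λ F → coefficientwise λ n → trans (ℤ.+-inverseʳ (F n)) (sym (𝟘-at n)))
        ; ⁻¹-cong = λ F≈G → coefficientwise λ n → cong ℤ.-_ (at F≈G n)
        }
      ; comm = λ F G → coefficientwise λ n → ℤ.+-comm (F n) (G n)
      }

open CauchyProduct

seriesRing : CommutativeRing 0ℓ 0ℓ
seriesRing = record
  { Carrier = Series ; _≈_ = _≈_ ; _+_ = _⊕_ ; _*_ = _⊗_ ; -_ = ⊝_ ; 0# = 𝟘 ; 1# = 𝟙
  ; isCommutativeRing = record
    { isRing = record
      { +-isAbelianGroup = ⊕-isAbelianGroup
      ; *-cong     = λ F≈ G≈ → coefficientwise (⊗-cong (at F≈) (at G≈))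
      ; *-assoc    = λ F G H → coefficientwise (⊗-assoc F G H)
      ; *-identity = (λ F → coefficientwise (⊗-identityˡ F))
                   , (λ F → coefficientwise λ n → trans (⊗-comm F 𝟙 n) (⊗-identityˡ F n))
      ; distrib    = (λ H F G → coefficientwise (⊗-distribˡ H F G))
                   , (λ H F G → coefficientwise (⊗-distribʳ H F G))
      }
    ; *-comm = λ F G → coefficientwise (⊗-comm F G)
    }
  }

module R = CommutativeRing seriesRing

opaque
  unfolding _⊕_

  scalar-+ : ∀ a b → scalar (a ℤ.+ b) ≈ scalar a ⊕ scalar b
  scalar-+ a b = coefficientwise λ { zero → refl ; (suc n) → refl }

  scalar-neg : ∀ a → scalar (ℤ.- a) ≈ ⊝ scalar a
  scalar-neg a = coefficientwise λ { zero → refl ; (suc n) → refl }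

·-scalar : ∀ c F → c ·ˢ F ≈ scalar c ⊗ F
·-scalar c F = coefficientwise λ n → sym (scalar-⊗ c F n)

scalar-* : ∀ a b → scalar (a ℤ.* b) ≈ scalar a ⊗ scalar b
scalar-* a b = coefficientwise λ
  { zero    → sym (scalar-⊗ a (scalar b) 0)
  ; (suc n) → sym (trans (scalar-⊗ a (scalar b) (suc n)) (ℤ.*-zeroʳ a)) }

-- Lets the ring solver compute with integer coefficients, so that identities with numerals such as
-- 7 or 243 are settled by arithmetic in ℤ.
scalar-morphism : CommutativeRing.rawRing ℤ.+-*-commutativeRing
                  -Raw-AlmostCommutative⟶ fromCommutativeRing seriesRing
scalar-morphism = record
  { ⟦_⟧    = scalar
  ; +-homo = scalar-+
  ; *-homo = scalar-*
  ; -‿homo = scalar-neg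
  ; 0-homo = R.refl
  ; 1-homo = R.refl
  }

scalar-≟ : (a b : ℤ) → Maybe (scalar a ≈ scalar b)
scalar-≟ a b with a ℤ.≟ b
... | yes refl = just R.refl
... | no _     = nothing

open RingSolver (CommutativeRing.rawRing ℤ.+-*-commutativeRing) (fromCommutativeRing seriesRing) scalar-morphism scalar-≟
  using (solve; _:=_; _:+_; _:*_; _:-_; :-_; con)

module ≈R = SetoidReasoning R.setoid
open R using () renaming (_-_ to _⊖_)
open SemiringExp R.semiring using () renaming (_^_ to _↑_; ^-homo-* to ↑-+)
open CommutativeSemiringExp R.commutativeSemiring using () renaming (^-distrib-* to ↑-⊗)
open CommutativeSemigroupProperties R.*-commutativeSemigroup using (interchange) renaming (x∙yz≈y∙xz to ⊗-swap)
open CommutativeSemigroupProperties R.+-commutativeSemigroup using () renaming (interchange to ⊕-interchange)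

-- Congruence modulo qᴺ and q-adic limits

infix 4 _≈[_]_
record _≈[_]_ (F : Series) (N : ℕ) (G : Series) : Set where
  constructor upTo
  field below : ∀ n → n < N → F n ≡ G n
open _≈[_]_

≈⇒≈[] : ∀ {N F G} → F ≈ G → F ≈[ N ] G
≈⇒≈[] F≈G = upTo λ n _ → at F≈G n

≈[]⇒≈ : ∀ {F G} → (∀ N → F ≈[ N ] G) → F ≈ G
≈[]⇒≈ F≈G = coefficientwise λ n → below (F≈G (suc n)) n ≤-refl

≈[]-refl : ∀ {N F} → F ≈[ N ] F
≈[]-refl = ≈⇒≈[] R.refl

≈[]-sym : ∀ {N F G} → F ≈[ N ] G → G ≈[ N ] F
≈[]-sym F≈G = upTo λ n n<N → sym (below F≈G n n<N)

≈[]-trans : ∀ {N F G H} → F ≈[ N ] G → G ≈[ N ] H → F ≈[ N ] H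
≈[]-trans F≈G G≈H = upTo λ n n<N → trans (below F≈G n n<N) (below G≈H n n<N)

≈[]-weaken : ∀ {M N F G} → M ≤ N → F ≈[ N ] G → F ≈[ M ] G
≈[]-weaken M≤N F≈G = upTo λ n n<M → below F≈G n (≤-trans n<M M≤N)

⊕-cong[] : ∀ {N F F′ G G′} → F ≈[ N ] F′ → G ≈[ N ] G′ → F ⊕ G ≈[ N ] F′ ⊕ G′
⊕-cong[] {N} {F} {F′} {G} {G′} F≈ G≈ = upTo λ n n<N →
  trans (⊕-at F G n) (trans (cong₂ ℤ._+_ (below F≈ n n<N) (below G≈ n n<N)) (sym (⊕-at F′ G′ n)))

⊝-cong[] : ∀ {N F G} → F ≈[ N ] G → ⊝ F ≈[ N ] ⊝ G
⊝-cong[] {N} {F} {G} F≈ = upTo λ n n<N →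
  trans (⊝-at F n) (trans (cong ℤ.-_ (below F≈ n n<N)) (sym (⊝-at G n)))

⊗-cong[] : ∀ {N F F′ G G′} → F ≈[ N ] F′ → G ≈[ N ] G′ → F ⊗ G ≈[ N ] F′ ⊗ G′
⊗-cong[] {N} F≈ G≈ = upTo (coefficient F≈ G≈)
  where
  coefficient : ∀ {N F F′ G G′} → F ≈[ N ] F′ → G ≈[ N ] G′ → ∀ n → n < N → (F ⊗ G) n ≡ (F′ ⊗ G′) n
  coefficient {N} {F} {F′} {G} {G′} F≈ G≈ zero n<N =
    trans (⊗-zero F G) (trans (cong₂ ℤ._*_ (below F≈ 0 n<N) (below G≈ 0 n<N)) (sym (⊗-zero F′ G′)))
  coefficient {suc N} {F} {F′} {G} {G′} F≈ G≈ (suc n) (s≤s n<N) = trans (⊗-suc F G n)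
    (trans (cong₂ ℤ._+_ (cong₂ ℤ._*_ (below F≈ 0 z<s) (below G≈ (suc n) (s<s n<N)))
                        (coefficient {N} (upTo λ k k<N → below F≈ (suc k) (s<s k<N))
                                         (≈[]-weaken (m≤n⇒m≤1+n ≤-refl) G≈) n n<N))
           (sym (⊗-suc F′ G′ n)))

≈[]-≈ : ∀ {N F G H} → F ≈[ N ] G → G ≈ H → F ≈[ N ] H
≈[]-≈ p q = ≈[]-trans p (≈⇒≈[] q)

infix 4 _⟶_
-- Convergence at a fixed rate: the term N is already correct below qᴺ. Limits then combine termwise
-- without moduli of convergence; the price is an occasional passage to a subsequence.
_⟶_ : (ℕ → Series) → Series → Set
s ⟶ F = ∀ N → s N ≈[ N ] F

⟶-unique : ∀ {s t F G} → (∀ N → s N ≈[ N ] t N) → s ⟶ F → t ⟶ G → F ≈ G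
⟶-unique s≈t s⟶F t⟶G = ≈[]⇒≈ λ N → ≈[]-trans (≈[]-sym (s⟶F N)) (≈[]-trans (s≈t N) (t⟶G N))

⟶-⊗ : ∀ {s t F G} → s ⟶ F → t ⟶ G → (λ N → s N ⊗ t N) ⟶ F ⊗ G
⟶-⊗ s⟶F t⟶G N = ⊗-cong[] (s⟶F N) (t⟶G N)

⟶-subsequence : ∀ {s F} (φ : ℕ → ℕ) → (∀ N → N ≤ φ N) → s ⟶ F → (s ∘ φ) ⟶ F
⟶-subsequence φ N≤φN s⟶F N = ≈[]-weaken (N≤φN N) (s⟶F (φ N))

-- The limit of s, provided that the coefficient of qⁿ no longer changes after the term d + n.
diagonal : ℕ → (ℕ → Series) → Series
diagonal d s n = s (d + n) n

-- The offset `d` admits families that settle late. Theta sums need d = 1: in `Ψ` the term of index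
-- -1 is q⁰ and still alters the constant coefficient.
diagonal-⟶ : ∀ d s → (∀ N → s (suc (d + N)) ≈[ suc N ] s (d + N)) → (λ N → s (d + N)) ⟶ diagonal d s
diagonal-⟶ d s cauchy N = upTo λ n n<N → below (eventually (ℕ.≤⇒≤′ (ℕ.<⇒≤ n<N))) n ≤-refl
  where

  eventually : ∀ {n N} → n ≤′ N → s (d + N) ≈[ suc n ] s (d + n)
  eventually ≤′-refl = ≈[]-refl
  eventually {n} {suc N} (≤′-step n≤N) = ≈[]-trans
    (≈[]-weaken (s≤s (ℕ.≤′⇒≤ n≤N)) (subst (λ k → s k ≈[ suc N ] s (d + N)) (sym (ℕ.+-suc d N)) (cauchy N)))
    (eventually n≤N)

-- Monomials

opaque
  infix 9 q^_
  q^_ : ℕ → Series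
  q^_ = monomial

  q^-zero : ∀ k → (q^ (suc k)) 0 ≡ 0ℤ
  q^-zero k = refl

  q^-suc-at : ∀ k n → (q^ (suc k)) (suc n) ≡ (q^ k) n
  -- `monomial` tests with `isYes`, but the comparison of two successors reduces only under `does`.
  q^-suc-at k n = cong (λ b → if b then 1ℤ else 0ℤ)
    (trans (isYes≗does (suc n ℕ.≟ suc k)) (sym (isYes≗does (n ℕ.≟ k))))

  q^0 : q^ 0 ≈ 𝟙
  q^0 = coefficientwise λ { zero → refl ; (suc n) → refl }

  q^1 : q^ 1 ≡ q
  q^1 = refl

  q^≡0 : ∀ k n → n < k → (q^ k) n ≡ 0ℤ
  q^≡0 (suc k) zero    _         = refl
  q^≡0 (suc k) (suc n) (s<s n<k) = trans (q^-suc-at k n) (q^≡0 k n n<k)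

q⊗-zero : ∀ F → (q^ 1 ⊗ F) 0 ≡ 0ℤ
q⊗-zero F = trans (⊗-zero (q^ 1) F) (cong (ℤ._* F 0) (q^-zero 0))

q⊗-suc : ∀ F n → (q^ 1 ⊗ F) (suc n) ≡ F n
q⊗-suc F n = begin
  (q^ 1 ⊗ F) (suc n)                                  ≡⟨ ⊗-suc (q^ 1) F n ⟩
  (q^ 1) 0 ℤ.* F (suc n) ℤ.+ (tail (q^ 1) ⊗ F) n      ≡⟨ cong₂ (λ a b → a ℤ.* F (suc n) ℤ.+ b) (q^-zero 0)
                                                          (at (R.*-congʳ
                                                              (R.trans (coefficientwise (q^-suc-at 0)) q^0)) n) ⟩
  0ℤ ℤ.+ (𝟙 ⊗ F) n                                    ≡⟨ ℤ.+-identityˡ _ ⟩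
  (𝟙 ⊗ F) n                                           ≡⟨ at (R.*-identityˡ F) n ⟩
  F n                                                 ∎
  where open ≡-Reasoning

q^-suc : ∀ k → q^ (suc k) ≈ q^ 1 ⊗ q^ k
q^-suc k = coefficientwise λ
  { zero    → trans (q^-zero k) (sym (q⊗-zero (q^ k)))
  ; (suc n) → trans (q^-suc-at k n) (sym (q⊗-suc (q^ k) n)) }

q^-+ : ∀ j k → q^ (j + k) ≈ q^ j ⊗ q^ k
q^-+ zero    k = R.sym (R.trans (R.*-congʳ q^0) (R.*-identityˡ _))
q^-+ (suc j) k = begin
  q^ (suc (j + k))          ≈⟨ q^-suc (j + k) ⟩
  q^ 1 ⊗ q^ (j + k)         ≈⟨ R.*-congˡ (q^-+ j k) ⟩
  q^ 1 ⊗ (q^ j ⊗ q^ k)      ≈⟨ R.*-assoc _ _ _ ⟨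
  q^ 1 ⊗ q^ j ⊗ q^ k        ≈⟨ R.*-congʳ (q^-suc j) ⟨
  q^ (suc j) ⊗ q^ k         ∎
  where open ≈R

q^-≡ : ∀ {j k} → j ≡ k → q^ j ≈ q^ k
q^-≡ refl = R.refl

q^-small : ∀ {N k} → N ≤ k → q^ k ≈[ N ] 𝟘
q^-small {k = k} N≤k = upTo λ n n<N → trans (q^≡0 k n (<-≤-trans n<N N≤k)) (sym (𝟘-at n))

q⊗-cancel : ∀ {F G} → q^ 1 ⊗ F ≈ q^ 1 ⊗ G → F ≈ G
q⊗-cancel {F} {G} qF≈qG = coefficientwise λ n →
  trans (sym (q⊗-suc F n)) (trans (at qF≈qG (suc n)) (q⊗-suc G n))

q^⊗-cancel : ∀ k {F G} → q^ k ⊗ F ≈ q^ k ⊗ G → F ≈ G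
q^⊗-cancel zero    {F} {G} eq = R.trans (R.sym (unit F)) (R.trans eq (unit G))
  where
  unit : ∀ F → q^ 0 ⊗ F ≈ F
  unit F = R.trans (R.*-congʳ q^0) (R.*-identityˡ F)
q^⊗-cancel (suc k) {F} {G} eq = q^⊗-cancel k (q⊗-cancel (R.trans (R.sym (split F)) (R.trans eq (split G))))
  where
  split : ∀ F → q^ (suc k) ⊗ F ≈ q^ 1 ⊗ (q^ k ⊗ F)
  split F = R.trans (R.*-congʳ (q^-suc k)) (R.*-assoc _ _ _)

-- Trisection: V substitutes q³ for q, and F(q) = D₀F(q³) + q D₁F(q³) + q² D₂F(q³).

opaque
  V D₀ D₁ D₂ : Series → Series
  V F 0                   = F 0
  V F 1                   = 0ℤ
  V F 2                   = 0ℤ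
  V F (suc (suc (suc n))) = V (tail F) n
  D₀ F n = F (n * 3)
  D₁ F n = F (1 + n * 3)
  D₂ F n = F (2 + n * 3)

  D₀-at : ∀ F n → D₀ F n ≡ F (n * 3)
  D₀-at F n = refl

  D₂-at : ∀ F n → D₂ F n ≡ F (2 + n * 3)
  D₂-at F n = refl

  V-zero : ∀ F → V F 0 ≡ F 0
  V-zero F = refl

  D₀-cong : ∀ {F G} → F ≈ G → D₀ F ≈ D₀ G
  D₀-cong F≈G = coefficientwise λ n → at F≈G (n * 3)

  D₁-cong : ∀ {F G} → F ≈ G → D₁ F ≈ D₁ G
  D₁-cong F≈G = coefficientwise λ n → at F≈G (1 + n * 3)

  D₂-cong : ∀ {F G} → F ≈ G → D₂ F ≈ D₂ G
  D₂-cong F≈G = coefficientwise λ n → at F≈G (2 + n * 3)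

  V-cong-at : ∀ n {F G} → (∀ m → m ≤ n → F m ≡ G m) → V F n ≡ V G n
  V-cong-at 0                   F≡G = F≡G 0 z≤n
  V-cong-at 1                   F≡G = refl
  V-cong-at 2                   F≡G = refl
  V-cong-at (suc (suc (suc n))) F≡G =
    V-cong-at n λ m m≤n → F≡G (suc m) (s≤s (≤-trans m≤n (m≤n⇒m≤1+n (m≤n⇒m≤1+n ≤-refl))))

  D₀-cong[] : ∀ {N F G} → F ≈[ N * 3 ] G → D₀ F ≈[ N ] D₀ G
  D₀-cong[] F≈G = upTo λ n n<N → below F≈G (n * 3) (ℕ.*-monoˡ-< 3 n<N)

  D₁-cong[] : ∀ {N F G} → F ≈[ N * 3 ] G → D₁ F ≈[ N ] D₁ G
  D₁-cong[] F≈G = upTo λ n n<N → below F≈G (1 + n * 3)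
    (≤-trans (s≤s (s≤s (m≤n⇒m≤1+n ≤-refl))) (ℕ.*-monoˡ-≤ 3 n<N))

  D₂-cong[] : ∀ {N F G} → F ≈[ N * 3 ] G → D₂ F ≈[ N ] D₂ G
  D₂-cong[] F≈G = upTo λ n n<N → below F≈G (2 + n * 3) (ℕ.*-monoˡ-≤ 3 n<N)

  D₀V : ∀ F → D₀ (V F) ≈ F
  D₀V F = coefficientwise λ n → pointwise F n
    where
    pointwise : ∀ F n → V F (n * 3) ≡ F n
    pointwise F zero    = refl
    pointwise F (suc n) = pointwise (tail F) n

  D₁V : ∀ F → D₁ (V F) ≈ 𝟘
  D₁V F = coefficientwise λ n → trans (pointwise F n) (sym (𝟘-at n))
    where
    pointwise : ∀ F n → V F (1 + n * 3) ≡ 0ℤ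
    pointwise F zero    = refl
    pointwise F (suc n) = pointwise (tail F) n

  D₂V : ∀ F → D₂ (V F) ≈ 𝟘
  D₂V F = coefficientwise λ n → trans (pointwise F n) (sym (𝟘-at n))
    where
    pointwise : ∀ F n → V F (2 + n * 3) ≡ 0ℤ
    pointwise F zero    = refl
    pointwise F (suc n) = pointwise (tail F) n

  D₀-⊕ : ∀ F G → D₀ (F ⊕ G) ≈ D₀ F ⊕ D₀ G
  D₀-⊕ F G = coefficientwise λ n → trans (⊕-at F G _) (sym (⊕-at (D₀ F) (D₀ G) n))

  D₁-⊕ : ∀ F G → D₁ (F ⊕ G) ≈ D₁ F ⊕ D₁ G
  D₁-⊕ F G = coefficientwise λ n → trans (⊕-at F G _) (sym (⊕-at (D₁ F) (D₁ G) n))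

  D₂-⊕ : ∀ F G → D₂ (F ⊕ G) ≈ D₂ F ⊕ D₂ G
  D₂-⊕ F G = coefficientwise λ n → trans (⊕-at F G _) (sym (⊕-at (D₂ F) (D₂ G) n))

  -- Multiplication by q moves each section on by one residue; wrapping around from 2 to 0 costs a
  -- factor q.
  D₀-q⊗ : ∀ F → D₀ (q^ 1 ⊗ F) ≈ q^ 1 ⊗ D₂ F
  D₀-q⊗ F = coefficientwise λ
    { zero → trans (q⊗-zero F) (sym (q⊗-zero (D₂ F)))
    ; (suc n) → trans (q⊗-suc F (2 + n * 3)) (sym (q⊗-suc (D₂ F) n)) }

  D₁-q⊗ : ∀ F → D₁ (q^ 1 ⊗ F) ≈ D₀ F
  D₁-q⊗ F = coefficientwise λ n → q⊗-suc F (n * 3)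

  D₂-q⊗ : ∀ F → D₂ (q^ 1 ⊗ F) ≈ D₁ F
  D₂-q⊗ F = coefficientwise λ n → q⊗-suc F (1 + n * 3)

  private
    V⊗-1 : ∀ F G → (V F ⊗ G) 1 ≡ F 0 ℤ.* G 1
    V⊗-1 F G = trans (⊗-suc (V F) G 0)
      (trans (cong (ℤ._+_ (F 0 ℤ.* G 1)) (⊗-zero (tail (V F)) G)) (ℤ.+-identityʳ _))

    V⊗-2 : ∀ F G → (V F ⊗ G) 2 ≡ F 0 ℤ.* G 2
    V⊗-2 F G = trans (⊗-suc (V F) G 1)
      (trans (cong (ℤ._+_ (F 0 ℤ.* G 2)) (trans (⊗-suc (tail (V F)) G 0)
        (trans (ℤ.+-identityˡ _) (⊗-zero (tail (tail (V F))) G)))) (ℤ.+-identityʳ _))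

    V⊗-3+ : ∀ F G n → (V F ⊗ G) (3 + n) ≡ F 0 ℤ.* G (3 + n) ℤ.+ (V (tail F) ⊗ G) n
    V⊗-3+ F G n = trans (⊗-suc (V F) G (2 + n)) (cong (ℤ._+_ (F 0 ℤ.* G (3 + n)))
      (trans (⊗-suc (tail (V F)) G (1 + n)) (trans (ℤ.+-identityˡ _)
      (trans (⊗-suc (tail (tail (V F))) G n) (ℤ.+-identityˡ _)))))

  -- Sections are linear over series in q³. This allows factors such as `V b` or `V G⁴` to be moved
  -- out of an extraction and then cancelled.
  D₀-V⊗ : ∀ F G → D₀ (V F ⊗ G) ≈ F ⊗ D₀ G
  D₀-V⊗ F G = coefficientwise (pointwise F)
    where
    pointwise : ∀ F n → (V F ⊗ G) (n * 3) ≡ (F ⊗ D₀ G) n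
    pointwise F zero    = trans (⊗-zero (V F) G) (sym (⊗-zero F (D₀ G)))
    pointwise F (suc n) = trans (V⊗-3+ F G (n * 3))
      (trans (cong (ℤ._+_ (F 0 ℤ.* G (3 + n * 3))) (pointwise (tail F) n)) (sym (⊗-suc F (D₀ G) n)))

  D₁-V⊗ : ∀ F G → D₁ (V F ⊗ G) ≈ F ⊗ D₁ G
  D₁-V⊗ F G = coefficientwise (pointwise F)
    where
    pointwise : ∀ F n → (V F ⊗ G) (1 + n * 3) ≡ (F ⊗ D₁ G) n
    pointwise F zero    = trans (V⊗-1 F G) (sym (⊗-zero F (D₁ G)))
    pointwise F (suc n) = trans (V⊗-3+ F G (1 + n * 3))
      (trans (cong (ℤ._+_ (F 0 ℤ.* G (4 + n * 3))) (pointwise (tail F) n)) (sym (⊗-suc F (D₁ G) n)))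

  D₂-V⊗ : ∀ F G → D₂ (V F ⊗ G) ≈ F ⊗ D₂ G
  D₂-V⊗ F G = coefficientwise (pointwise F)
    where
    pointwise : ∀ F n → (V F ⊗ G) (2 + n * 3) ≡ (F ⊗ D₂ G) n
    pointwise F zero    = trans (V⊗-2 F G) (sym (⊗-zero F (D₂ G)))
    pointwise F (suc n) = trans (V⊗-3+ F G (2 + n * 3))
      (trans (cong (ℤ._+_ (F 0 ℤ.* G (5 + n * 3))) (pointwise (tail F) n)) (sym (⊗-suc F (D₂ G) n)))

  D-ext : ∀ {F G} → D₀ F ≈ D₀ G → D₁ F ≈ D₁ G → D₂ F ≈ D₂ G → F ≈ G
  D-ext {F} {G} e₀ e₁ e₂ = coefficientwise λ n → pointwise n F G (at e₀) (at e₁) (at e₂)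
    where
    pointwise : ∀ n F G → D₀ F ≈ˢ D₀ G → D₁ F ≈ˢ D₁ G → D₂ F ≈ˢ D₂ G → F n ≡ G n
    pointwise 0 F G e₀ e₁ e₂ = e₀ 0
    pointwise 1 F G e₀ e₁ e₂ = e₁ 0
    pointwise 2 F G e₀ e₁ e₂ = e₂ 0
    pointwise (suc (suc (suc n))) F G e₀ e₁ e₂ =
      pointwise n (tail (tail (tail F))) (tail (tail (tail G))) (e₀ ∘ suc) (e₁ ∘ suc) (e₂ ∘ suc)

V-cong : ∀ {F G} → F ≈ G → V F ≈ V G
V-cong F≈G = coefficientwise λ n → V-cong-at n λ m _ → at F≈G m

V-cong[] : ∀ {N F G} → F ≈[ N ] G → V F ≈[ N ] V G
V-cong[] F≈G = upTo λ n n<N → V-cong-at n λ m m≤n → below F≈G m (ℕ.≤-<-trans m≤n n<N)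

q² : q^ 2 ≈ q^ 1 ⊗ q^ 1
q² = q^-suc 1

private
  module _ (a b c : Series) where
    trisect : Series
    trisect = V a ⊕ q^ 1 ⊗ V b ⊕ q^ 2 ⊗ V c

    trisected-⊗ : ∀ H → trisect ⊗ H ≈ V a ⊗ H ⊕ q^ 1 ⊗ (V b ⊗ H) ⊕ q^ 1 ⊗ (q^ 1 ⊗ (V c ⊗ H))
    trisected-⊗ H = R.trans (R.*-congʳ (R.+-congˡ (R.*-congʳ q²)))
      (solve 5 (λ a b c q h → (a :+ q :* b :+ q :* q :* c) :* h := a :* h :+ q :* (b :* h) :+ q :* (q :* (c :* h)))
        R.refl (V a) (V b) (V c) (q^ 1) H)

D₀-trisected⊗ : ∀ a b c H → D₀ ((V a ⊕ q^ 1 ⊗ V b ⊕ q^ 2 ⊗ V c) ⊗ H)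
    ≈ a ⊗ D₀ H ⊕ q^ 1 ⊗ (b ⊗ D₂ H) ⊕ q^ 1 ⊗ (c ⊗ D₁ H)
D₀-trisected⊗ a b c H = begin
  D₀ (trisect a b c ⊗ H)
    ≈⟨ D₀-cong (trisected-⊗ a b c H) ⟩
  D₀ (V a ⊗ H ⊕ q^ 1 ⊗ (V b ⊗ H) ⊕ q^ 1 ⊗ (q^ 1 ⊗ (V c ⊗ H)))
    ≈⟨ R.trans (D₀-⊕ _ _) (R.+-congʳ (D₀-⊕ _ _)) ⟩
  D₀ (V a ⊗ H) ⊕ D₀ (q^ 1 ⊗ (V b ⊗ H)) ⊕ D₀ (q^ 1 ⊗ (q^ 1 ⊗ (V c ⊗ H)))
    ≈⟨ R.+-cong (R.+-cong (D₀-V⊗ a H) (R.trans (D₀-q⊗ _) (R.*-congˡ (D₂-V⊗ b H))))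
                (R.trans (D₀-q⊗ _) (R.*-congˡ (R.trans (D₂-q⊗ _) (D₁-V⊗ c H)))) ⟩
  a ⊗ D₀ H ⊕ q^ 1 ⊗ (b ⊗ D₂ H) ⊕ q^ 1 ⊗ (c ⊗ D₁ H) ∎
  where open ≈R

D₁-trisected⊗ : ∀ a b c H → D₁ ((V a ⊕ q^ 1 ⊗ V b ⊕ q^ 2 ⊗ V c) ⊗ H) ≈ a ⊗ D₁ H ⊕ b ⊗ D₀ H ⊕ q^ 1 ⊗ (c ⊗ D₂ H)
D₁-trisected⊗ a b c H = begin
  D₁ (trisect a b c ⊗ H)
    ≈⟨ D₁-cong (trisected-⊗ a b c H) ⟩
  D₁ (V a ⊗ H ⊕ q^ 1 ⊗ (V b ⊗ H) ⊕ q^ 1 ⊗ (q^ 1 ⊗ (V c ⊗ H)))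
    ≈⟨ R.trans (D₁-⊕ _ _) (R.+-congʳ (D₁-⊕ _ _)) ⟩
  D₁ (V a ⊗ H) ⊕ D₁ (q^ 1 ⊗ (V b ⊗ H)) ⊕ D₁ (q^ 1 ⊗ (q^ 1 ⊗ (V c ⊗ H)))
    ≈⟨ R.+-cong (R.+-cong (D₁-V⊗ a H) (R.trans (D₁-q⊗ _) (D₀-V⊗ b H)))
                (R.trans (D₁-q⊗ _) (R.trans (D₀-q⊗ _) (R.*-congˡ (D₂-V⊗ c H)))) ⟩
  a ⊗ D₁ H ⊕ b ⊗ D₀ H ⊕ q^ 1 ⊗ (c ⊗ D₂ H) ∎
  where open ≈R

D₂-trisected⊗ : ∀ a b c H → D₂ ((V a ⊕ q^ 1 ⊗ V b ⊕ q^ 2 ⊗ V c) ⊗ H) ≈ a ⊗ D₂ H ⊕ b ⊗ D₁ H ⊕ c ⊗ D₀ H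
D₂-trisected⊗ a b c H = begin
  D₂ (trisect a b c ⊗ H)
    ≈⟨ D₂-cong (trisected-⊗ a b c H) ⟩
  D₂ (V a ⊗ H ⊕ q^ 1 ⊗ (V b ⊗ H) ⊕ q^ 1 ⊗ (q^ 1 ⊗ (V c ⊗ H)))
    ≈⟨ R.trans (D₂-⊕ _ _) (R.+-congʳ (D₂-⊕ _ _)) ⟩
  D₂ (V a ⊗ H) ⊕ D₂ (q^ 1 ⊗ (V b ⊗ H)) ⊕ D₂ (q^ 1 ⊗ (q^ 1 ⊗ (V c ⊗ H)))
    ≈⟨ R.+-cong (R.+-cong (D₂-V⊗ a H) (R.trans (D₂-q⊗ _) (D₁-V⊗ b H)))
                (R.trans (D₂-q⊗ _) (R.trans (D₁-q⊗ _) (D₀-V⊗ c H))) ⟩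
  a ⊗ D₂ H ⊕ b ⊗ D₁ H ⊕ c ⊗ D₀ H ∎
  where open ≈R

opaque
  unfolding V

  V-scalar : ∀ c → V (scalar c) ≈ scalar c
  V-scalar c = coefficientwise pointwise
    where
    zeros : ∀ n → V (λ _ → 0ℤ) n ≡ 0ℤ
    zeros 0 = refl
    zeros 1 = refl
    zeros 2 = refl
    zeros (suc (suc (suc n))) = zeros n
    pointwise : V (scalar c) ≈ˢ scalar c
    pointwise 0 = refl
    pointwise 1 = refl
    pointwise 2 = refl
    pointwise (suc (suc (suc n))) = zeros n

V-𝟙 : V 𝟙 ≈ 𝟙
V-𝟙 = V-scalar 1ℤ

D₀-𝟙 : D₀ 𝟙 ≈ 𝟙
D₀-𝟙 = R.trans (D₀-cong (R.sym V-𝟙)) (D₀V 𝟙)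

D₁-𝟙 : D₁ 𝟙 ≈ 𝟘
D₁-𝟙 = R.trans (D₁-cong (R.sym V-𝟙)) (D₁V 𝟙)

D₂-𝟙 : D₂ 𝟙 ≈ 𝟘
D₂-𝟙 = R.trans (D₂-cong (R.sym V-𝟙)) (D₂V 𝟙)

D₀-trisected : ∀ a b c → D₀ (V a ⊕ q^ 1 ⊗ V b ⊕ q^ 2 ⊗ V c) ≈ a
D₀-trisected a b c = begin
  D₀ (trisect a b c)                                 ≈⟨ D₀-cong (R.*-identityʳ _) ⟨
  D₀ (trisect a b c ⊗ 𝟙)                             ≈⟨ D₀-trisected⊗ a b c 𝟙 ⟩
  a ⊗ D₀ 𝟙 ⊕ q^ 1 ⊗ (b ⊗ D₂ 𝟙) ⊕ q^ 1 ⊗ (c ⊗ D₁ 𝟙)   ≈⟨ R.+-cong (R.+-cong (R.*-congˡ D₀-𝟙) (R.*-congˡ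
      (R.*-congˡ D₂-𝟙)))
                                                                  (R.*-congˡ (R.*-congˡ D₁-𝟙)) ⟩
  a ⊗ 𝟙 ⊕ q^ 1 ⊗ (b ⊗ 𝟘) ⊕ q^ 1 ⊗ (c ⊗ 𝟘)            ≈⟨ solve 4 (λ a b c q
      → a :* con 1ℤ :+ q :* (b :* con 0ℤ) :+ q :* (c :* con 0ℤ) := a) R.refl a b c (q^ 1) ⟩
  a                                                  ∎
  where open ≈R

D₁-trisected : ∀ a b c → D₁ (V a ⊕ q^ 1 ⊗ V b ⊕ q^ 2 ⊗ V c) ≈ b
D₁-trisected a b c = begin
  D₁ (trisect a b c)                                 ≈⟨ D₁-cong (R.*-identityʳ _) ⟨
  D₁ (trisect a b c ⊗ 𝟙)                             ≈⟨ D₁-trisected⊗ a b c 𝟙 ⟩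
  a ⊗ D₁ 𝟙 ⊕ b ⊗ D₀ 𝟙 ⊕ q^ 1 ⊗ (c ⊗ D₂ 𝟙)            ≈⟨ R.+-cong (R.+-cong (R.*-congˡ D₁-𝟙) (R.*-congˡ D₀-𝟙))
                                                                  (R.*-congˡ (R.*-congˡ D₂-𝟙)) ⟩
  a ⊗ 𝟘 ⊕ b ⊗ 𝟙 ⊕ q^ 1 ⊗ (c ⊗ 𝟘)                     ≈⟨ solve 4 (λ a b c q
      → a :* con 0ℤ :+ b :* con 1ℤ :+ q :* (c :* con 0ℤ) := b) R.refl a b c (q^ 1) ⟩
  b                                                  ∎
  where open ≈R

D₂-trisected : ∀ a b c → D₂ (V a ⊕ q^ 1 ⊗ V b ⊕ q^ 2 ⊗ V c) ≈ c
D₂-trisected a b c = begin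
  D₂ (trisect a b c)                                 ≈⟨ D₂-cong (R.*-identityʳ _) ⟨
  D₂ (trisect a b c ⊗ 𝟙)                             ≈⟨ D₂-trisected⊗ a b c 𝟙 ⟩
  a ⊗ D₂ 𝟙 ⊕ b ⊗ D₁ 𝟙 ⊕ c ⊗ D₀ 𝟙                     ≈⟨ R.+-cong (R.+-cong (R.*-congˡ D₂-𝟙) (R.*-congˡ D₁-𝟙))
      (R.*-congˡ D₀-𝟙) ⟩
  a ⊗ 𝟘 ⊕ b ⊗ 𝟘 ⊕ c ⊗ 𝟙                              ≈⟨ solve 3 (λ a b c → a :* con 0ℤ :+ b :* con 0ℤ :+ c :* con 1ℤ
      := c) R.refl a b c ⟩
  c                                                  ∎
  where open ≈R

trisection : ∀ F → F ≈ V (D₀ F) ⊕ q^ 1 ⊗ V (D₁ F) ⊕ q^ 2 ⊗ V (D₂ F)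
trisection F = D-ext (R.sym (D₀-trisected _ _ _)) (R.sym (D₁-trisected _ _ _)) (R.sym (D₂-trisected _ _ _))

D₀-⊗ : ∀ F G → D₀ (F ⊗ G) ≈ D₀ F ⊗ D₀ G ⊕ q^ 1 ⊗ (D₁ F ⊗ D₂ G) ⊕ q^ 1 ⊗ (D₂ F ⊗ D₁ G)
D₀-⊗ F G = R.trans (D₀-cong (R.*-congʳ (trisection F))) (D₀-trisected⊗ _ _ _ G)

D₁-⊗ : ∀ F G → D₁ (F ⊗ G) ≈ D₀ F ⊗ D₁ G ⊕ D₁ F ⊗ D₀ G ⊕ q^ 1 ⊗ (D₂ F ⊗ D₂ G)
D₁-⊗ F G = R.trans (D₁-cong (R.*-congʳ (trisection F))) (D₁-trisected⊗ _ _ _ G)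

D₂-⊗ : ∀ F G → D₂ (F ⊗ G) ≈ D₀ F ⊗ D₂ G ⊕ D₁ F ⊗ D₁ G ⊕ D₂ F ⊗ D₀ G
D₂-⊗ F G = R.trans (D₂-cong (R.*-congʳ (trisection F))) (D₂-trisected⊗ _ _ _ G)

V-⊗ : ∀ F G → V (F ⊗ G) ≈ V F ⊗ V G
V-⊗ F G = D-ext
  (R.trans (D₀V _) (R.sym (R.trans (D₀-V⊗ F (V G)) (R.*-congˡ (D₀V G)))))
  (R.trans (D₁V _) (R.sym (R.trans (D₁-V⊗ F (V G)) (R.trans (R.*-congˡ (D₁V G)) (R.zeroʳ F)))))
  (R.trans (D₂V _) (R.sym (R.trans (D₂-V⊗ F (V G)) (R.trans (R.*-congˡ (D₂V G)) (R.zeroʳ F)))))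

V-⊕ : ∀ F G → V (F ⊕ G) ≈ V F ⊕ V G
V-⊕ F G = D-ext
  (R.trans (D₀V _) (R.sym (R.trans (D₀-⊕ _ _) (R.+-cong (D₀V F) (D₀V G)))))
  (R.trans (D₁V _) (R.sym (R.trans (D₁-⊕ _ _) (R.trans (R.+-cong (D₁V F) (D₁V G)) (R.+-identityʳ _)))))
  (R.trans (D₂V _) (R.sym (R.trans (D₂-⊕ _ _) (R.trans (R.+-cong (D₂V F) (D₂V G)) (R.+-identityʳ _)))))

⊝-scalar : ∀ F → ⊝ F ≈ scalar (ℤ.- 1ℤ) ⊗ F
⊝-scalar F = solve 1 (λ f → :- f := con (ℤ.- 1ℤ) :* f) R.refl F

V-scalar⊗ : ∀ c F → V (scalar c ⊗ F) ≈ scalar c ⊗ V F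
V-scalar⊗ c F = R.trans (V-⊗ _ _) (R.*-congʳ (V-scalar c))

V-⊝ : ∀ F → V (⊝ F) ≈ ⊝ V F
V-⊝ F = R.trans (V-cong (⊝-scalar F)) (R.trans (V-scalar⊗ _ F) (R.sym (⊝-scalar (V F))))

D₀-scalar⊗ : ∀ c F → D₀ (scalar c ⊗ F) ≈ scalar c ⊗ D₀ F
D₀-scalar⊗ c F = R.trans (D₀-cong (R.*-congʳ (R.sym (V-scalar c)))) (D₀-V⊗ (scalar c) F)

D₂-scalar⊗ : ∀ c F → D₂ (scalar c ⊗ F) ≈ scalar c ⊗ D₂ F
D₂-scalar⊗ c F = R.trans (D₂-cong (R.*-congʳ (R.sym (V-scalar c)))) (D₂-V⊗ (scalar c) F)

V-q : V (q^ 1) ≈ q^ 3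
V-q = D-ext (R.trans (D₀V _) (R.sym (R.trans (D₀-cong q³) (R.trans (D₀-q⊗ _) (R.trans (R.*-congˡ (R.trans (D₂-q⊗ _)
    (R.trans (D₁-q⊗ 𝟙) D₀-𝟙))) (R.*-identityʳ _))))))
            (R.trans (D₁V _) (R.sym (R.trans (D₁-cong q³) (R.trans (D₁-q⊗ _) (R.trans (D₀-q⊗ _) (R.trans (R.*-congˡ
                (R.trans (D₂-q⊗ 𝟙) D₁-𝟙)) (R.zeroʳ _)))))))
            (R.trans (D₂V _) (R.sym (R.trans (D₂-cong q³) (R.trans (D₂-q⊗ _) (R.trans (D₁-q⊗ _) (R.trans (D₀-q⊗ 𝟙)
                (R.trans (R.*-congˡ D₂-𝟙) (R.zeroʳ _))))))))
  where
  q³ : q^ 3 ≈ q^ 1 ⊗ (q^ 1 ⊗ (q^ 1 ⊗ 𝟙))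
  q³ = R.trans (q^-suc 2) (R.*-congˡ (R.trans q² (R.*-congˡ (R.sym (R.*-identityʳ _)))))

V-q^ : ∀ k → V (q^ k) ≈ q^ (k * 3)
V-q^ zero    = R.trans (V-cong q^0) (R.trans V-𝟙 (R.sym q^0))
V-q^ (suc k) = R.trans (V-cong (q^-suc k)) (R.trans (V-⊗ _ _) (R.trans (R.*-cong V-q (V-q^ k))
    (R.sym (q^-+ 3 (k * 3)))))

-- Products

∏ : (ℕ → Series) → ℕ → Series
∏ s zero    = 𝟙
∏ s (suc n) = ∏ s n ⊗ s n

∏-cong : ∀ {s t} → (∀ i → s i ≈ t i) → ∀ n → ∏ s n ≈ ∏ t n
∏-cong s≈t zero    = R.refl
∏-cong s≈t (suc n) = R.*-cong (∏-cong s≈t n) (s≈t n)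

∏-⊗ : ∀ s t n → ∏ (λ i → s i ⊗ t i) n ≈ ∏ s n ⊗ ∏ t n
∏-⊗ s t zero    = R.sym (R.*-identityʳ 𝟙)
∏-⊗ s t (suc n) = R.trans (R.*-congʳ (∏-⊗ s t n)) (interchange _ _ _ _)

∏-sucˡ : ∀ s n → ∏ s (suc n) ≈ s 0 ⊗ ∏ (s ∘ suc) n
∏-sucˡ s zero    = R.*-comm _ _
∏-sucˡ s (suc n) = R.trans (R.*-congʳ (∏-sucˡ s n)) (R.*-assoc _ _ _)

∏-pairs : ∀ s n → ∏ s (n * 2) ≈ ∏ (λ i → s (i * 2) ⊗ s (1 + i * 2)) n
∏-pairs s zero    = R.refl
∏-pairs s (suc n) = R.trans (R.*-assoc _ _ _) (R.*-congʳ (∏-pairs s n))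

∏-triples : ∀ s n → ∏ s (n * 3) ≈ ∏ (λ i → s (i * 3) ⊗ s (1 + i * 3) ⊗ s (2 + i * 3)) n
∏-triples s zero    = R.refl
∏-triples s (suc n) = R.trans (R.*-assoc _ _ _) (R.trans (R.*-assoc _ _ _)
  (R.*-cong (∏-triples s n) (R.sym (R.*-assoc _ _ _))))

factor : ℤ → ℕ → Series
factor c k = 𝟙 ⊕ scalar c ⊗ q^ k

factor-≈[]𝟙 : ∀ c {k N} → N ≤ k → factor c k ≈[ N ] 𝟙
factor-≈[]𝟙 c {k} N≤k = ≈[]-≈ (⊕-cong[] ≈[]-refl (⊗-cong[] ≈[]-refl (q^-small N≤k)))
  (R.trans (R.+-congˡ (R.zeroʳ _)) (R.+-identityʳ 𝟙))

factor-≡ : ∀ c {j k} → j ≡ k → factor c j ≈ factor c k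
factor-≡ c refl = R.refl

-- The coefficient of qⁿ is read off after n factors, as in `∏ˢ₁`, so that `f k` agrees with such a
-- product coefficient by coefficient. The limit is the intended one when i < e i.
∏∞ : ℤ → (ℕ → ℕ) → Series
∏∞ c e = diagonal 0 (∏ (λ i → factor c (e i)))

∏∞-⟶ : ∀ c e → (∀ i → i < e i) → ∏ (λ i → factor c (e i)) ⟶ ∏∞ c e
∏∞-⟶ c e i<ei = diagonal-⟶ 0 _ λ N →
  ≈[]-≈ (⊗-cong[] ≈[]-refl (factor-≈[]𝟙 c (i<ei N))) (R.*-identityʳ _)

V-factor : ∀ c k → V (factor c k) ≈ factor c (k * 3)
V-factor c k = R.trans (V-⊕ _ _) (R.+-cong V-𝟙 (R.trans (V-scalar⊗ c _) (R.*-congˡ (V-q^ k))))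

V-∏ : ∀ s n → V (∏ s n) ≈ ∏ (V ∘ s) n
V-∏ s zero    = V-𝟙
V-∏ s (suc n) = R.trans (V-⊗ _ _) (R.*-congʳ (V-∏ s n))

opaque
  unfolding _⊕_ q^_

  1ˢ-≈ : 1ˢ ≈ 𝟙
  1ˢ-≈ = q^0

  -ˢ-≡ : ∀ F G → F -ˢ G ≡ F ⊖ G
  -ˢ-≡ F G = refl

  *ˢ-≡ : ∀ F G → F *ˢ G ≡ F ⊗ G
  *ˢ-≡ F G = refl

  ^ˢ-suc : ∀ F n → F ^ˢ suc n ≡ F ⊗ F ^ˢ n
  ^ˢ-suc F n = refl

  productˢ-suc : ∀ s n → productˢ {suc n} (s ∘ toℕ) ≡ s 0 ⊗ productˢ {n} (s ∘ suc ∘ toℕ)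
  productˢ-suc s n = refl

^ˢ-≈ : ∀ F n → F ^ˢ n ≈ F ↑ n
^ˢ-≈ F zero    = 1ˢ-≈
^ˢ-≈ F (suc n) = R.trans (R.reflexive (^ˢ-suc F n)) (R.*-congˡ (^ˢ-≈ F n))

productˢ-≈ : ∀ s n → productˢ {n} (s ∘ toℕ) ≈ ∏ s n
productˢ-≈ s zero    = 1ˢ-≈
productˢ-≈ s (suc n) = R.trans (R.reflexive (productˢ-suc s n))
  (R.trans (R.*-congˡ (productˢ-≈ (s ∘ suc) n)) (R.sym (∏-sucˡ s n)))

q↑ : ∀ k → q ^ˢ k ≈ q^ k
q↑ k = R.trans (^ˢ-≈ q k) (powers k)
  where
  powers : ∀ k → q ↑ k ≈ q^ k
  powers zero    = R.sym q^0
  powers (suc k) = R.trans (R.*-cong (R.reflexive (sym q^1)) (powers k)) (R.sym (q^-suc k))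

factor-f : ∀ k → 1ˢ -ˢ q ^ˢ k ≈ factor -1ℤ k
factor-f k = R.trans (R.reflexive (-ˢ-≡ _ _)) (R.+-cong 1ˢ-≈ (R.trans (R.-‿cong (q↑ k)) (⊝-scalar _)))

f-≈ : ∀ k .{{_ : NonZero k}} → f k ≈ ∏∞ -1ℤ (λ i → k * suc i)
f-≈ k = coefficientwise λ n → at (R.trans (productˢ-≈ (λ i → 1ˢ -ˢ q ^ˢ (k * suc i)) n) (∏-cong (λ i
    → factor-f (k * suc i)) n)) n

f-⟶ : ∀ k .{{_ : NonZero k}} → ∏ (λ i → factor -1ℤ (k * suc i)) ⟶ f k
f-⟶ k N = ≈[]-≈ (∏∞-⟶ -1ℤ (λ i → k * suc i) (λ i → ℕ.m≤n*m (suc i) k) N) (R.sym (f-≈ k))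

V-f : ∀ k .{{_ : NonZero k}} .{{_ : NonZero (3 * k)}} → V (f k) ≈ f (3 * k)
V-f k = ⟶-unique (λ N → ≈⇒≈[] (R.trans (V-∏ _ N) (∏-cong (λ i
    → R.trans (V-factor -1ℤ (k * suc i)) (factor-≡ -1ℤ (reindex k i))) N)))
   (λ N → V-cong[] (f-⟶ k N)) (f-⟶ (3 * k))
  where
  reindex : ∀ k i → k * suc i * 3 ≡ 3 * k * suc i
  reindex = ℕ.solve-∀

f-constant : ∀ k .{{_ : NonZero k}} → f k 0 ≡ 1ℤ
f-constant k = sym (below (f-⟶ k 1) 0 z<s) ⟨ trans ⟩ below (factors 1) 0 z<s
  where
  factors : ∀ n → ∏ (λ i → factor -1ℤ (k * suc i)) n ≈[ 1 ] 𝟙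
  factors zero    = ≈[]-refl
  factors (suc n) = ≈[]-≈ (⊗-cong[] (factors n) (factor-≈[]𝟙 -1ℤ (≤-trans (s≤s z≤n) (ℕ.m≤n*m (suc n) k))))
      (R.*-identityʳ 𝟙)

-- Inverses

module ℤ-sum = SemiringSum (CommutativeRing.semiring ℤ.+-*-commutativeRing)
open ℤ-sum using (sum-syntax; sum⁺-syntax)

∑-last : ∀ (h : ℕ → ℤ) n → ∑[ i ≤ n ] h (toℕ i) ≡ ∑[ i < n ] h (toℕ i) ℤ.+ h n
∑-last h zero    = ℤ.+-comm (h 0) 0ℤ
∑-last h (suc n) = trans (cong (ℤ._+_ (h 0)) (∑-last (h ∘ suc) n)) (sym (ℤ.+-assoc (h 0) _ _))

⊗-constant : ∀ F G → F 0 ≡ 1ℤ → G 0 ≡ 1ℤ → (F ⊗ G) 0 ≡ 1ℤ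
⊗-constant F G F0 G0 = trans (⊗-zero F G) (cong₂ ℤ._*_ F0 G0)

partial : (ℕ → Series) → ℕ → Series
partial s zero    = 𝟘
partial s (suc n) = partial s n ⊕ s n

partial-at : ∀ s n k → partial s n k ≡ ∑[ i < n ] s (toℕ i) k
partial-at s zero    k = 𝟘-at k
partial-at s (suc n) k = trans (⊕-at _ _ k) (trans (cong (ℤ._+ s n k) (partial-at s n k)) (sym (∑-last (λ i
    → s i k) n)))

-- Multiplying a partial sum of the geometric series in g = 1 - F by F telescopes to 1 - gⁿ, and gⁿ
-- is divisible by qⁿ because g has constant term 0.
inverseʳ : ∀ F → F 0 ≡ 1ℤ → F ⊗ inverse F ≈ 𝟙
inverseʳ F F0≡1 = ⟶-unique
  (λ N → ≈[]-trans (≈⇒≈[] (telescope N)) (≈[]-≈ (⊕-cong[] ≈[]-refl (⊝-cong[] (↑-small N))) 1-0))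
  (⟶-⊗ {s = λ _ → F} (λ _ → ≈[]-refl) inverse-⟶)
  (λ N → ≈[]-refl)
  where
  g : Series
  g = 𝟙 ⊖ F
  1-0 : 𝟙 ⊖ 𝟘 ≈ 𝟙
  1-0 = solve 0 (con 1ℤ :- con 0ℤ := con 1ℤ) R.refl
  g≈ : 1ˢ -ˢ F ≈ g
  g≈ = R.trans (R.reflexive (-ˢ-≡ 1ˢ F)) (R.+-congʳ 1ˢ-≈)
  g0 : g 0 ≡ 0ℤ
  g0 = trans (⊕-at 𝟙 (⊝ F) 0) (cong (ℤ._+_ 1ℤ) (trans (⊝-at F 0) (cong ℤ.-_ F0≡1)))
  qtail : g ≈ q^ 1 ⊗ tail g
  qtail = coefficientwise λ { zero → trans g0 (sym (q⊗-zero _)) ; (suc n) → sym (q⊗-suc _ n) }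
  ↑-q : ∀ k → g ↑ k ≈ q^ k ⊗ tail g ↑ k
  ↑-q zero    = R.sym (R.trans (R.*-identityʳ _) q^0)
  ↑-q (suc k) = R.trans (R.*-cong qtail (↑-q k)) (R.trans (interchange _ _ _ _) (R.*-congʳ (R.sym (q^-suc k))))
  ↑-small : ∀ k → g ↑ k ≈[ k ] 𝟘
  ↑-small k = ≈[]-trans (≈⇒≈[] (↑-q k)) (≈[]-≈ (⊗-cong[] (q^-small ≤-refl) ≈[]-refl) (R.zeroˡ _))
  telescope : ∀ n → F ⊗ partial (g ↑_) n ≈ 𝟙 ⊖ g ↑ n
  telescope zero    = solve 1 (λ F → F :* con 0ℤ := con 1ℤ :- con 1ℤ) R.refl F
  telescope (suc n) = R.trans (R.distribˡ F _ _) (R.trans (R.+-congʳ (telescope n))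
    (solve 2 (λ F p → con 1ℤ :- p :+ F :* p := con 1ℤ :- (con 1ℤ :- F) :* p) R.refl F (g ↑ n)))
  inverse≈ : inverse F ≈ diagonal 1 (partial (g ↑_))
  inverse≈ = coefficientwise λ n → trans (ℤ-sum.sum-cong-≗ {suc n} λ i
      → at (R.trans (^ˢ-≈ _ (toℕ i)) (↑-cong (toℕ i))) n)
                                          (sym (partial-at (g ↑_) (suc n) n))
    where
    ↑-cong : ∀ k → (1ˢ -ˢ F) ↑ k ≈ g ↑ k
    ↑-cong zero    = R.refl
    ↑-cong (suc k) = R.*-cong g≈ (↑-cong k)
  step≈ : ∀ N → partial (g ↑_) (suc N) ≈[ N ] partial (g ↑_) N
  step≈ N = ≈[]-≈ (⊕-cong[] ≈[]-refl (↑-small N)) (R.+-identityʳ _)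
  inverse-⟶ : partial (g ↑_) ⟶ inverse F
  -- At qⁿ `inverse` sums n + 1 terms, whence the diagonal with offset 1; the extra term gᴺ is
  -- invisible below qᴺ.
  inverse-⟶ N = ≈[]-trans (≈[]-sym (step≈ N))
    (≈[]-≈ (diagonal-⟶ 1 (partial (g ↑_)) (λ N → step≈ (suc N)) N) (R.sym inverse≈))

inverse-cancelˡ : ∀ F G → F 0 ≡ 1ℤ → inverse F ⊗ (F ⊗ G) ≈ G
inverse-cancelˡ F G F0≡1 = begin
  inverse F ⊗ (F ⊗ G)      ≈⟨ R.*-assoc _ _ _ ⟨
  inverse F ⊗ F ⊗ G        ≈⟨ R.*-congʳ (R.trans (R.*-comm _ _) (inverseʳ F F0≡1)) ⟩
  𝟙 ⊗ G                    ≈⟨ R.*-identityˡ G ⟩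
  G                        ∎
  where open ≈R

⊗-cancelˡ : ∀ F {G H} → F 0 ≡ 1ℤ → F ⊗ G ≈ F ⊗ H → G ≈ H
⊗-cancelˡ F {G} {H} F0≡1 FG≈FH = begin
  G                        ≈⟨ inverse-cancelˡ F G F0≡1 ⟨
  inverse F ⊗ (F ⊗ G)      ≈⟨ R.*-congˡ FG≈FH ⟩
  inverse F ⊗ (F ⊗ H)      ≈⟨ inverse-cancelˡ F H F0≡1 ⟩
  H                        ∎
  where open ≈R

-- Norms of Euler products

-- The norm of F is the product of F(q), F(ωq) and F(ω²q) for a primitive cube root of
-- unity ω, with q in place of q³.
norm-form : Series → Series → Series → Series
norm-form a b c = a ⊗ a ⊗ a ⊕ q^ 1 ⊗ (b ⊗ b ⊗ b) ⊕ q^ 1 ⊗ q^ 1 ⊗ (c ⊗ c ⊗ c) ⊖ scalar (ℤ.+ 3) ⊗ q^ 1 ⊗ (a ⊗ b ⊗ c)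

norm-form-cong : ∀ {a a′ b b′ c c′} → a ≈ a′ → b ≈ b′ → c ≈ c′ → norm-form a b c ≈ norm-form a′ b′ c′
norm-form-cong a b c = R.+-cong (R.+-cong (R.+-cong (R.*-cong (R.*-cong a a) a) (R.*-congˡ (R.*-cong
    (R.*-cong b b) b)))
  (R.*-congˡ (R.*-cong (R.*-cong c c) c))) (R.-‿cong (R.*-congˡ (R.*-cong (R.*-cong a b) c)))

norm : Series → Series
norm F = norm-form (D₀ F) (D₁ F) (D₂ F)

norm-cong : ∀ {F G} → F ≈ G → norm F ≈ norm G
norm-cong F≈G = norm-form-cong (D₀-cong F≈G) (D₁-cong F≈G) (D₂-cong F≈G)

-- The sections of a product multiply like coordinates in R[x]/(x³ - q), R being the ring of series,
-- and the cubic form is the norm of that extension. Multiplicativity is thus one polynomial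
-- identity.
norm-⊗ : ∀ F G → norm (F ⊗ G) ≈ norm F ⊗ norm G
norm-⊗ F G = R.trans (norm-form-cong (D₀-⊗ F G) (D₁-⊗ F G) (D₂-⊗ F G))
  (solve 7 (λ a b c x y z q →
     let d = a :* x :+ q :* (b :* z) :+ q :* (c :* y)
         e = a :* y :+ b :* x :+ q :* (c :* z)
         h = a :* z :+ b :* y :+ c :* x
         n = λ a b c → a :* a :* a :+ q :* (b :* b :* b)
             :+ q :* q :* (c :* c :* c) :- con (ℤ.+ 3) :* q :* (a :* b :* c)
     in n d e h := n a b c :* n x y z) R.refl (D₀ F) (D₁ F) (D₂ F) (D₀ G) (D₁ G) (D₂ G) (q^ 1))

cube : Series → Series
cube F = F ⊗ F ⊗ F

norm-V : ∀ F → norm (V F) ≈ cube F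
norm-V F = R.trans (norm-form-cong (D₀V F) (D₁V F) (D₂V F))
  (solve 2 (λ F q → F :* F :* F :+ q :* (con 0ℤ :* con 0ℤ :* con 0ℤ)
      :+ q :* q :* (con 0ℤ :* con 0ℤ :* con 0ℤ) :- con (ℤ.+ 3) :* q :* (F :* con 0ℤ :* con 0ℤ)
     := F :* F :* F) R.refl F (q^ 1))

norm-trisected : ∀ {F} a b c → F ≈ V a ⊕ q^ 1 ⊗ V b ⊕ q^ 2 ⊗ V c → norm F ≈ norm-form a b c
norm-trisected a b c F≈ = R.trans (norm-cong F≈)
  (norm-form-cong (D₀-trisected a b c) (D₁-trisected a b c) (D₂-trisected a b c))

V-𝟘 : V 𝟘 ≈ 𝟘
V-𝟘 = V-scalar 0ℤ

V-cq^ : ∀ c k → V (scalar c ⊗ q^ k) ≈ scalar c ⊗ q^ (k * 3)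
V-cq^ c k = R.trans (V-scalar⊗ c _) (R.*-congˡ (V-q^ k))

q^-*3 : ∀ k → q^ (k * 3) ≈ cube (q^ k)
q^-*3 k = R.trans (q^-≡ (reindex k)) (R.trans (q^-+ (k + k) k) (R.*-congʳ (q^-+ k k)))
  where
  reindex : ∀ k → k * 3 ≡ k + k + k
  reindex = ℕ.solve-∀

-- The product of 1 - y, 1 - ωy and 1 - ω²y is 1 - y³; for an exponent prime to 3 the conjugates of
-- the factor are of this kind, and writing q for q³ brings the factor back.
norm-factor₁ : ∀ k → norm (factor -1ℤ (1 + k * 3)) ≈ factor -1ℤ (1 + k * 3)
norm-factor₁ k = R.trans (norm-trisected 𝟙 (scalar -1ℤ ⊗ q^ k) 𝟘 trisected) (R.trans
  (solve 2 (λ q x → con 1ℤ :* con 1ℤ :* con 1ℤ :+ q :* ((con -1ℤ :* x) :* (con -1ℤ :* x) :* (con -1ℤ :* x))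
      :+ q :* q :* (con 0ℤ :* con 0ℤ :* con 0ℤ)
                        :- con (ℤ.+ 3) :* q :* (con 1ℤ :* (con -1ℤ :* x) :* con 0ℤ)
                      := con 1ℤ :+ con -1ℤ :* (q :* (x :* x :* x))) R.refl (q^ 1) (q^ k))
  (R.+-congˡ (R.*-congˡ (R.sym (R.trans (q^-suc (k * 3)) (R.*-congˡ (q^-*3 k)))))))
  where
  trisected : factor -1ℤ (1 + k * 3) ≈ V 𝟙 ⊕ q^ 1 ⊗ V (scalar -1ℤ ⊗ q^ k) ⊕ q^ 2 ⊗ V 𝟘
  trisected = R.trans (R.trans (R.+-congˡ (R.*-congˡ (q^-suc (k * 3))))
    (solve 3 (λ q x q² → con 1ℤ :+ con -1ℤ :* (q :* x) := con 1ℤ :+ q :* (con -1ℤ :* x) :+ q² :* con 0ℤ)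
        R.refl (q^ 1) (q^ (k * 3)) (q^ 2)))
    (R.+-cong (R.+-cong (R.sym V-𝟙) (R.*-congˡ (R.sym (V-cq^ -1ℤ k)))) (R.*-congˡ (R.sym V-𝟘)))

norm-factor₂ : ∀ k → norm (factor -1ℤ (2 + k * 3)) ≈ factor -1ℤ (2 + k * 3)
norm-factor₂ k = R.trans (norm-trisected 𝟙 𝟘 (scalar -1ℤ ⊗ q^ k) trisected) (R.trans
  (solve 2 (λ q x → con 1ℤ :* con 1ℤ :* con 1ℤ :+ q :* (con 0ℤ :* con 0ℤ :* con 0ℤ)
      :+ q :* q :* ((con -1ℤ :* x) :* (con -1ℤ :* x) :* (con -1ℤ :* x))
                        :- con (ℤ.+ 3) :* q :* (con 1ℤ :* con 0ℤ :* (con -1ℤ :* x))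
                      := con 1ℤ :+ con -1ℤ :* (q :* q :* (x :* x :* x))) R.refl (q^ 1) (q^ k))
  (R.+-congˡ (R.*-congˡ (R.sym (R.trans (q^-+ 2 (k * 3)) (R.*-cong q² (q^-*3 k)))))))
  where
  trisected : factor -1ℤ (2 + k * 3) ≈ V 𝟙 ⊕ q^ 1 ⊗ V 𝟘 ⊕ q^ 2 ⊗ V (scalar -1ℤ ⊗ q^ k)
  trisected = R.trans (R.trans (R.+-congˡ (R.*-congˡ (q^-+ 2 (k * 3))))
    (solve 3 (λ q x q² → con 1ℤ :+ con -1ℤ :* (q² :* x) := con 1ℤ :+ q :* con 0ℤ :+ q² :* (con -1ℤ :* x))
        R.refl (q^ 1) (q^ (k * 3)) (q^ 2)))
    (R.+-cong (R.+-cong (R.sym V-𝟙) (R.*-congˡ (R.sym V-𝟘))) (R.*-congˡ (R.sym (V-cq^ -1ℤ k))))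

norm-∏ : ∀ s n → norm (∏ s n) ≈ ∏ (norm ∘ s) n
norm-∏ s zero    = R.trans (norm-cong (R.sym V-𝟙)) (R.trans (norm-V 𝟙) (solve 0 (con 1ℤ :* con 1ℤ :* con 1ℤ
    := con 1ℤ) R.refl))
norm-∏ s (suc n) = R.trans (norm-⊗ _ _) (R.*-congʳ (norm-∏ s n))

-- Sections below qⁿ involve the coefficients below q³ⁿ, so the norm converges at the required rate
-- only along multiples of 3.
⟶-norm : ∀ {s F} → s ⟶ F → (λ n → norm (s (n * 3))) ⟶ norm F
⟶-norm {s} {F} s⟶F n = ⊕-cong[] (⊕-cong[] (⊕-cong[] (⊗-cong[] (⊗-cong[] a a) a) (⊗-cong[] ≈[]-refl (⊗-cong[]
    (⊗-cong[] b b) b)))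
  (⊗-cong[] ≈[]-refl (⊗-cong[] (⊗-cong[] c c) c))) (⊝-cong[] (⊗-cong[] ≈[]-refl (⊗-cong[] (⊗-cong[] a b) c)))
  where
  a = D₀-cong[] {n} (s⟶F (n * 3))
  b = D₁-cong[] {n} (s⟶F (n * 3))
  c = D₂-cong[] {n} (s⟶F (n * 3))

-- Of three consecutive factors the last has exponent k (3i + 3), a series in q³ whose norm is a
-- cube; the other two keep their shape by hypothesis. The factor `f (3 * k)` on the left restores
-- the factors replaced by cubes, so that nothing is divided.
norm-f : ∀ k .{{_ : NonZero k}} .{{_ : NonZero (3 * k)}} →
  let s = λ i → factor -1ℤ (k * suc i) in
  (∀ i → norm (s (i * 3)) ≈ s (i * 3)) → (∀ i → norm (s (1 + i * 3)) ≈ s (1 + i * 3)) →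
  norm (f k) ⊗ f (3 * k) ≈ f k ⊗ cube (f k)
norm-f k N₀ N₁ = ⟶-unique (λ n → ≈⇒≈[] (finite n)) (⟶-⊗ (⟶-norm (f-⟶ k)) (f-⟶ (3 * k)))
  (⟶-⊗ (⟶-subsequence (_* 3) (λ n → ℕ.m≤m*n n 3) (f-⟶ k)) (⟶-⊗ (⟶-⊗ (f-⟶ k) (f-⟶ k)) (f-⟶ k)))
  where
  s w : ℕ → Series
  s i = factor -1ℤ (k * suc i)
  w i = factor -1ℤ (3 * k * suc i)
  reindex : ∀ k i → k * suc (2 + i * 3) ≡ k * suc i * 3
  reindex = ℕ.solve-∀
  reindex′ : ∀ k i → k * suc (2 + i * 3) ≡ 3 * k * suc i
  reindex′ = ℕ.solve-∀
  N₂ : ∀ i → norm (s (2 + i * 3)) ≈ cube (s i)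
  N₂ i = R.trans (norm-cong (R.trans (factor-≡ -1ℤ (reindex k i)) (R.sym (V-factor -1ℤ (k * suc i))))) (norm-V (s i))
  triple : ℕ → Series
  triple i = s (i * 3) ⊗ s (1 + i * 3) ⊗ s (2 + i * 3)
  norm-triple : ∀ i → norm (triple i) ⊗ w i ≈ triple i ⊗ cube (s i)
  norm-triple i = begin
    norm (triple i) ⊗ w i
      ≈⟨ R.*-congʳ (R.trans (norm-⊗ _ _) (R.*-congʳ (norm-⊗ _ _))) ⟩
    norm (s (i * 3)) ⊗ norm (s (1 + i * 3)) ⊗ norm (s (2 + i * 3)) ⊗ w i
      ≈⟨ R.*-cong (R.*-cong (R.*-cong (N₀ i) (N₁ i)) (N₂ i)) (R.sym (factor-≡ -1ℤ (reindex′ k i))) ⟩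
    s (i * 3) ⊗ s (1 + i * 3) ⊗ cube (s i) ⊗ s (2 + i * 3)
      ≈⟨ solve 4 (λ a b c d → a :* b :* c :* d := a :* b :* d :* c)
          R.refl (s (i * 3)) (s (1 + i * 3)) (cube (s i)) (s (2 + i * 3)) ⟩
    triple i ⊗ cube (s i) ∎
    where open ≈R
  finite : ∀ n → norm (∏ s (n * 3)) ⊗ ∏ w n ≈ ∏ s (n * 3) ⊗ cube (∏ s n)
  finite n = begin
    norm (∏ s (n * 3)) ⊗ ∏ w n            ≈⟨ R.*-congʳ (R.trans (norm-cong (∏-triples s n)) (norm-∏ triple n)) ⟩
    ∏ (norm ∘ triple) n ⊗ ∏ w n           ≈⟨ ∏-⊗ _ _ n ⟨
    ∏ (λ i → norm (triple i) ⊗ w i) n     ≈⟨ ∏-cong norm-triple n ⟩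
    ∏ (λ i → triple i ⊗ cube (s i)) n  ≈⟨ ∏-⊗ _ _ n ⟩
    ∏ triple n ⊗ ∏ (cube ∘ s) n        ≈⟨ R.*-cong (R.sym (∏-triples s n)) (R.trans (∏-⊗ _ _ n)
        (R.*-congʳ (∏-⊗ _ _ n))) ⟩
    ∏ s (n * 3) ⊗ cube (∏ s n)         ∎
    where open ≈R

norm-f1 : norm (f 1) ⊗ f 3 ≈ f 1 ⊗ cube (f 1)
norm-f1 = norm-f 1 (λ i → R.trans (norm-cong (≡₁ i)) (R.trans (norm-factor₁ i) (R.sym (≡₁ i))))
             (λ i → R.trans (norm-cong (≡₂ i)) (R.trans (norm-factor₂ i) (R.sym (≡₂ i))))
  where
  ≡₁ : ∀ i → factor -1ℤ (1 * suc (i * 3)) ≈ factor -1ℤ (1 + i * 3)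
  ≡₁ i = factor-≡ -1ℤ (ℕ.*-identityˡ _)
  ≡₂ : ∀ i → factor -1ℤ (1 * suc (1 + i * 3)) ≈ factor -1ℤ (2 + i * 3)
  ≡₂ i = factor-≡ -1ℤ (ℕ.*-identityˡ _)

-- Doubling exchanges the residues 1 and 2 modulo 3, so the two factor lemmas swap places.
norm-f2 : norm (f 2) ⊗ f 6 ≈ f 2 ⊗ cube (f 2)
norm-f2 = norm-f 2 (λ i → R.trans (norm-cong (≡₂ i)) (R.trans (norm-factor₂ (2 * i)) (R.sym (≡₂ i))))
             (λ i → R.trans (norm-cong (≡₁ i)) (R.trans (norm-factor₁ (1 + 2 * i)) (R.sym (≡₁ i))))
  where
  ≡₂ : ∀ i → factor -1ℤ (2 * suc (i * 3)) ≈ factor -1ℤ (2 + 2 * i * 3)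
  ≡₂ i = factor-≡ -1ℤ (reindex i)
    where
    reindex : ∀ i → 2 * suc (i * 3) ≡ 2 + 2 * i * 3
    reindex = ℕ.solve-∀
  ≡₁ : ∀ i → factor -1ℤ (2 * suc (1 + i * 3)) ≈ factor -1ℤ (1 + (1 + 2 * i) * 3)
  ≡₁ i = factor-≡ -1ℤ (reindex i)
    where
    reindex : ∀ i → 2 * suc (1 + i * 3) ≡ 1 + (1 + 2 * i) * 3
    reindex = ℕ.solve-∀

-- Gaussian binomials and the Jacobi triple product

-- The sum of h r s over all r and s with r + s = L.
∑-pairs : (ℕ → ℕ → Series) → ℕ → Series
∑-pairs h zero    = h 0 0
∑-pairs h (suc L) = h 0 (suc L) ⊕ ∑-pairs (λ r s → h (suc r) s) L

∑-pairs-cong : ∀ {h k} L → (∀ r s → r + s ≡ L → h r s ≈ k r s) → ∑-pairs h L ≈ ∑-pairs k L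
∑-pairs-cong zero    h≈k = h≈k 0 0 refl
∑-pairs-cong (suc L) h≈k = R.+-cong (h≈k 0 (suc L) refl) (∑-pairs-cong L λ r s r+s≡L → h≈k (suc r) s (cong suc r+s≡L))

∑-pairs-cong[] : ∀ {N h k} L → (∀ r s → r + s ≡ L → h r s ≈[ N ] k r s) → ∑-pairs h L ≈[ N ] ∑-pairs k L
∑-pairs-cong[] zero    h≈k = h≈k 0 0 refl
∑-pairs-cong[] (suc L) h≈k = ⊕-cong[] (h≈k 0 (suc L) refl) (∑-pairs-cong[] L λ r s r+s≡L
    → h≈k (suc r) s (cong suc r+s≡L))

∑-pairs-last : ∀ h L → ∑-pairs h (suc L) ≈ ∑-pairs (λ r s → h r (suc s)) L ⊕ h (suc L) 0
∑-pairs-last h zero    = R.refl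
∑-pairs-last h (suc L) = R.trans (R.+-congˡ (∑-pairs-last (λ r s → h (suc r) s) L)) (R.sym (R.+-assoc _ _ _))

∑-pairs-⊕ : ∀ h k L → ∑-pairs (λ r s → h r s ⊕ k r s) L ≈ ∑-pairs h L ⊕ ∑-pairs k L
∑-pairs-⊕ h k zero    = R.refl
∑-pairs-⊕ h k (suc L) = R.trans (R.+-congˡ (∑-pairs-⊕ (λ r s → h (suc r) s) (λ r s
    → k (suc r) s) L)) (⊕-interchange _ _ _ _)

∑-pairs-⊗ : ∀ F h L → F ⊗ ∑-pairs h L ≈ ∑-pairs (λ r s → F ⊗ h r s) L
∑-pairs-⊗ F h zero    = R.refl
∑-pairs-⊗ F h (suc L) = R.trans (R.distribˡ F _ _) (R.+-congˡ (∑-pairs-⊗ F (λ r s → h (suc r) s) L))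

-- An array with a Pascal rule splits antidiagonal L + 1 into two antidiagonals L, one of them with
-- its weights shifted by a place. Keeping `A` and `B` abstract makes both q-Pascal rules instances.
∑-pairs-Pascal : ∀ (g A B : ℕ → ℕ → Series) (E : ℕ → Series) →
  (∀ s → g 0 (suc s) ≈ A 0 s) → (∀ r → g (suc r) 0 ≈ B r 0) →
  (∀ r s → g (suc r) (suc s) ≈ A (suc r) s ⊕ B r (suc s)) →
  ∀ L → ∑-pairs (λ r s → g r s ⊗ E r) (suc L) ≈
        ∑-pairs (λ r s → A r s ⊗ E r) L ⊕ ∑-pairs (λ r s → B r s ⊗ E (suc r)) L
∑-pairs-Pascal g A B E gA gB gAB zero = R.+-cong (R.*-congʳ (gA 0)) (R.*-congʳ (gB 0))
∑-pairs-Pascal g A B E gA gB gAB (suc L) = begin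
  g 0 (suc (suc L)) ⊗ E 0 ⊕ ∑-pairs (λ r s → g (suc r) s ⊗ E (suc r)) (suc L)
    ≈⟨ R.+-cong (R.*-congʳ (gA (suc L))) (∑-pairs-last (λ r s → g (suc r) s ⊗ E (suc r)) L) ⟩
  A 0 (suc L) ⊗ E 0 ⊕ (∑-pairs (λ r s → g (suc r) (suc s) ⊗ E (suc r)) L ⊕ g (suc (suc L)) 0 ⊗ E (suc (suc L)))
    ≈⟨ R.+-congˡ (R.+-cong
         (R.trans (∑-pairs-cong L λ r s _ → R.trans (R.*-congʳ (gAB r s))
             (R.distribʳ (E (suc r)) _ _)) (∑-pairs-⊕ _ _ L))
         (R.*-congʳ (gB (suc L)))) ⟩
  A 0 (suc L) ⊗ E 0 ⊕ (∑-pairs (λ r s → A (suc r) s ⊗ E (suc r)) L ⊕ ∑-pairs (λ r s → B r (suc s) ⊗ E (suc r)) L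
    ⊕ B (suc L) 0 ⊗ E (suc (suc L)))
    ≈⟨ solve 4 (λ a b c d → a :+ (b :+ c :+ d) := a :+ b :+ (c :+ d)) R.refl _ _ _ _ ⟩
  A 0 (suc L) ⊗ E 0 ⊕ ∑-pairs (λ r s → A (suc r) s ⊗ E (suc r)) L
    ⊕ (∑-pairs (λ r s → B r (suc s) ⊗ E (suc r)) L ⊕ B (suc L) 0 ⊗ E (suc (suc L)))
    ≈⟨ R.+-congˡ (∑-pairs-last (λ r s → B r s ⊗ E (suc r)) L) ⟨
  ∑-pairs (λ r s → A r s ⊗ E r) (suc L) ⊕ ∑-pairs (λ r s → B r s ⊗ E (suc r)) (suc L) ∎
  where open ≈R

-- The triple product of (1 + z q²ᵏ⁻¹)(1 + z⁻¹ q²ᵏ⁻¹)(1 - q²ᵏ), with u = z q, v = z⁻¹ q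
-- and p = q², so that z need not be invertible.
module Jacobi (u v p : Series) (uv≈p : u ⊗ v ≈ p) (p-small : ∀ k → p ↑ k ≈[ k ] 𝟘) where

  -- The Gaussian binomial coefficient of r + s over r in base p.
  Gaussian : ℕ → ℕ → Series
  Gaussian zero    s       = 𝟙
  Gaussian (suc r) zero    = 𝟙
  Gaussian (suc r) (suc s) = Gaussian (suc r) s ⊕ p ↑ suc s ⊗ Gaussian r (suc s)

  Gaussian-exchange : ∀ r s → (𝟙 ⊖ p ↑ suc r) ⊗ Gaussian (suc r) s ≈ (𝟙 ⊖ p ↑ suc s) ⊗ Gaussian r (suc s)
  Gaussian-exchange zero zero = R.refl
  Gaussian-exchange (suc r) zero = begin
    (𝟙 ⊖ p ⊗ ξ) ⊗ 𝟙
      ≈⟨ solve 2 (λ p ξ → (con 1ℤ :- p :* ξ) :* con 1ℤ := con 1ℤ :- p :* con 1ℤ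
          :+ p :* con 1ℤ :* ((con 1ℤ :- ξ) :* con 1ℤ)) R.refl p ξ ⟩
    𝟙 ⊖ p ↑ 1 ⊕ p ↑ 1 ⊗ ((𝟙 ⊖ ξ) ⊗ 𝟙)
      ≈⟨ R.+-congˡ (R.*-congˡ (R.trans (R.*-congˡ (Gaussian-zeroʳ r)) (Gaussian-exchange r zero))) ⟩
    𝟙 ⊖ p ↑ 1 ⊕ p ↑ 1 ⊗ ((𝟙 ⊖ p ↑ 1) ⊗ Gaussian r 1)
      ≈⟨ solve 2 (λ η h → con 1ℤ :- η :+ η :* ((con 1ℤ :- η) :* h) := (con 1ℤ :- η) :* (con 1ℤ :+ η :* h))
          R.refl (p ↑ 1) (Gaussian r 1) ⟩
    (𝟙 ⊖ p ↑ 1) ⊗ (𝟙 ⊕ p ↑ 1 ⊗ Gaussian r 1) ∎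
    where
    open ≈R
    ξ = p ↑ suc r
    Gaussian-zeroʳ : ∀ r → 𝟙 ≈ Gaussian (suc r) 0
    Gaussian-zeroʳ r = R.refl
  Gaussian-exchange zero (suc s) = begin
    (𝟙 ⊖ p ↑ 1) ⊗ (Gaussian 1 s ⊕ η ⊗ 𝟙)
      ≈⟨ R.distribˡ _ _ _ ⟩
    (𝟙 ⊖ p ↑ 1) ⊗ Gaussian 1 s ⊕ (𝟙 ⊖ p ↑ 1) ⊗ (η ⊗ 𝟙)
      ≈⟨ R.+-congʳ (Gaussian-exchange zero s) ⟩
    (𝟙 ⊖ η) ⊗ 𝟙 ⊕ (𝟙 ⊖ p ↑ 1) ⊗ (η ⊗ 𝟙)
      ≈⟨ solve 2 (λ p η → (con 1ℤ :- η) :* con 1ℤ :+ (con 1ℤ :- p :* con 1ℤ) :* (η :* con 1ℤ)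
          := (con 1ℤ :- p :* η) :* con 1ℤ) R.refl p η ⟩
    (𝟙 ⊖ p ⊗ η) ⊗ 𝟙 ∎
    where
    open ≈R
    η = p ↑ suc s
  Gaussian-exchange (suc r) (suc s) = begin
    (𝟙 ⊖ p ⊗ ξ) ⊗ (Gaussian (suc (suc r)) s ⊕ η ⊗ h)
      ≈⟨ R.distribˡ _ _ _ ⟩
    (𝟙 ⊖ p ⊗ ξ) ⊗ Gaussian (suc (suc r)) s ⊕ (𝟙 ⊖ p ⊗ ξ) ⊗ (η ⊗ h)
      ≈⟨ R.+-congʳ (Gaussian-exchange (suc r) s) ⟩
    (𝟙 ⊖ η) ⊗ h ⊕ (𝟙 ⊖ p ⊗ ξ) ⊗ (η ⊗ h)
      ≈⟨ solve 4 (λ p ξ η h → (con 1ℤ :- η) :* h :+ (con 1ℤ :- p :* ξ) :* (η :* h)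
                           := (con 1ℤ :- p :* η) :* h :+ p :* η :* ((con 1ℤ :- ξ) :* h)) R.refl p ξ η h ⟩
    (𝟙 ⊖ p ⊗ η) ⊗ h ⊕ p ⊗ η ⊗ ((𝟙 ⊖ ξ) ⊗ h)
      ≈⟨ R.+-congˡ (R.*-congˡ (Gaussian-exchange r (suc s))) ⟩
    (𝟙 ⊖ p ⊗ η) ⊗ h ⊕ p ⊗ η ⊗ ((𝟙 ⊖ p ⊗ η) ⊗ Gaussian r (suc (suc s)))
      ≈⟨ solve 3 (λ z h k → (con 1ℤ :- z) :* h :+ z :* ((con 1ℤ :- z) :* k) := (con 1ℤ :- z) :* (h :+ z :* k))
          R.refl (p ⊗ η) h _ ⟩
    (𝟙 ⊖ p ⊗ η) ⊗ (h ⊕ p ⊗ η ⊗ Gaussian r (suc (suc s))) ∎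
    where
    open ≈R
    ξ = p ↑ suc r
    η = p ↑ suc s
    h = Gaussian (suc r) (suc s)

  -- The two q-Pascal rules differ precisely by `Gaussian-exchange`.
  Gaussian-Pascal′ : ∀ r s → Gaussian (suc r) (suc s) ≈ p ↑ suc r ⊗ Gaussian (suc r) s ⊕ Gaussian r (suc s)
  Gaussian-Pascal′ r s = begin
    G₁ ⊕ η ⊗ G₂                                         ≈⟨ solve 4 (λ ξ η g₁ g₂ → g₁ :+ η :* g₂
                                                             := (con 1ℤ :- ξ) :* g₁ :+ (ξ :* g₁ :+ η :* g₂))
                                                                 R.refl ξ η G₁ G₂ ⟩
    (𝟙 ⊖ ξ) ⊗ G₁ ⊕ (ξ ⊗ G₁ ⊕ η ⊗ G₂)                    ≈⟨ R.+-congʳ (Gaussian-exchange r s) ⟩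
    (𝟙 ⊖ η) ⊗ G₂ ⊕ (ξ ⊗ G₁ ⊕ η ⊗ G₂)                    ≈⟨ solve 4 (λ ξ η g₁ g₂
        → (con 1ℤ :- η) :* g₂ :+ (ξ :* g₁ :+ η :* g₂)
                                                             := ξ :* g₁ :+ g₂) R.refl ξ η G₁ G₂ ⟩
    ξ ⊗ G₁ ⊕ G₂                                         ∎
    where
    open ≈R
    ξ = p ↑ suc r
    η = p ↑ suc s
    G₁ = Gaussian (suc r) s
    G₂ = Gaussian r (suc s)

  factorial : ℕ → Series
  factorial = ∏ (λ i → 𝟙 ⊖ p ↑ suc i)

  -- The quotient formula with denominators cleared; it serves to show that a factorial times a
  -- Gaussian binomial with both arguments large tends to 1.
  Gaussian-factorial : ∀ r s → Gaussian r s ⊗ (factorial r ⊗ factorial s) ≈ factorial (r + s)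
  Gaussian-factorial zero    s       = R.trans (R.*-identityˡ _) (R.*-identityˡ _)
  Gaussian-factorial (suc r) zero    = R.trans (R.*-identityˡ _) (R.trans (R.*-identityʳ _)
    (R.reflexive (cong factorial (sym (ℕ.+-identityʳ (suc r))))))
  Gaussian-factorial (suc r) (suc s) = begin
    (G₁ ⊕ η ⊗ G₂) ⊗ (a ⊗ (𝟙 ⊖ ξ) ⊗ (b ⊗ (𝟙 ⊖ η)))
      ≈⟨ solve 6 (λ g₁ g₂ ξ η a b → (g₁ :+ η :* g₂) :* (a :* (con 1ℤ :- ξ) :* (b :* (con 1ℤ :- η)))
           := g₁ :* (a :* (con 1ℤ :- ξ) :* b) :* (con 1ℤ :- η)
               :+ g₂ :* (a :* (b :* (con 1ℤ :- η))) :* (η :* (con 1ℤ :- ξ)))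
           R.refl G₁ G₂ ξ η a b ⟩
    G₁ ⊗ (a ⊗ (𝟙 ⊖ ξ) ⊗ b) ⊗ (𝟙 ⊖ η) ⊕ G₂ ⊗ (a ⊗ (b ⊗ (𝟙 ⊖ η))) ⊗ (η ⊗ (𝟙 ⊖ ξ))
      ≈⟨ R.+-cong (R.*-congʳ (R.trans (Gaussian-factorial (suc r) s) (R.reflexive (cong factorial (sym
          (ℕ.+-suc r s))))))
                  (R.*-congʳ (Gaussian-factorial r (suc s))) ⟩
    z ⊗ (𝟙 ⊖ η) ⊕ z ⊗ (η ⊗ (𝟙 ⊖ ξ))
      ≈⟨ solve 3 (λ ξ η z → z :* (con 1ℤ :- η) :+ z :* (η :* (con 1ℤ :- ξ)) := z :* (con 1ℤ :- ξ :* η)) R.refl ξ η z ⟩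
    z ⊗ (𝟙 ⊖ ξ ⊗ η)
      ≈⟨ R.*-congˡ (R.+-congˡ (R.-‿cong (↑-+ p (suc r) (suc s)))) ⟨
    factorial (suc r + suc s) ∎
    where
    open ≈R
    ξ = p ↑ suc r
    η = p ↑ suc s
    G₁ = Gaussian (suc r) s
    G₂ = Gaussian r (suc s)
    a = factorial r
    b = factorial s
    z = factorial (r + suc s)

  -- This is wʲ p^(j(j-1)/2), so that with p = q² the choice w = z q gives zʲ q^(j²), and w = z⁻¹ q
  -- gives the term of index -j.
  term : Series → ℕ → Series
  term w zero    = 𝟙
  term w (suc j) = term w j ⊗ (w ⊗ p ↑ j)

  -- shifted m k is the term of the theta series at the integer index k - m.
  shifted : ℕ → ℕ → Series
  shifted zero    k       = term u k
  shifted (suc m) zero    = term v (suc m)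
  shifted (suc m) (suc k) = shifted m k

  shifted-zero : ∀ m → shifted m 0 ≡ term v m
  shifted-zero zero    = refl
  shifted-zero (suc m) = refl

  shifted-term-v : ∀ r k → shifted (r + k) r ≡ term v k
  shifted-term-v zero    k = shifted-zero k
  shifted-term-v (suc r) k = shifted-term-v r k

  shifted-term-u : ∀ m k → shifted m (m + k) ≡ term u k
  shifted-term-u zero    k = refl
  shifted-term-u (suc m) k = shifted-term-u m k

  -- Going from index k to k + 1 in the theta series multiplies the term by u pᵏ, at negative k
  -- thanks to u v = p. For k = r - m the power left over is n - k, and r + s = m + n identifies it
  -- with the natural number s.
  u-shift : ∀ m n r s → r + s ≡ m + n → u ⊗ p ↑ n ⊗ shifted m r ≈ p ↑ s ⊗ shifted m (suc r)
  u-shift zero n r s refl = R.trans (R.*-congʳ (R.*-congˡ (↑-+ p r s)))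
    (solve 4 (λ u t ξ η → u :* (ξ :* η) :* t := η :* (t :* (u :* ξ))) R.refl u (term u r) (p ↑ r) (p ↑ s))
  u-shift (suc m) n zero s refl = begin
    u ⊗ p ↑ n ⊗ (term v m ⊗ (v ⊗ p ↑ m))          ≈⟨ solve 5 (λ u v t ξ η → u :* η :* (t :* (v :* ξ))
        := u :* v :* (ξ :* η) :* t) R.refl u v (term v m) (p ↑ m) (p ↑ n) ⟩
    u ⊗ v ⊗ (p ↑ m ⊗ p ↑ n) ⊗ term v m            ≈⟨ R.*-congʳ (R.*-cong uv≈p (R.sym (↑-+ p m n))) ⟩
    p ↑ suc (m + n) ⊗ term v m                    ≡⟨ cong (p ↑ suc (m + n) ⊗_) (shifted-zero m) ⟨
    p ↑ suc (m + n) ⊗ shifted m 0                 ∎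
    where open ≈R
  u-shift (suc m) n (suc r) s eq = u-shift m n r s (ℕ.suc-injective eq)

  -- Downwards, from k to k - 1, the multiplier is v p⁻ᵏ, and with k = r - m the power left over is
  -- m + k = r.
  v-shift : ∀ m r → v ⊗ p ↑ m ⊗ shifted m r ≈ p ↑ r ⊗ shifted (suc m) r
  v-shift zero zero = solve 1 (λ v → v :* con 1ℤ :* con 1ℤ := con 1ℤ :* (con 1ℤ :* (v :* con 1ℤ))) R.refl v
  v-shift zero (suc r) = R.trans
    (solve 4 (λ u v t ξ → v :* con 1ℤ :* (t :* (u :* ξ)) := u :* v :* ξ :* t) R.refl u v (term u r) (p ↑ r))
    (R.*-congʳ (R.*-congʳ uv≈p))
  v-shift (suc m) zero = solve 3 (λ v ξ t → v :* ξ :* t := con 1ℤ :* (t :* (v :* ξ)))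
      R.refl v (p ↑ suc m) (term v (suc m))
  v-shift (suc m) (suc r) = begin
    v ⊗ (p ⊗ p ↑ m) ⊗ shifted m r            ≈⟨ solve 4 (λ v p ξ t → v :* (p :* ξ) :* t := p :* (v :* ξ :* t))
        R.refl v p (p ↑ m) (shifted m r) ⟩
    p ⊗ (v ⊗ p ↑ m ⊗ shifted m r)            ≈⟨ R.*-congˡ (v-shift m r) ⟩
    p ⊗ (p ↑ r ⊗ shifted (suc m) r)          ≈⟨ R.*-assoc _ _ _ ⟨
    p ⊗ p ↑ r ⊗ shifted (suc m) r            ∎
    where open ≈R

  factors : ℕ → Series
  factors i = (𝟙 ⊕ u ⊗ p ↑ i) ⊗ (𝟙 ⊕ v ⊗ p ↑ i)

  -- The q-binomial theorem, recentred. Adjoining the factor with `u` lengthens the antidiagonal by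
  -- the defining Pascal rule; adjoining the one with `v` lengthens it again by the second rule and
  -- moves the centre by one.
  finite-Jacobi : ∀ n → ∏ factors n ≈ ∑-pairs (λ r s → Gaussian r s ⊗ shifted n r) (n * 2)
  finite-Jacobi zero    = R.sym (R.*-identityʳ 𝟙)
  finite-Jacobi (suc n) = begin
    ∏ factors n ⊗ ((𝟙 ⊕ U) ⊗ (𝟙 ⊕ W))
      ≈⟨ R.*-congʳ (finite-Jacobi n) ⟩
    sum₀ ⊗ ((𝟙 ⊕ U) ⊗ (𝟙 ⊕ W))
      ≈⟨ solve 3 (λ s u w → s :* ((con 1ℤ :+ u) :* (con 1ℤ :+ w)) := (s :+ u :* s) :+ w :* (s :+ u :* s))
          R.refl sum₀ U W ⟩
    (sum₀ ⊕ U ⊗ sum₀) ⊕ W ⊗ (sum₀ ⊕ U ⊗ sum₀)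
      ≈⟨ R.+-cong u-step (R.*-congˡ u-step) ⟩
    sum₁ ⊕ W ⊗ sum₁
      ≈⟨ R.+-congˡ (R.trans (∑-pairs-⊗ W (λ r s
          → Gaussian r s ⊗ shifted n r) (suc (n * 2))) (∑-pairs-cong (suc (n * 2)) λ r s _ → v-term r s)) ⟩
    sum₁ ⊕ ∑-pairs (λ r s → p ↑ r ⊗ Gaussian r s ⊗ shifted (suc n) r) (suc (n * 2))
      ≈⟨ R.+-comm _ _ ⟩
    ∑-pairs (λ r s → p ↑ r ⊗ Gaussian r s ⊗ shifted (suc n) r) (suc (n * 2)) ⊕ sum₁
      -- `shifted (suc n) (suc r)` reduces to `shifted n r`, so `sum₁` already is the sum with
      -- shifted weights.
      ≈⟨ ∑-pairs-Pascal Gaussian (λ r s → p ↑ r ⊗ Gaussian r s) Gaussian (shifted (suc n))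
           (λ s → R.sym (R.*-identityʳ 𝟙)) (λ { zero → R.refl ; (suc r) → R.refl }) Gaussian-Pascal′ (suc (n * 2)) ⟨
    ∑-pairs (λ r s → Gaussian r s ⊗ shifted (suc n) r) (suc n * 2) ∎
    where
    open ≈R
    U = u ⊗ p ↑ n
    W = v ⊗ p ↑ n
    sum₀ = ∑-pairs (λ r s → Gaussian r s ⊗ shifted n r) (n * 2)
    sum₁ = ∑-pairs (λ r s → Gaussian r s ⊗ shifted n r) (suc (n * 2))
    2n≡n+n : n * 2 ≡ n + n
    2n≡n+n = trans (ℕ.*-comm n 2) (cong (n +_) (ℕ.+-identityʳ n))
    exchange : ∀ {w e ξ e′} g → w ⊗ e ≈ ξ ⊗ e′ → w ⊗ (g ⊗ e) ≈ ξ ⊗ g ⊗ e′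
    exchange g eq = R.trans (⊗-swap _ g _) (R.trans (R.*-congˡ eq) (R.trans (⊗-swap g _ _) (R.sym (R.*-assoc _ _ _))))
    v-term : ∀ r s → W ⊗ (Gaussian r s ⊗ shifted n r) ≈ p ↑ r ⊗ Gaussian r s ⊗ shifted (suc n) r
    v-term r s = exchange (Gaussian r s) (v-shift n r)
    u-step : sum₀ ⊕ U ⊗ sum₀ ≈ sum₁
    u-step = R.trans
      (R.+-congˡ (R.trans (∑-pairs-⊗ U (λ r s
          → Gaussian r s ⊗ shifted n r) (n * 2)) (∑-pairs-cong (n * 2) λ r s r+s≡2n →
         exchange (Gaussian r s) (u-shift n n r s (trans r+s≡2n 2n≡n+n)))))
      (R.sym (∑-pairs-Pascal Gaussian Gaussian (λ r s → p ↑ s ⊗ Gaussian r s) (shifted n)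
        (λ s → R.refl) (λ { zero → R.sym (R.*-identityʳ 𝟙) ; (suc r) → R.sym (R.*-identityʳ 𝟙) }) (λ r s
            → R.refl) (n * 2)))

  theta : ℕ → Series
  theta zero    = 𝟙
  theta (suc n) = theta n ⊕ (term u (suc n) ⊕ term v (suc n))

  ∑-shifted : ∀ n → ∑-pairs (λ r s → shifted n r) (n * 2) ≈ theta n
  ∑-shifted zero    = R.refl
  ∑-shifted (suc n) = R.trans (R.+-congˡ (R.trans (∑-pairs-last (λ r s
      → shifted n r) (n * 2)) (R.+-cong (∑-shifted n) (R.reflexive last-term))))
    (solve 3 (λ a b c → a :+ (b :+ c) := b :+ (c :+ a)) R.refl _ _ _)
    where
    last-term : shifted n (suc (n * 2)) ≡ term u (suc n)
    last-term = trans (cong (shifted n) (trans (cong suc (trans (ℕ.*-comm n 2) (cong (n +_) (ℕ.+-identityʳ n)))) (sym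
        (ℕ.+-suc n n))))
                      (shifted-term-u n (suc n))

  -- Only the factor pʲ is exploited, since `w` may have a nonzero constant term: for `Ψ` the series
  -- `v` is q⁰. Hence the loss of one index.
  term-small : ∀ w j → term w (suc j) ≈[ j ] 𝟘
  term-small w j = ≈[]-≈ (⊗-cong[] ≈[]-refl (⊗-cong[] ≈[]-refl (p-small j)))
    (R.trans (R.*-congˡ (R.zeroʳ w)) (R.zeroʳ _))

  term-small′ : ∀ w {N j} → N < j → term w j ≈[ N ] 𝟘
  term-small′ w {N} {suc j} (s≤s N≤j) = ≈[]-weaken N≤j (term-small w j)

  theta-⟶ : (λ N → theta (1 + N)) ⟶ diagonal 1 theta
  theta-⟶ = diagonal-⟶ 1 theta λ N
      → ≈[]-≈ (⊕-cong[] ≈[]-refl (⊕-cong[] (term-small u (suc N)) (term-small v (suc N))))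
    (R.trans (R.+-congˡ (R.+-identityʳ 𝟘)) (R.+-identityʳ _))

  1-p-small : ∀ i → 𝟙 ⊖ p ↑ suc i ≈[ suc i ] 𝟙
  1-p-small i = ≈[]-≈ (⊕-cong[] ≈[]-refl (⊝-cong[] (p-small (suc i)))) (solve 0 (con 1ℤ :- con 0ℤ := con 1ℤ) R.refl)

  factorial-⟶ : factorial ⟶ diagonal 0 factorial
  factorial-⟶ = diagonal-⟶ 0 factorial λ N → ≈[]-≈ (⊗-cong[] ≈[]-refl (1-p-small N)) (R.*-identityʳ _)

  factorial-constant : ∀ n → factorial n 0 ≡ 1ℤ
  factorial-constant n = below (constant n) 0 z<s
    where
    constant : ∀ n → factorial n ≈[ 1 ] 𝟙
    constant zero    = ≈[]-refl
    constant (suc n) = ≈[]-≈ (⊗-cong[] (constant n) (≈[]-weaken (s≤s z≤n) (1-p-small n))) (R.*-identityʳ 𝟙)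

  factorial-stable : ∀ {N n} → N ≤ n → factorial n ≈[ N ] factorial N
  factorial-stable {N} {n} N≤n = ≈[]-trans (≈[]-weaken N≤n (factorial-⟶ n)) (≈[]-sym (factorial-⟶ N))

  -- Below qᴺ all factorials from N on agree with F = `factorial N`, so the quotient formula reads F
  -- · (F · Gaussian) = F, and F is a unit.
  factorial⊗Gaussian : ∀ {N r s n} → N ≤ r → N ≤ s → N ≤ n → factorial n ⊗ Gaussian r s ≈[ N ] 𝟙
  factorial⊗Gaussian {N} {r} {s} {n} N≤r N≤s N≤n =
    ≈[]-trans (⊗-cong[] (factorial-stable N≤n) ≈[]-refl)
    (≈[]-trans (≈[]-sym (≈⇒≈[] (inverse-cancelˡ F _ (factorial-constant N))))
    (≈[]-trans (⊗-cong[] (≈[]-refl {F = inverse F}) cancelled) (≈⇒≈[] (R.trans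
        (R.*-comm _ _) (inverseʳ F (factorial-constant N))))))
    where
    F = factorial N
    cancelled : F ⊗ (F ⊗ Gaussian r s) ≈[ N ] F
    cancelled = ≈[]-trans (≈⇒≈[] (solve 2 (λ f g → f :* (f :* g) := g :* (f :* f)) R.refl F (Gaussian r s)))
      (≈[]-trans (⊗-cong[] ≈[]-refl (⊗-cong[] (≈[]-sym (factorial-stable N≤r)) (≈[]-sym (factorial-stable N≤s))))
      (≈[]-trans (≈⇒≈[] (Gaussian-factorial r s)) (factorial-stable (≤-trans N≤r (ℕ.m≤m+n r s)))))

  -- With 2N factors the sum is centred at r = 2N. A pair with r < N or s < N belongs to a theta
  -- index of absolute value above N, invisible below qᴺ; for all other pairs the coefficient has
  -- become 1.
  Jacobi-⟶ : ∀ N → factorial (N * 2) ⊗ ∏ factors (N * 2) ≈[ N ] theta (N * 2)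
  Jacobi-⟶ N = ≈[]-trans (≈⇒≈[] (R.trans (R.*-congˡ (finite-Jacobi n)) (∑-pairs-⊗ (factorial n) _ (n * 2))))
               (≈[]-trans (∑-pairs-cong[] (n * 2) termwise) (≈⇒≈[] (∑-shifted n)))
    where
    n = N * 2
    N≤n : N ≤ n
    N≤n = ℕ.m≤m*n N 2
    vanish : ∀ {r s} → shifted n r ≈[ N ] 𝟘 → factorial n ⊗ (Gaussian r s ⊗ shifted n r) ≈[ N ] shifted n r
    vanish e≈0 = ≈[]-trans (≈[]-≈ (⊗-cong[] ≈[]-refl (⊗-cong[] ≈[]-refl e≈0)) (R.trans (R.*-congˡ (R.zeroʳ _))
        (R.zeroʳ _))) (≈[]-sym e≈0)
    far : ∀ {k} → k < N → N < n ∸ k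
    far {k} k<N = ℕ.m+n≤o⇒m≤o∸n (suc N) (≤-trans (ℕ.+-monoʳ-≤ (suc N) (ℕ.≤-refl)) (≤-trans (ℕ.≤-reflexive (sym
        (ℕ.+-suc N k))) (≤-trans (ℕ.+-monoʳ-≤ N k<N) (ℕ.≤-reflexive N+N≡n))))
      where
      N+N≡n : N + N ≡ N * 2
      N+N≡n = sym (trans (ℕ.*-comm N 2) (cong (N +_) (ℕ.+-identityʳ N)))
    termwise : ∀ r s → r + s ≡ n * 2 → factorial n ⊗ (Gaussian r s ⊗ shifted n r) ≈[ N ] shifted n r
    termwise r s r+s≡2n with N ℕ.≤? r | N ℕ.≤? s
    ... | yes N≤r | yes N≤s = ≈[]-trans (≈⇒≈[] (R.sym (R.*-assoc _ _ _)))
      (≈[]-≈ (⊗-cong[] (factorial⊗Gaussian N≤r N≤s N≤n) ≈[]-refl) (R.*-identityˡ _))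
    ... | no N≰r | _ = vanish {r} {s} (subst (_≈[ N ] 𝟘)
        (trans (sym (shifted-term-v r (n ∸ r))) (cong (λ m → shifted m r) (ℕ.m+[n∸m]≡n r≤n)))
        (term-small′ v (far r<N)))
      where
      r<N = ℕ.≰⇒> N≰r
      r≤n = ≤-trans (ℕ.<⇒≤ r<N) N≤n
    ... | yes _ | no N≰s = vanish {r} {s} (subst (_≈[ N ] 𝟘)
        (trans (sym (shifted-term-u n (n ∸ s))) (cong (shifted n) n+[n-s]≡r))
        (term-small′ u (far s<N)))
      where
      s<N = ℕ.≰⇒> N≰s
      s≤n = ≤-trans (ℕ.<⇒≤ s<N) N≤n
      n+[n-s]≡r : n + (n ∸ s) ≡ r
      n+[n-s]≡r = trans (sym (ℕ.+-∸-assoc n s≤n))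
        (trans (cong (_∸ s) (trans (sym (trans (ℕ.*-comm n 2) (cong (n +_) (ℕ.+-identityʳ n)))) (sym r+s≡2n)))
            (ℕ.m+n∸n≡m r s))

-- Theta series with exponents in q

progression : ℕ → ℕ → ℕ → ℕ
progression a d zero    = 0
progression a d (suc j) = progression a d j + (a + j * d)

-- theta-sum c a b n sums cʲ q^(a j(j+1)/2 + b j(j-1)/2) over -n ≤ j ≤ n, for c = ± 1.
theta-term : ℤ → ℕ → ℕ → ℕ → Series
theta-term c a d j = scalar (c ℤ.^ j) ⊗ q^ progression a d j

theta-sum : ℤ → ℕ → ℕ → ℕ → Series
theta-sum c a b zero    = 𝟙
theta-sum c a b (suc n) = theta-sum c a b n ⊕ (theta-term c a (a + b) (suc n) ⊕ theta-term c b (a + b) (suc n))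

Theta : ℤ → ℕ → ℕ → Series
Theta c a b = diagonal 1 (theta-sum c a b)

q^-↑ : ∀ d k → q^ d ↑ k ≈ q^ (k * d)
q^-↑ d zero    = R.sym q^0
q^-↑ d (suc k) = R.trans (R.*-congˡ (q^-↑ d k)) (R.sym (q^-+ d (k * d)))

module _ (c : ℤ) (c²≡1 : c ℤ.* c ≡ 1ℤ) (a b : ℕ) .{{_ : NonZero (a + b)}} where
  private
    d = a + b
    u = scalar c ⊗ q^ a
    v = scalar c ⊗ q^ b

    uv≈p : u ⊗ v ≈ q^ d
    uv≈p = R.trans (interchange _ _ _ _) (R.trans (R.*-cong
      (R.trans (R.sym (scalar-* c c)) (R.reflexive (cong scalar c²≡1))) (R.sym (q^-+ a b))) (R.*-identityˡ _))

    p-small : ∀ k → q^ d ↑ k ≈[ k ] 𝟘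
    p-small k = ≈[]-trans (≈⇒≈[] (q^-↑ d k)) (q^-small (ℕ.m≤m*n k d))

    module J = Jacobi u v (q^ d) uv≈p p-small

    term≈ : ∀ e j → J.term (scalar c ⊗ q^ e) j ≈ theta-term c e d j
    term≈ e zero    = R.sym (R.trans (R.*-identityˡ _) q^0)
    term≈ e (suc j) = R.trans (R.*-cong (term≈ e j) (R.*-congˡ (q^-↑ d j))) (R.trans
      (solve 5 (λ cj x c y z → cj :* x :* (c :* y :* z) := c :* cj :* (x :* (y :* z))) R.refl _ _ _ _ _)
      (R.*-cong (R.sym (scalar-* c (c ℤ.^ j)))
        (R.sym (R.trans (q^-+ (progression e d j) (e + j * d)) (R.*-congˡ (q^-+ e (j * d)))))))

    theta≈ : ∀ n → J.theta n ≈ theta-sum c a b n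
    theta≈ zero    = R.refl
    theta≈ (suc n) = R.+-cong (theta≈ n) (R.+-cong (term≈ a (suc n)) (term≈ b (suc n)))

    factor≈ : ∀ e i → 𝟙 ⊕ scalar c ⊗ q^ e ⊗ q^ d ↑ i ≈ factor c (e + i * d)
    factor≈ e i = R.+-congˡ (R.trans (R.*-assoc _ _ _) (R.*-congˡ
      (R.trans (R.*-congˡ (q^-↑ d i)) (R.sym (q^-+ e (i * d))))))

    factorial≈ : ∀ i → 𝟙 ⊖ q^ d ↑ suc i ≈ factor -1ℤ (d * suc i)
    factorial≈ i = R.+-congˡ (R.trans (⊝-scalar _) (R.*-congˡ
      (R.trans (q^-↑ d (suc i)) (q^-≡ (ℕ.*-comm (suc i) d)))))

  Theta-⟶ : (λ n → theta-sum c a b (1 + n)) ⟶ Theta c a b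
  Theta-⟶ N = ≈[]-trans (≈⇒≈[] (R.sym (theta≈ (1 + N))))
    (≈[]-≈ (J.theta-⟶ N) (coefficientwise λ n → at (theta≈ (1 + n)) n))

  -- Kept in finite form for the case b = 0: there the last product has the exponents 0, 1, 2, ...,
  -- which violate the growth condition of `∏∞-⟶`.
  triple-product-⟶ : (λ N → ∏ (λ i → factor -1ℤ (d * suc i)) (N * 2)
                       ⊗ (∏ (λ i → factor c (a + i * d)) (N * 2) ⊗ ∏ (λ i → factor c (b + i * d)) (N * 2)))
                     ⟶ Theta c a b
  triple-product-⟶ N = ≈[]-trans (≈⇒≈[] (R.sym (R.*-cong (∏-cong factorial≈ (N * 2))
      (R.trans (∏-⊗ _ _ (N * 2)) (R.*-cong (∏-cong (factor≈ a) (N * 2)) (∏-cong (factor≈ b) (N * 2)))))))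
    (≈[]-trans (J.Jacobi-⟶ N) (≈[]-trans (≈⇒≈[] (theta≈ (N * 2))) (theta-sum-⟶ N)))
    where
    theta-sum-⟶ : (λ N → theta-sum c a b (N * 2)) ⟶ Theta c a b
    theta-sum-⟶ zero    = upTo λ n ()
    theta-sum-⟶ (suc N) = ≈[]-weaken (s≤s (ℕ.m≤m*n N 2)) (Theta-⟶ (suc (N * 2)))

  triple-product : .{{_ : NonZero a}} .{{_ : NonZero b}} →
    Theta c a b ≈ f d ⊗ (∏∞ c (λ i → a + i * d) ⊗ ∏∞ c (λ i → b + i * d))
  triple-product = ⟶-unique (λ N → ≈[]-refl) triple-product-⟶
    (⟶-subsequence (_* 2) (λ N → ℕ.m≤m*n N 2)
      (⟶-⊗ (f-⟶ d) (⟶-⊗ (∏∞-⟶ c _ (increasing a)) (∏∞-⟶ c _ (increasing b)))))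
    where
    increasing : ∀ e .{{_ : NonZero e}} i → i < e + i * d
    increasing e i = ℕ.+-mono-≤ (>-nonZero⁻¹ e) (ℕ.m≤m*n i d)

-- In terms of Ramanujan's theta functions, Φ is φ(-q), Ψ is 2 ψ(q), Ω is f(-q, -q⁵) and Α is f(q, q²).
Φ Ψ Ω Α : Series
Φ = Theta -1ℤ 1 1
Ψ = Theta 1ℤ 1 0
Ω = Theta -1ℤ 5 1
Α = Theta 1ℤ 2 1

-- Trisection of Φ and Ψ, by the residue of the summation index modulo 3.

^-triple : ∀ c → c ℤ.* c ≡ 1ℤ → ∀ n → c ℤ.^ (n * 3) ≡ c ℤ.^ n
^-triple c c²≡1 zero    = refl
^-triple c c²≡1 (suc n) = begin
  c ℤ.* (c ℤ.* (c ℤ.* c ℤ.^ (n * 3)))      ≡⟨ cong (λ t → c ℤ.* (c ℤ.* (c ℤ.* t))) (^-triple c c²≡1 n) ⟩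
  c ℤ.* (c ℤ.* (c ℤ.* c ℤ.^ n))            ≡⟨ cong (c ℤ.*_) (ℤ.*-assoc c c _) ⟨
  c ℤ.* (c ℤ.* c ℤ.* c ℤ.^ n)              ≡⟨ cong (λ t → c ℤ.* (t ℤ.* c ℤ.^ n)) c²≡1 ⟩
  c ℤ.* (1ℤ ℤ.* c ℤ.^ n)                   ≡⟨ cong (c ℤ.*_) (ℤ.*-identityˡ _) ⟩
  c ℤ.* c ℤ.^ n                            ∎
  where open ≡-Reasoning

private
  term-V : ∀ {s s′ e e′} → s ≡ s′ → e ≡ e′ * 3 → scalar s ⊗ q^ e ≈ V (scalar s′ ⊗ q^ e′)
  term-V {s} {e′ = e′} refl refl = R.sym (R.trans (V-scalar⊗ s _) (R.*-congˡ (V-q^ e′)))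

  term-qV : ∀ c {s s′ e e′} → s ≡ c ℤ.* s′ → e ≡ 1 + e′ * 3 →
            scalar s ⊗ q^ e ≈ scalar c ⊗ (q^ 1 ⊗ V (scalar s′ ⊗ q^ e′))
  term-qV c {s′ = s′} {e′ = e′} refl refl = begin
    scalar (c ℤ.* s′) ⊗ q^ (1 + e′ * 3)                ≈⟨ R.*-cong (scalar-* c s′) (q^-suc (e′ * 3)) ⟩
    scalar c ⊗ scalar s′ ⊗ (q^ 1 ⊗ q^ (e′ * 3))        ≈⟨ solve 4 (λ c s x y → c :* s :* (x :* y)
        := c :* (x :* (s :* y))) R.refl _ _ _ _ ⟩
    scalar c ⊗ (q^ 1 ⊗ (scalar s′ ⊗ q^ (e′ * 3)))      ≈⟨ R.*-congˡ (R.*-congˡ (term-V refl refl)) ⟩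
    scalar c ⊗ (q^ 1 ⊗ V (scalar s′ ⊗ q^ e′))          ∎
    where open ≈R

  term-VV : ∀ {s s′ e e′} → s ≡ s′ → e ≡ e′ * 3 * 3 → scalar s ⊗ q^ e ≈ V (V (scalar s′ ⊗ q^ e′))
  term-VV s≡ e≡ = R.trans (term-V s≡ e≡) (V-cong (term-V refl refl))

  term-qVV : ∀ c {s s′ e e′} → s ≡ c ℤ.* s′ → e ≡ 1 + e′ * 3 * 3 →
            scalar s ⊗ q^ e ≈ scalar c ⊗ (q^ 1 ⊗ V (V (scalar s′ ⊗ q^ e′)))
  term-qVV c s≡ e≡ = R.trans (term-qV c s≡ e≡) (R.*-congˡ (R.*-congˡ (V-cong (term-V refl refl))))

  V-⊕₃ : ∀ F G H → V (F ⊕ (G ⊕ H)) ≈ V F ⊕ (V G ⊕ V H)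
  V-⊕₃ F G H = R.trans (V-⊕ _ _) (R.+-congˡ (V-⊕ _ _))

module _ where
  private
    -- `progression 1 2 j` is j². The classes of j modulo 3 give 9n², 1 + 3(3n² + 2n) and 1 + 3(3n²
    -- + 4n + 1), the last two brackets being the exponents of `Ω` at the indices n and -(n + 1).
    ³Φ₀ : ∀ n → progression 1 2 (n * 3) ≡ progression 1 2 n * 3 * 3
    ³Φ₀ zero    = refl
    ³Φ₀ (suc n) = trans (cong (λ e → e + (1 + n * 3 * 2) + (1 + (1 + n * 3) * 2) + (1 + (2 + n * 3) * 2)) (³Φ₀ n))
                  (lemma (progression 1 2 n) n)
      where
      lemma : ∀ e n
          → e * 3 * 3 + (1 + n * 3 * 2) + (1 + (1 + n * 3) * 2) + (1 + (2 + n * 3) * 2) ≡ (e + (1 + n * 2)) * 3 * 3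
      lemma = ℕ.solve-∀

    ³Φ₁ : ∀ n → progression 1 2 (1 + n * 3) ≡ 1 + progression 5 6 n * 3
    ³Φ₁ zero    = refl
    ³Φ₁ (suc n) = trans (cong (λ e
        → e + (1 + (1 + n * 3) * 2) + (1 + (2 + n * 3) * 2) + (1 + (3 + n * 3) * 2)) (³Φ₁ n))
                  (lemma (progression 5 6 n) n)
      where
      lemma : ∀ e n
          → 1 + e * 3 + (1 + (1 + n * 3) * 2) + (1 + (2 + n * 3) * 2) + (1 + (3 + n * 3) * 2) ≡ 1 + (e + (5 + n * 6)) * 3
      lemma = ℕ.solve-∀

    ³Φ₂ : ∀ n → progression 1 2 (2 + n * 3) ≡ 1 + progression 1 6 (suc n) * 3
    ³Φ₂ zero    = refl
    ³Φ₂ (suc n) = trans (cong (λ e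
        → e + (1 + (2 + n * 3) * 2) + (1 + (3 + n * 3) * 2) + (1 + (4 + n * 3) * 2)) (³Φ₂ n))
                  (lemma (progression 1 6 (suc n)) n)
      where
      lemma : ∀ e n
          → 1 + e * 3 + (1 + (2 + n * 3) * 2) + (1 + (3 + n * 3) * 2) + (1 + (4 + n * 3) * 2) ≡ 1 + (e + (1 + (1 + n) * 6)) * 3
      lemma = ℕ.solve-∀

    sign : ∀ n → -1ℤ ℤ.^ (n * 3) ≡ -1ℤ ℤ.^ n
    sign = ^-triple -1ℤ refl

    -- Cut at |j| ≤ 3n + 1, the indices j = 3k and j = 3k + 1 both have k running over -n to n
    -- exactly. The remaining indices are the negatives of the second kind, whence the factor 2; its
    -- sign is that of (-1)^(3k+1) against (-1)ᵏ.
    finite : ∀ n → theta-sum -1ℤ 1 1 (1 + n * 3) ≈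
             V (V (theta-sum -1ℤ 1 1 n)) ⊕ scalar (ℤ.- (ℤ.+ 2)) ⊗ (q^ 1 ⊗ V (theta-sum -1ℤ 5 1 n))
    finite zero = R.sym (R.trans
      (R.+-cong (R.trans (V-cong V-𝟙) V-𝟙) (R.*-congˡ (R.trans (R.*-congˡ V-𝟙) (R.*-identityʳ (q^ 1)))))
      (solve 1 (λ q → con 1ℤ :+ con (ℤ.- (ℤ.+ 2)) :* q := con 1ℤ :+ (con -1ℤ :* q :+ con -1ℤ :* q)) R.refl (q^ 1)))
    finite (suc n) = begin
      theta-sum -1ℤ 1 1 (1 + n * 3) ⊕ (t (2 + n * 3) ⊕ t (2 + n * 3)) ⊕ (t (3 + n * 3) ⊕ t (3 + n * 3))
          ⊕ (t (4 + n * 3) ⊕ t (4 + n * 3))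
        ≈⟨ R.+-cong (R.+-cong (R.+-cong (finite n)
             (R.+-cong t₂ t₂)) (R.+-cong t₀ t₀)) (R.+-cong t₁ t₁) ⟩
      VVΦ ⊕ scalar (ℤ.- (ℤ.+ 2)) ⊗ (q^ 1 ⊗ VΩ) ⊕ (scalar -1ℤ ⊗ (q^ 1 ⊗ V ω⁻) ⊕ scalar -1ℤ ⊗ (q^ 1 ⊗ V ω⁻))
        ⊕ (V (V (t (suc n))) ⊕ V (V (t (suc n)))) ⊕ (scalar -1ℤ ⊗ (q^ 1 ⊗ V ω⁺) ⊕ scalar -1ℤ ⊗ (q^ 1 ⊗ V ω⁺))
        ≈⟨ solve 6 (λ φ ω ω⁺ ω⁻ t q → φ :+ con (ℤ.- (ℤ.+ 2)) :* (q :* ω) :+ (con -1ℤ :* (q :* ω⁻)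
            :+ con -1ℤ :* (q :* ω⁻))
              :+ (t :+ t) :+ (con -1ℤ :* (q :* ω⁺) :+ con -1ℤ :* (q :* ω⁺))
              := φ :+ (t :+ t) :+ con (ℤ.- (ℤ.+ 2)) :* (q :* (ω :+ (ω⁺ :+ ω⁻))))
                  R.refl VVΦ VΩ (V ω⁺) (V ω⁻) (V (V (t (suc n)))) (q^ 1) ⟩
      VVΦ ⊕ (V (V (t (suc n))) ⊕ V (V (t (suc n)))) ⊕ scalar (ℤ.- (ℤ.+ 2)) ⊗ (q^ 1 ⊗ (VΩ ⊕ (V ω⁺ ⊕ V ω⁻)))
        ≈⟨ R.+-cong (R.trans (V-cong (V-⊕₃ _ _ _)) (V-⊕₃ _ _ _)) (R.*-congˡ (R.*-congˡ (V-⊕₃ _ _ _))) ⟨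
      V (V (theta-sum -1ℤ 1 1 (suc n))) ⊕ scalar (ℤ.- (ℤ.+ 2)) ⊗ (q^ 1 ⊗ V (theta-sum -1ℤ 5 1 (suc n))) ∎
      where
      open ≈R
      t = theta-term -1ℤ 1 2
      ω⁺ = theta-term -1ℤ 5 6 (suc n)
      ω⁻ = theta-term -1ℤ 1 6 (suc n)
      VVΦ = V (V (theta-sum -1ℤ 1 1 n))
      VΩ = V (theta-sum -1ℤ 5 1 n)
      t₂ : t (2 + n * 3) ≈ scalar -1ℤ ⊗ (q^ 1 ⊗ V ω⁻)
      t₂ = term-qV -1ℤ (cong (λ s → -1ℤ ℤ.* (-1ℤ ℤ.* s)) (sign n)) (³Φ₂ n)
      t₀ : t (3 + n * 3) ≈ V (V (t (suc n)))
      t₀ = term-VV (sign (suc n)) (³Φ₀ (suc n))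
      t₁ : t (4 + n * 3) ≈ scalar -1ℤ ⊗ (q^ 1 ⊗ V ω⁺)
      t₁ = term-qV -1ℤ (cong (-1ℤ ℤ.*_) (sign (suc n))) (³Φ₁ (suc n))

  Φ-trisection : Φ ≈ V (V Φ) ⊕ scalar (ℤ.- (ℤ.+ 2)) ⊗ (q^ 1 ⊗ V Ω)
  Φ-trisection = ⟶-unique (λ n → ≈⇒≈[] (finite (1 + n)))
    (⟶-subsequence (λ n → 3 + n * 3) (λ n → ≤-trans (ℕ.m≤m*n n 3) (ℕ.m≤n+m (n * 3) 3)) (Theta-⟶ -1ℤ refl 1 1))
    (λ n → ⊕-cong[] (V-cong[] (V-cong[] (Theta-⟶ -1ℤ refl 1 1 n))) (⊗-cong[] ≈[]-refl (⊗-cong[] ≈[]-refl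
        (V-cong[] (Theta-⟶ -1ℤ refl 5 1 n)))))

module _ where
  private
    -- `progression 1 1 j` and `progression 0 1 j` are the triangular numbers j(j+1)/2 at the
    -- indices j and -j. The class j = 3k + 1 gives 1 + 9 k(k+1)/2; the other two classes are
    -- exchanged by j ↦ -1 - j, which produces the factor 2 before `V Α`.
    ³Ψ⁺₀ : ∀ n → progression 1 1 (n * 3) ≡ progression 2 3 n * 3
    ³Ψ⁺₀ zero    = refl
    ³Ψ⁺₀ (suc n) = trans (cong (λ e → e + (1 + n * 3 * 1) + (1 + (1 + n * 3) * 1) + (1 + (2 + n * 3) * 1)) (³Ψ⁺₀ n))
                  (lemma (progression 2 3 n) n)
      where
      lemma : ∀ e n → e * 3 + (1 + n * 3 * 1) + (1 + (1 + n * 3) * 1) + (1 + (2 + n * 3) * 1) ≡ (e + (2 + n * 3)) * 3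
      lemma = ℕ.solve-∀

    ³Ψ⁺₁ : ∀ n → progression 1 1 (1 + n * 3) ≡ 1 + progression 1 1 n * 3 * 3
    ³Ψ⁺₁ zero    = refl
    ³Ψ⁺₁ (suc n) = trans (cong (λ e
        → e + (1 + (1 + n * 3) * 1) + (1 + (2 + n * 3) * 1) + (1 + (3 + n * 3) * 1)) (³Ψ⁺₁ n))
                  (lemma (progression 1 1 n) n)
      where
      lemma : ∀ e n
          → 1 + e * 3 * 3 + (1 + (1 + n * 3) * 1) + (1 + (2 + n * 3) * 1) + (1 + (3 + n * 3) * 1) ≡ 1 + (e + (1 + n * 1)) * 3 * 3
      lemma = ℕ.solve-∀

    ³Ψ⁺₂ : ∀ n → progression 1 1 (2 + n * 3) ≡ progression 1 3 (suc n) * 3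
    ³Ψ⁺₂ zero    = refl
    ³Ψ⁺₂ (suc n) = trans (cong (λ e
        → e + (1 + (2 + n * 3) * 1) + (1 + (3 + n * 3) * 1) + (1 + (4 + n * 3) * 1)) (³Ψ⁺₂ n))
                  (lemma (progression 1 3 (suc n)) n)
      where
      lemma : ∀ e n
          → e * 3 + (1 + (2 + n * 3) * 1) + (1 + (3 + n * 3) * 1) + (1 + (4 + n * 3) * 1) ≡ (e + (1 + (1 + n) * 3)) * 3
      lemma = ℕ.solve-∀

    ³Ψ⁻₀ : ∀ n → progression 0 1 (n * 3) ≡ progression 1 3 n * 3
    ³Ψ⁻₀ zero    = refl
    ³Ψ⁻₀ (suc n) = trans (cong (λ e → e + (0 + n * 3 * 1) + (0 + (1 + n * 3) * 1) + (0 + (2 + n * 3) * 1)) (³Ψ⁻₀ n))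
                  (lemma (progression 1 3 n) n)
      where
      lemma : ∀ e n → e * 3 + (0 + n * 3 * 1) + (0 + (1 + n * 3) * 1) + (0 + (2 + n * 3) * 1) ≡ (e + (1 + n * 3)) * 3
      lemma = ℕ.solve-∀

    ³Ψ⁻₁ : ∀ n → progression 0 1 (1 + n * 3) ≡ progression 2 3 n * 3
    ³Ψ⁻₁ zero    = refl
    ³Ψ⁻₁ (suc n) = trans (cong (λ e
        → e + (0 + (1 + n * 3) * 1) + (0 + (2 + n * 3) * 1) + (0 + (3 + n * 3) * 1)) (³Ψ⁻₁ n))
                  (lemma (progression 2 3 n) n)
      where
      lemma : ∀ e n
          → e * 3 + (0 + (1 + n * 3) * 1) + (0 + (2 + n * 3) * 1) + (0 + (3 + n * 3) * 1) ≡ (e + (2 + n * 3)) * 3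
      lemma = ℕ.solve-∀

    ³Ψ⁻₂ : ∀ n → progression 0 1 (2 + n * 3) ≡ 1 + progression 0 1 (suc n) * 3 * 3
    ³Ψ⁻₂ zero    = refl
    ³Ψ⁻₂ (suc n) = trans (cong (λ e
        → e + (0 + (2 + n * 3) * 1) + (0 + (3 + n * 3) * 1) + (0 + (4 + n * 3) * 1)) (³Ψ⁻₂ n))
                  (lemma (progression 0 1 (suc n)) n)
      where
      lemma : ∀ e n
          → 1 + e * 3 * 3 + (0 + (2 + n * 3) * 1) + (0 + (3 + n * 3) * 1) + (0 + (4 + n * 3) * 1) ≡ 1 + (e + (0 + (1 + n) * 1)) * 3 * 3
      lemma = ℕ.solve-∀

    sign : ∀ n → 1ℤ ℤ.^ (n * 3) ≡ 1ℤ ℤ.^ n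
    sign = ^-triple 1ℤ refl

    1*1* : ∀ s → 1ℤ ℤ.* (1ℤ ℤ.* s) ≡ 1ℤ ℤ.* s
    1*1* s = ℤ.*-identityˡ _

    finite : ∀ n → theta-sum 1ℤ 1 0 (1 + n * 3) ≈
             scalar (ℤ.+ 2) ⊗ V (theta-sum 1ℤ 2 1 n) ⊕ scalar 1ℤ ⊗ (q^ 1 ⊗ V (V (theta-sum 1ℤ 1 0 n)))
    -- The index -1 contributes q⁰, the second half of the constant 2.
    finite zero = R.trans
      (solve 2 (λ q q⁰ → con 1ℤ :+ (con 1ℤ :* q :+ con 1ℤ :* q⁰) := con 1ℤ :+ q⁰ :+ q) R.refl (q^ 1) (q^ 0))
      (R.sym (R.trans (R.+-cong (R.*-congˡ V-𝟙) (R.*-congˡ (R.*-congˡ (R.trans (V-cong V-𝟙) V-𝟙))))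
      (R.trans (solve 1 (λ q → con (ℤ.+ 2) :* con 1ℤ :+ con 1ℤ :* (q :* con 1ℤ) := con 1ℤ :+ con 1ℤ :+ q)
          R.refl (q^ 1))
               (R.+-congʳ (R.+-congˡ (R.sym q^0))))))
    finite (suc n) = begin
      theta-sum 1ℤ 1 0 (1 + n * 3) ⊕ (t⁺ (2 + n * 3) ⊕ t⁻ (2 + n * 3)) ⊕ (t⁺ (3 + n * 3) ⊕ t⁻ (3 + n * 3))
          ⊕ (t⁺ (4 + n * 3) ⊕ t⁻ (4 + n * 3))
        ≈⟨ R.+-cong (R.+-cong (R.+-cong (finite n)
             (R.+-cong (term-V (cong (λ s → 1ℤ ℤ.* (1ℤ ℤ.* s)) (sign n) ⟨ trans ⟩ 1*1* _) (³Ψ⁺₂ n))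
                       (term-qVV 1ℤ (cong (λ s → 1ℤ ℤ.* (1ℤ ℤ.* s)) (sign n)) (³Ψ⁻₂ n))))
             (R.+-cong (term-V (sign (suc n)) (³Ψ⁺₀ (suc n))) (term-V (sign (suc n)) (³Ψ⁻₀ (suc n)))))
             (R.+-cong (term-qVV 1ℤ (cong (1ℤ ℤ.*_) (sign (suc n))) (³Ψ⁺₁ (suc n)))
                       (term-V (cong (1ℤ ℤ.*_) (sign (suc n)) ⟨ trans ⟩ ℤ.*-identityˡ _) (³Ψ⁻₁ (suc n)))) ⟩
      scalar (ℤ.+ 2) ⊗ VΑ ⊕ scalar 1ℤ ⊗ (q^ 1 ⊗ VVΨ)
        ⊕ (V α⁻ ⊕ scalar 1ℤ ⊗ (q^ 1 ⊗ V (V (t⁻ (suc n))))) ⊕ (V α⁺ ⊕ V α⁻) ⊕ (scalar 1ℤ ⊗ (q^ 1 ⊗ V (V (t⁺ (suc n))))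
            ⊕ V α⁺)
        ≈⟨ solve 7 (λ α ψ α⁺ α⁻ t⁺ t⁻ q → con (ℤ.+ 2) :* α :+ con 1ℤ :* (q :* ψ)
                 :+ (α⁻ :+ con 1ℤ :* (q :* t⁻)) :+ (α⁺ :+ α⁻) :+ (con 1ℤ :* (q :* t⁺) :+ α⁺)
              := con (ℤ.+ 2) :* (α :+ (α⁺ :+ α⁻)) :+ con 1ℤ :* (q :* (ψ :+ (t⁺ :+ t⁻)))) R.refl
              VΑ VVΨ (V α⁺) (V α⁻) (V (V (t⁺ (suc n)))) (V (V (t⁻ (suc n)))) (q^ 1) ⟩
      scalar (ℤ.+ 2) ⊗ (VΑ ⊕ (V α⁺ ⊕ V α⁻)) ⊕ scalar 1ℤ ⊗ (q^ 1 ⊗ (VVΨ ⊕ (V (V (t⁺ (suc n))) ⊕ V (V (t⁻ (suc n))))))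
        ≈⟨ R.+-cong (R.*-congˡ (V-⊕₃ _ _ _)) (R.*-congˡ (R.*-congˡ (R.trans (V-cong (V-⊕₃ _ _ _)) (V-⊕₃ _ _ _)))) ⟨
      scalar (ℤ.+ 2) ⊗ V (theta-sum 1ℤ 2 1 (suc n)) ⊕ scalar 1ℤ ⊗ (q^ 1 ⊗ V (V (theta-sum 1ℤ 1 0 (suc n)))) ∎
      where
      open ≈R
      t⁺ = theta-term 1ℤ 1 1
      t⁻ = theta-term 1ℤ 0 1
      α⁺ = theta-term 1ℤ 2 3 (suc n)
      α⁻ = theta-term 1ℤ 1 3 (suc n)
      VVΨ = V (V (theta-sum 1ℤ 1 0 n))
      VΑ = V (theta-sum 1ℤ 2 1 n)

  Ψ-trisection : Ψ ≈ scalar (ℤ.+ 2) ⊗ V Α ⊕ scalar 1ℤ ⊗ (q^ 1 ⊗ V (V Ψ))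
  Ψ-trisection = ⟶-unique (λ n → ≈⇒≈[] (finite (1 + n)))
    (⟶-subsequence (λ n → 3 + n * 3) (λ n → ≤-trans (ℕ.m≤m*n n 3) (ℕ.m≤n+m (n * 3) 3)) (Theta-⟶ 1ℤ refl 1 0))
    (λ n → ⊕-cong[] (⊗-cong[] ≈[]-refl (V-cong[] (Theta-⟶ 1ℤ refl 2 1 n)))
      (⊗-cong[] ≈[]-refl (⊗-cong[] ≈[]-refl (V-cong[] (V-cong[] (Theta-⟶ 1ℤ refl 1 0 n))))))

-- Product formulas for the theta series

∏∞-pairs : ∀ c e → (∀ i → i < e i) → (∀ i → i < e (i * 2)) → (∀ i → i < e (1 + i * 2)) →
           ∏∞ c e ≈ ∏∞ c (λ i → e (i * 2)) ⊗ ∏∞ c (λ i → e (1 + i * 2))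
∏∞-pairs c e <e <e₀ <e₁ = ⟶-unique
  (λ n → ≈⇒≈[] (R.trans (∏-pairs (λ i → factor c (e i)) n) (∏-⊗ (λ i → factor c (e (i * 2))) (λ i
      → factor c (e (1 + i * 2))) n)))
  (⟶-subsequence (_* 2) (λ n → ℕ.m≤m*n n 2) (∏∞-⟶ c e <e))
  (⟶-⊗ (∏∞-⟶ c _ <e₀) (∏∞-⟶ c _ <e₁))

∏∞-cong : ∀ c {e e′ : ℕ → ℕ} → (∀ i → e i ≡ e′ i) → ∏∞ c e ≈ ∏∞ c e′
∏∞-cong c e≡e′ = coefficientwise λ n → at (∏-cong (λ i → factor-≡ c (e≡e′ i)) n) n

∏∞-conjugate : ∀ e → (∀ i → i < e i) → ∏∞ -1ℤ e ⊗ ∏∞ 1ℤ e ≈ ∏∞ -1ℤ (λ i → 2 * e i)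
∏∞-conjugate e <e = ⟶-unique
  (λ n → ≈⇒≈[] (R.trans (R.sym (∏-⊗ _ _ n)) (∏-cong (λ i → conjugate (e i)) n)))
  (⟶-⊗ (∏∞-⟶ -1ℤ e <e) (∏∞-⟶ 1ℤ e <e))
  (∏∞-⟶ -1ℤ _ (λ i → ≤-trans (<e i) (ℕ.m≤n*m (e i) 2)))
  where
  conjugate : ∀ k → factor -1ℤ k ⊗ factor 1ℤ k ≈ factor -1ℤ (2 * k)
  conjugate k = R.trans
    (solve 1 (λ x → (con 1ℤ :+ con -1ℤ :* x) :* (con 1ℤ :+ con 1ℤ :* x) := con 1ℤ :+ con -1ℤ :* (x :* x))
        R.refl (q^ k))
    (R.+-congˡ (R.*-congˡ (R.sym (R.trans (q^-≡ (cong (k +_) (ℕ.+-identityʳ k))) (q^-+ k k)))))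

private
  <+ : ∀ a d .{{_ : NonZero d}} i → i < suc a + i * d
  <+ a d i = s≤s (≤-trans (ℕ.m≤m*n i d) (ℕ.m≤n+m (i * d) a))

  <+2* : ∀ a d .{{_ : NonZero d}} i → i < suc a + i * 2 * d
  <+2* a d i = ≤-trans (<+ a 2 i) (s≤s (ℕ.+-monoʳ-≤ a (ℕ.m≤m*n (i * 2) d)))

-- φ(-q) = f₂ o² and ψ(q) = f₁ g², where o g = 1 by Euler's identity.
o g : Series
o = ∏∞ -1ℤ (λ i → 1 + i * 2)
g = ∏∞ 1ℤ (λ i → 1 + i * 1)

f₁≈ : f 1 ≈ ∏∞ -1ℤ (λ i → 1 + i * 1)
f₁≈ = R.trans (f-≈ 1) (∏∞-cong -1ℤ reindex)
  where
  reindex : ∀ i → 1 * suc i ≡ 1 + i * 1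
  reindex = ℕ.solve-∀

f₁≈of₂ : f 1 ≈ o ⊗ f 2
f₁≈of₂ = R.trans f₁≈ (R.trans (∏∞-pairs -1ℤ _ (<+ 0 1) (<+2* 0 1) (λ i → ≤-trans (<+2* 0 1 i) (m≤n⇒m≤1+n ≤-refl)))
  (R.*-cong (∏∞-cong -1ℤ reindex₁) (R.trans (∏∞-cong -1ℤ reindex₂) (R.sym (f-≈ 2)))))
  where
  reindex₁ : ∀ i → 1 + i * 2 * 1 ≡ 1 + i * 2
  reindex₁ = ℕ.solve-∀
  reindex₂ : ∀ i → 1 + (1 + i * 2) * 1 ≡ 2 * suc i
  reindex₂ = ℕ.solve-∀

f₁g≈f₂ : f 1 ⊗ g ≈ f 2
f₁g≈f₂ = R.trans (R.*-congʳ f₁≈) (R.trans (∏∞-conjugate _ (<+ 0 1))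
  (R.trans (∏∞-cong -1ℤ reindex) (R.sym (f-≈ 2))))
  where
  reindex : ∀ i → 2 * (1 + i * 1) ≡ 2 * suc i
  reindex = ℕ.solve-∀

og≈𝟙 : o ⊗ g ≈ 𝟙
og≈𝟙 = ⊗-cancelˡ (f 1) (f-constant 1) (begin
  f 1 ⊗ (o ⊗ g)      ≈⟨ solve 3 (λ f o g → f :* (o :* g) := o :* (f :* g)) R.refl (f 1) o g ⟩
  o ⊗ (f 1 ⊗ g)      ≈⟨ R.*-congˡ f₁g≈f₂ ⟩
  o ⊗ f 2            ≈⟨ f₁≈of₂ ⟨
  f 1                ≈⟨ R.*-identityʳ _ ⟨
  f 1 ⊗ 𝟙            ∎)
  where open ≈R

Φ-product : Φ ≈ f 2 ⊗ (o ⊗ o)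
Φ-product = triple-product -1ℤ refl 1 1

-- The product over the exponents 0, 1, 2, ... starts with 1 + q⁰ = 2, which is split off before the
-- limit. This is the 2 by which `Ψ` exceeds ψ(q).
Ψ-product : Ψ ≈ f 1 ⊗ (g ⊗ (scalar (ℤ.+ 2) ⊗ g))
Ψ-product = ⟶-unique (λ N → ≈[]-refl) (triple-product-⟶ 1ℤ refl 1 0)
  (⟶-⊗ (sub (f-⟶ 1)) (⟶-⊗ (sub (∏∞-⟶ 1ℤ _ (<+ 0 1))) limit))
  where
  sub : ∀ {s F} → s ⟶ F → (λ N → s (N * 2)) ⟶ F
  sub = ⟶-subsequence (_* 2) (λ N → ℕ.m≤m*n N 2)
  limit : (λ N → ∏ (λ i → factor 1ℤ (0 + i * 1)) (N * 2)) ⟶ scalar (ℤ.+ 2) ⊗ g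
  limit zero    = upTo λ n ()
  limit (suc N) = ≈[]-trans (≈⇒≈[] (R.trans (∏-sucˡ (λ i → factor 1ℤ (0 + i * 1)) (suc (N * 2)))
      (R.*-congʳ (R.trans (R.+-congˡ (R.*-congˡ q^0)) (solve 0 (con 1ℤ :+ con 1ℤ :* con 1ℤ := con (ℤ.+ 2)) R.refl)))))
    (⊗-cong[] ≈[]-refl (≈[]-weaken (s≤s (ℕ.m≤m*n N 2)) (∏∞-⟶ 1ℤ (λ i → 1 + i * 1) (<+ 0 1) (suc (N * 2)))))

ΦΨ : Φ ⊗ Ψ ≈ scalar (ℤ.+ 2) ⊗ (f 1 ⊗ f 2)
ΦΨ = begin
  Φ ⊗ Ψ
    ≈⟨ R.*-cong Φ-product Ψ-product ⟩
  f 2 ⊗ (o ⊗ o) ⊗ (f 1 ⊗ (g ⊗ (scalar (ℤ.+ 2) ⊗ g)))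
    ≈⟨ solve 4 (λ f₁ f₂ o g → f₂ :* (o :* o) :* (f₁ :* (g :* (con (ℤ.+ 2) :* g)))
        := con (ℤ.+ 2) :* (f₁ :* f₂) :* ((o :* g) :* (o :* g)))
         R.refl (f 1) (f 2) o g ⟩
  scalar (ℤ.+ 2) ⊗ (f 1 ⊗ f 2) ⊗ (o ⊗ g ⊗ (o ⊗ g))
    ≈⟨ R.*-congˡ (R.trans (R.*-cong og≈𝟙 og≈𝟙) (R.*-identityʳ 𝟙)) ⟩
  scalar (ℤ.+ 2) ⊗ (f 1 ⊗ f 2) ⊗ 𝟙
    ≈⟨ R.*-identityʳ _ ⟩
  scalar (ℤ.+ 2) ⊗ (f 1 ⊗ f 2) ∎
  where open ≈R

-- By the triple product only the infinite products by residues modulo 6 and 3 have to cancel. From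
-- (1 - y)(1 + y) = 1 - y² come p₁d₁ = c₂ and p₂d₂ = c₄, while p₁ = c₁c₄ and p₂ = c₂c₅; multiplying
-- these together, the surplus is c₂c₄ on both sides.
ΩΑ : Ω ⊗ Α ≈ f 3 ⊗ f 6
ΩΑ = begin
  Ω ⊗ Α                                      ≈⟨ R.*-cong (triple-product -1ℤ refl 5 1) (triple-product 1ℤ refl 2 1) ⟩
  f 6 ⊗ (c₅ ⊗ c₁) ⊗ (f 3 ⊗ (d₂ ⊗ d₁))        ≈⟨ solve 4 (λ x y c d → x :* c :* (y :* d) := y :* x :* (c :* d))
      R.refl (f 6) (f 3) (c₅ ⊗ c₁) (d₂ ⊗ d₁) ⟩
  f 3 ⊗ f 6 ⊗ (c₅ ⊗ c₁ ⊗ (d₂ ⊗ d₁))          ≈⟨ R.*-congˡ cd≈𝟙 ⟩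
  f 3 ⊗ f 6 ⊗ 𝟙                              ≈⟨ R.*-identityʳ _ ⟩
  f 3 ⊗ f 6                                  ∎
  where
  open ≈R
  c₁ c₂ c₄ c₅ d₁ d₂ p₁ p₂ : Series
  c₁ = ∏∞ -1ℤ (λ i → 1 + i * 6)
  c₂ = ∏∞ -1ℤ (λ i → 2 + i * 6)
  c₄ = ∏∞ -1ℤ (λ i → 4 + i * 6)
  c₅ = ∏∞ -1ℤ (λ i → 5 + i * 6)
  d₁ = ∏∞ 1ℤ (λ i → 1 + i * 3)
  d₂ = ∏∞ 1ℤ (λ i → 2 + i * 3)
  p₁ = ∏∞ -1ℤ (λ i → 1 + i * 3)
  p₂ = ∏∞ -1ℤ (λ i → 2 + i * 3)
  p₁≈ : p₁ ≈ c₁ ⊗ c₄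
  p₁≈ = R.trans (∏∞-pairs -1ℤ _ (<+ 0 3) (<+2* 0 3) (λ i → ≤-trans (<+2* 3 3 i) (ℕ.≤-reflexive (sym (reindex₄ i)))))
          (R.*-cong (∏∞-cong -1ℤ reindex₁) (∏∞-cong -1ℤ (λ i → trans (reindex₄ i) (reindex₄′ i))))
    where
    reindex₁ : ∀ i → 1 + i * 2 * 3 ≡ 1 + i * 6
    reindex₁ = ℕ.solve-∀
    reindex₄ : ∀ i → 1 + (1 + i * 2) * 3 ≡ 4 + i * 2 * 3
    reindex₄ = ℕ.solve-∀
    reindex₄′ : ∀ i → 4 + i * 2 * 3 ≡ 4 + i * 6
    reindex₄′ = ℕ.solve-∀
  p₂≈ : p₂ ≈ c₂ ⊗ c₅
  p₂≈ = R.trans (∏∞-pairs -1ℤ _ (<+ 1 3) (<+2* 1 3) (λ i → ≤-trans (<+2* 4 3 i) (ℕ.≤-reflexive (sym (reindex₅ i)))))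
          (R.*-cong (∏∞-cong -1ℤ reindex₂) (∏∞-cong -1ℤ (λ i → trans (reindex₅ i) (reindex₅′ i))))
    where
    reindex₂ : ∀ i → 2 + i * 2 * 3 ≡ 2 + i * 6
    reindex₂ = ℕ.solve-∀
    reindex₅ : ∀ i → 2 + (1 + i * 2) * 3 ≡ 5 + i * 2 * 3
    reindex₅ = ℕ.solve-∀
    reindex₅′ : ∀ i → 5 + i * 2 * 3 ≡ 5 + i * 6
    reindex₅′ = ℕ.solve-∀
  p₁d₁≈ : p₁ ⊗ d₁ ≈ c₂
  p₁d₁≈ = R.trans (∏∞-conjugate _ (<+ 0 3)) (∏∞-cong -1ℤ reindex)
    where
    reindex : ∀ i → 2 * (1 + i * 3) ≡ 2 + i * 6
    reindex = ℕ.solve-∀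
  p₂d₂≈ : p₂ ⊗ d₂ ≈ c₄
  p₂d₂≈ = R.trans (∏∞-conjugate _ (<+ 1 3)) (∏∞-cong -1ℤ reindex)
    where
    reindex : ∀ i → 2 * (2 + i * 3) ≡ 4 + i * 6
    reindex = ℕ.solve-∀
  cd≈𝟙 : c₅ ⊗ c₁ ⊗ (d₂ ⊗ d₁) ≈ 𝟙
  cd≈𝟙 = ⊗-cancelˡ (c₂ ⊗ c₄) (⊗-constant c₂ c₄ refl refl) (begin
    c₂ ⊗ c₄ ⊗ (c₅ ⊗ c₁ ⊗ (d₂ ⊗ d₁))      ≈⟨ solve 6 (λ c₁ c₂ c₄ c₅ d₁ d₂ → c₂ :* c₄ :* (c₅ :* c₁ :* (d₂ :* d₁))
        := c₁ :* c₄ :* d₁ :* (c₂ :* c₅ :* d₂))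
                                               R.refl c₁ c₂ c₄ c₅ d₁ d₂ ⟩
    c₁ ⊗ c₄ ⊗ d₁ ⊗ (c₂ ⊗ c₅ ⊗ d₂)        ≈⟨ R.*-cong (R.*-congʳ p₁≈) (R.*-congʳ p₂≈) ⟨
    p₁ ⊗ d₁ ⊗ (p₂ ⊗ d₂)                  ≈⟨ R.*-cong p₁d₁≈ p₂d₂≈ ⟩
    c₂ ⊗ c₄                              ≈⟨ R.*-identityʳ _ ⟨
    c₂ ⊗ c₄ ⊗ 𝟙                          ∎)

-- The trisection of f₁f₂

-- The three sections of f₁f₂ up to sign; `Α` is a capital alpha, not the matrix `A`.
Y b a c : Series
Y = f 1 ⊗ f 2
b = f 3 ⊗ f 6
a = Α ⊗ V Φ
c = Ω ⊗ V Ψ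

V-Y : V Y ≈ b
V-Y = R.trans (V-⊗ _ _) (R.*-cong (V-f 1) (V-f 2))

2⊗-cancel : ∀ {F G} → scalar (ℤ.+ 2) ⊗ F ≈ scalar (ℤ.+ 2) ⊗ G → F ≈ G
2⊗-cancel {F} {G} 2F≈2G = coefficientwise λ n → ℤ.*-cancelˡ-≡ (ℤ.+ 2) (F n) (G n)
  (trans (at (·-scalar (ℤ.+ 2) F) n) (trans (at 2F≈2G n) (sym (at (·-scalar (ℤ.+ 2) G) n))))

VΩVΑ : V Ω ⊗ V Α ≈ V b
VΩVΑ = R.trans (R.sym (V-⊗ _ _)) (V-cong ΩΑ)

VΦVΨ : V Φ ⊗ V Ψ ≈ scalar (ℤ.+ 2) ⊗ b
VΦVΨ = R.trans (R.sym (V-⊗ _ _)) (R.trans (V-cong ΦΨ) (R.trans (V-scalar⊗ _ _) (R.*-congˡ V-Y)))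

ac≈2b² : a ⊗ c ≈ scalar (ℤ.+ 2) ⊗ (b ⊗ b)
ac≈2b² = begin
  Α ⊗ V Φ ⊗ (Ω ⊗ V Ψ)             ≈⟨ solve 4 (λ α φ ω ψ → α :* φ :* (ω :* ψ) := ω :* α :* (φ :* ψ))
      R.refl Α (V Φ) Ω (V Ψ) ⟩
  Ω ⊗ Α ⊗ (V Φ ⊗ V Ψ)             ≈⟨ R.*-cong ΩΑ VΦVΨ ⟩
  b ⊗ (scalar (ℤ.+ 2) ⊗ b)        ≈⟨ solve 1 (λ b → b :* (con (ℤ.+ 2) :* b) := con (ℤ.+ 2) :* (b :* b)) R.refl b ⟩
  scalar (ℤ.+ 2) ⊗ (b ⊗ b)        ∎
  where open ≈R

-- Two of the four products of pieces fall into the middle section: q φ(-q⁹) ψ(q⁹) taken twice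
-- contributes 2b, and the cross term of `Ω` and `Α` contributes -4b. Everything is doubled because
-- `Ψ` is.
Y-trisection : Y ≈ V a ⊕ q^ 1 ⊗ V (⊝ b) ⊕ q^ 2 ⊗ V (⊝ c)
Y-trisection = 2⊗-cancel (begin
  scalar (ℤ.+ 2) ⊗ Y
    ≈⟨ ΦΨ ⟨
  Φ ⊗ Ψ
    ≈⟨ R.*-cong Φ-trisection Ψ-trisection ⟩
  (VVΦ ⊕ scalar (ℤ.- (ℤ.+ 2)) ⊗ (q^ 1 ⊗ V Ω)) ⊗ (scalar (ℤ.+ 2) ⊗ V Α ⊕ scalar 1ℤ ⊗ (q^ 1 ⊗ VVΨ))
    ≈⟨ solve 5 (λ φ ω α ψ q → (φ :+ con (ℤ.- (ℤ.+ 2)) :* (q :* ω)) :* (con (ℤ.+ 2) :* α :+ con 1ℤ :* (q :* ψ))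
         := con (ℤ.+ 2) :* (α :* φ) :+ q :* (φ :* ψ) :+ con (ℤ.- (ℤ.+ 4)) :* (q :* (ω :* α))
             :+ con (ℤ.- (ℤ.+ 2)) :* (q :* q :* (ω :* ψ)))
         R.refl VVΦ (V Ω) (V Α) VVΨ (q^ 1) ⟩
  scalar (ℤ.+ 2) ⊗ (V Α ⊗ VVΦ) ⊕ q^ 1 ⊗ (VVΦ ⊗ VVΨ) ⊕ scalar (ℤ.- (ℤ.+ 4)) ⊗ (q^ 1 ⊗ (V Ω ⊗ V Α))
    ⊕ scalar (ℤ.- (ℤ.+ 2)) ⊗ (q^ 1 ⊗ q^ 1 ⊗ (V Ω ⊗ VVΨ))
    ≈⟨ R.+-cong (R.+-cong (R.+-cong (R.*-congˡ (R.sym (V-⊗ _ _)))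
         (R.*-congˡ (R.trans (R.sym (V-⊗ _ _)) (R.trans (V-cong VΦVΨ) (V-scalar⊗ _ _)))))
         (R.*-congˡ (R.*-congˡ VΩVΑ)))
         (R.*-congˡ (R.*-cong (R.sym q²) (R.sym (V-⊗ _ _)))) ⟩
  scalar (ℤ.+ 2) ⊗ V a ⊕ q^ 1 ⊗ (scalar (ℤ.+ 2) ⊗ V b) ⊕ scalar (ℤ.- (ℤ.+ 4)) ⊗ (q^ 1 ⊗ V b)
    ⊕ scalar (ℤ.- (ℤ.+ 2)) ⊗ (q^ 2 ⊗ V c)
    ≈⟨ solve 5 (λ a b c q q² → con (ℤ.+ 2) :* a :+ q :* (con (ℤ.+ 2) :* b) :+ con (ℤ.- (ℤ.+ 4)) :* (q :* b)
        :+ con (ℤ.- (ℤ.+ 2)) :* (q² :* c)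
         := con (ℤ.+ 2) :* (a :+ q :* (:- b) :+ q² :* (:- c))) R.refl (V a) (V b) (V c) (q^ 1) (q^ 2) ⟩
  scalar (ℤ.+ 2) ⊗ (V a ⊕ q^ 1 ⊗ (⊝ V b) ⊕ q^ 2 ⊗ (⊝ V c))
    ≈⟨ R.*-congˡ (R.+-cong (R.+-congˡ (R.*-congˡ (V-⊝ b))) (R.*-congˡ (V-⊝ c))) ⟨
  scalar (ℤ.+ 2) ⊗ (V a ⊕ q^ 1 ⊗ V (⊝ b) ⊕ q^ 2 ⊗ V (⊝ c)) ∎)
  where
  open ≈R
  VVΦ = V (V Φ)
  VVΨ = V (V Ψ)

D₀-Y : D₀ Y ≈ a
D₀-Y = R.trans (D₀-cong Y-trisection) (D₀-trisected _ _ _)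

D₁-Y : D₁ Y ≈ ⊝ b
D₁-Y = R.trans (D₁-cong Y-trisection) (D₁-trisected _ _ _)

D₂-Y : D₂ Y ≈ ⊝ c
D₂-Y = R.trans (D₂-cong Y-trisection) (D₂-trisected _ _ _)

-- The 7 is 1 + 6: one b³ from the cube of -b, six from 3abc with ac = 2b².
norm-Y : norm Y ≈ cube a ⊖ scalar (ℤ.+ 7) ⊗ q^ 1 ⊗ cube b ⊖ q^ 1 ⊗ q^ 1 ⊗ cube c
norm-Y = R.trans (norm-form-cong D₀-Y D₁-Y D₂-Y) (R.trans
  (solve 4 (λ a b c q → a :* a :* a :+ q :* ((:- b) :* (:- b) :* (:- b))
      :+ q :* q :* ((:- c) :* (:- c) :* (:- c)) :- con (ℤ.+ 3) :* q :* (a :* (:- b) :* (:- c))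
     := a :* a :* a :- q :* (b :* b :* b) :- q :* q :* (c :* c :* c) :- con (ℤ.+ 3) :* q :* (b :* (a :* c)))
         R.refl a b c (q^ 1))
  (R.trans (R.+-congˡ (R.-‿cong (R.*-congˡ (R.*-congˡ ac≈2b²))))
  (solve 4 (λ a b c q
      → a :* a :* a :- q :* (b :* b :* b) :- q :* q :* (c :* c :* c) :- con (ℤ.+ 3) :* q :* (b :* (con (ℤ.+ 2) :* (b :* b)))
     := a :* a :* a :- con (ℤ.+ 7) :* q :* (b :* b :* b) :- q :* q :* (c :* c :* c)) R.refl a b c (q^ 1))))

norm-Y⊗b : norm Y ⊗ b ≈ Y ⊗ cube Y
norm-Y⊗b = begin
  norm Y ⊗ (f 3 ⊗ f 6)                            ≈⟨ R.*-congʳ (norm-⊗ (f 1) (f 2)) ⟩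
  norm (f 1) ⊗ norm (f 2) ⊗ (f 3 ⊗ f 6)              ≈⟨ interchange _ _ _ _ ⟩
  norm (f 1) ⊗ f 3 ⊗ (norm (f 2) ⊗ f 6)              ≈⟨ R.*-cong norm-f1 norm-f2 ⟩
  f 1 ⊗ cube (f 1) ⊗ (f 2 ⊗ cube (f 2))        ≈⟨ solve 2 (λ x y → x :* (x :* x :* x) :* (y :* (y :* y :* y))
      := x :* y :* (x :* y :* (x :* y) :* (x :* y)))
                                                    R.refl (f 1) (f 2) ⟩
  Y ⊗ cube Y                                   ∎
  where open ≈R

V-cube : ∀ F → V (cube F) ≈ cube (V F)
V-cube F = R.trans (V-⊗ _ _) (R.*-congʳ (V-⊗ F F))

Y-constant : Y 0 ≡ 1ℤ
Y-constant = ⊗-constant (f 1) (f 2) (f-constant 1) (f-constant 2)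

b-constant : b 0 ≡ 1ℤ
b-constant = ⊗-constant (f 3) (f 6) (f-constant 3) (f-constant 6)

Vb-constant : V b 0 ≡ 1ℤ
Vb-constant = trans (V-zero b) b-constant

opaque
  unfolding _⊗_

  G≈ : G ≈ b ⊗ inverse Y
  G≈ = R.refl

GY≈b : G ⊗ Y ≈ b
GY≈b = begin
  G ⊗ Y                    ≈⟨ R.*-congʳ G≈ ⟩
  b ⊗ inverse Y ⊗ Y        ≈⟨ R.*-assoc _ _ _ ⟩
  b ⊗ (inverse Y ⊗ Y)      ≈⟨ R.*-congˡ (R.trans (R.*-comm _ _) (inverseʳ Y Y-constant)) ⟩
  b ⊗ 𝟙                    ≈⟨ R.*-identityʳ b ⟩
  b                        ∎
  where open ≈R

G-constant : G 0 ≡ 1ℤ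
G-constant = begin
  G 0                ≡⟨ ℤ.*-identityʳ (G 0) ⟨
  G 0 ℤ.* 1ℤ         ≡⟨ cong (G 0 ℤ.*_) Y-constant ⟨
  G 0 ℤ.* Y 0        ≡⟨ ⊗-zero G Y ⟨
  (G ⊗ Y) 0          ≡⟨ at GY≈b 0 ⟩
  b 0                ≡⟨ b-constant ⟩
  1ℤ                 ∎
  where open ≡-Reasoning

-- The cubic equation and the sections of the powers of u

-- t = q G⁴ and u = q G(q) G(q³); the conjugates of u under q ↦ ωq are the roots of a cubic over ℤ[t(q³)].

G⁴ t u : Series
G⁴ = G ⊗ cube G
t = q^ 1 ⊗ G⁴
u = q^ 1 ⊗ (G ⊗ V G)

-- Since b is itself `V Y`, the relation G Y = b applies twice, at q and at q³. It exhibits u as a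
-- series in q³ divided by Y / q.
uY≈qVb : u ⊗ Y ≈ q^ 1 ⊗ V b
uY≈qVb = begin
  q^ 1 ⊗ (G ⊗ V G) ⊗ Y      ≈⟨ solve 4 (λ q g v y → q :* (g :* v) :* y := q :* (v :* (g :* y)))
      R.refl (q^ 1) G (V G) Y ⟩
  q^ 1 ⊗ (V G ⊗ (G ⊗ Y))    ≈⟨ R.*-congˡ (R.*-congˡ (R.trans GY≈b (R.sym V-Y))) ⟩
  q^ 1 ⊗ (V G ⊗ V Y)        ≈⟨ R.*-congˡ (V-⊗ G Y) ⟨
  q^ 1 ⊗ V (G ⊗ Y)          ≈⟨ R.*-congˡ (V-cong GY≈b) ⟩
  q^ 1 ⊗ V b                ∎
  where open ≈R

G⁴-norm-Y : G⁴ ⊗ norm Y ≈ cube b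
G⁴-norm-Y = ⊗-cancelˡ b b-constant (begin
  b ⊗ (G⁴ ⊗ norm Y)            ≈⟨ solve 3 (λ b g n → b :* (g :* n) := g :* (n :* b)) R.refl b G⁴ (norm Y) ⟩
  G⁴ ⊗ (norm Y ⊗ b)            ≈⟨ R.*-congˡ norm-Y⊗b ⟩
  G⁴ ⊗ (Y ⊗ cube Y)         ≈⟨ solve 2 (λ g y → g :* (g :* g :* g) :* (y :* (y :* y :* y))
      := g :* y :* (g :* y :* (g :* y) :* (g :* y))) R.refl G Y ⟩
  G ⊗ Y ⊗ cube (G ⊗ Y)      ≈⟨ R.*-cong GY≈b (R.*-cong (R.*-cong GY≈b GY≈b) GY≈b) ⟩
  b ⊗ cube b                ∎)
  where open ≈R

VG⁴-Vnorm-Y : V G⁴ ⊗ V (norm Y) ≈ cube (V b)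
VG⁴-Vnorm-Y = R.trans (R.sym (V-⊗ _ _)) (R.trans (V-cong G⁴-norm-Y) (V-cube b))

V-q-cube : V (q^ 1) ≈ cube (q^ 1)
V-q-cube = R.trans V-q (R.trans (q^-+ 2 1) (R.*-congʳ q²))

-- The characteristic equation of Y / q over the series in q³, multiplied by q³. After inserting the
-- trisection, everything beyond the norm is a multiple of 2b² - ac at q³.
Y-cubic : cube Y ⊕ scalar (ℤ.+ 3) ⊗ (q^ 1 ⊗ V b ⊗ (Y ⊗ Y)) ⊕ scalar (ℤ.+ 9) ⊗ (q^ 1 ⊗ q^ 1 ⊗ (V b ⊗ V b) ⊗ Y)
    ≈ V (norm Y)
Y-cubic = begin
  cube Y ⊕ scalar (ℤ.+ 3) ⊗ (q^ 1 ⊗ V b ⊗ (Y ⊗ Y)) ⊕ scalar (ℤ.+ 9) ⊗ (q^ 1 ⊗ q^ 1 ⊗ (V b ⊗ V b) ⊗ Y)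
    ≈⟨ cubic Y≈ ⟩
  cubic-at (V a ⊕ q^ 1 ⊗ (⊝ V b) ⊕ q^ 1 ⊗ q^ 1 ⊗ (⊝ V c))
    ≈⟨ solve 4 (λ a b c q → let y = a :+ q :* (:- b) :+ q :* q :* (:- c) in
         y :* y :* y :+ con (ℤ.+ 3) :* (q :* b :* (y :* y)) :+ con (ℤ.+ 9) :* (q :* q :* (b :* b) :* y)
         := a :* a :* a :- con (ℤ.+ 7) :* (q :* q :* q) :* (b :* b :* b) :- (q :* q :* q) :* (q :* q :* q) :* (c :* c :* c)
            :+ con (ℤ.+ 3) :* (q :* q :* (a :- q :* q :* c) :* (con (ℤ.+ 2) :* (b :* b) :- a :* c)))
                R.refl (V a) (V b) (V c) (q^ 1) ⟩
  cube (V a) ⊖ scalar (ℤ.+ 7) ⊗ (q^ 1 ⊗ q^ 1 ⊗ q^ 1) ⊗ cube (V b) ⊖ q^ 1 ⊗ q^ 1 ⊗ q^ 1 ⊗ (q^ 1 ⊗ q^ 1 ⊗ q^ 1) ⊗ cube (V c)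
    ⊕ scalar (ℤ.+ 3) ⊗ (q^ 1 ⊗ q^ 1 ⊗ (V a ⊖ q^ 1 ⊗ q^ 1 ⊗ V c) ⊗ (scalar (ℤ.+ 2) ⊗ (V b ⊗ V b) ⊖ V a ⊗ V c))
    ≈⟨ R.+-congˡ (R.*-congˡ (R.*-congˡ (R.trans (R.+-congˡ (R.-‿cong VaVc)) (R.-‿inverseʳ _)))) ⟩
  cube (V a) ⊖ scalar (ℤ.+ 7) ⊗ (q^ 1 ⊗ q^ 1 ⊗ q^ 1) ⊗ cube (V b) ⊖ q^ 1 ⊗ q^ 1 ⊗ q^ 1 ⊗ (q^ 1 ⊗ q^ 1 ⊗ q^ 1) ⊗ cube (V c)
    ⊕ scalar (ℤ.+ 3) ⊗ (q^ 1 ⊗ q^ 1 ⊗ (V a ⊖ q^ 1 ⊗ q^ 1 ⊗ V c) ⊗ 𝟘)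
    ≈⟨ solve 3 (λ x y z → x :+ y :* (z :* con 0ℤ) := x) R.refl _ _ _ ⟩
  cube (V a) ⊖ scalar (ℤ.+ 7) ⊗ (q^ 1 ⊗ q^ 1 ⊗ q^ 1) ⊗ cube (V b) ⊖ q^ 1 ⊗ q^ 1 ⊗ q^ 1 ⊗ (q^ 1 ⊗ q^ 1 ⊗ q^ 1) ⊗ cube (V c)
    ≈⟨ R.+-cong (R.+-cong (V-cube a) (R.-‿cong (R.*-cong (R.*-congˡ V-q-cube) (V-cube b)))) (R.-‿cong (R.*-cong
        (R.*-cong V-q-cube V-q-cube) (V-cube c))) ⟨
  V (cube a) ⊖ scalar (ℤ.+ 7) ⊗ V (q^ 1) ⊗ V (cube b) ⊖ V (q^ 1) ⊗ V (q^ 1) ⊗ V (cube c)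
    ≈⟨ R.+-cong (R.+-congˡ (R.-‿cong (R.*-congʳ (V-scalar⊗ _ _)))) (R.-‿cong (R.*-congʳ (V-⊗ _ _))) ⟨
  V (cube a) ⊖ V (scalar (ℤ.+ 7) ⊗ q^ 1) ⊗ V (cube b) ⊖ V (q^ 1 ⊗ q^ 1) ⊗ V (cube c)
    ≈⟨ R.+-cong (R.+-congˡ (R.-‿cong (V-⊗ _ _))) (R.-‿cong (V-⊗ _ _)) ⟨
  V (cube a) ⊖ V (scalar (ℤ.+ 7) ⊗ q^ 1 ⊗ cube b) ⊖ V (q^ 1 ⊗ q^ 1 ⊗ cube c)
    ≈⟨ R.+-cong (R.+-congˡ (V-⊝ _)) (V-⊝ _) ⟨
  V (cube a) ⊕ V (⊝ (scalar (ℤ.+ 7) ⊗ q^ 1 ⊗ cube b)) ⊕ V (⊝ (q^ 1 ⊗ q^ 1 ⊗ cube c))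
    ≈⟨ R.trans (V-⊕ _ _) (R.+-congʳ (V-⊕ _ _)) ⟨
  V (cube a ⊖ scalar (ℤ.+ 7) ⊗ q^ 1 ⊗ cube b ⊖ q^ 1 ⊗ q^ 1 ⊗ cube c)
    ≈⟨ V-cong norm-Y ⟨
  V (norm Y) ∎
  where
  open ≈R
  cubic-at : Series → Series
  cubic-at y = cube y ⊕ scalar (ℤ.+ 3) ⊗ (q^ 1 ⊗ V b ⊗ (y ⊗ y)) ⊕ scalar (ℤ.+ 9) ⊗ (q^ 1 ⊗ q^ 1 ⊗ (V b ⊗ V b) ⊗ y)
  cubic : ∀ {y z} → y ≈ z → cubic-at y ≈ cubic-at z
  cubic y≈z = R.+-cong (R.+-cong (R.*-cong (R.*-cong y≈z y≈z) y≈z) (R.*-congˡ (R.*-congˡ (R.*-cong y≈z y≈z))))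
      (R.*-congˡ (R.*-congˡ y≈z))
  Y≈ : Y ≈ V a ⊕ q^ 1 ⊗ (⊝ V b) ⊕ q^ 1 ⊗ q^ 1 ⊗ (⊝ V c)
  Y≈ = R.trans Y-trisection (R.+-cong (R.+-congˡ (R.*-congˡ (V-⊝ b))) (R.*-cong q² (V-⊝ c)))
  VaVc : V a ⊗ V c ≈ scalar (ℤ.+ 2) ⊗ (V b ⊗ V b)
  VaVc = R.trans (R.sym (V-⊗ _ _)) (R.trans (V-cong ac≈2b²) (R.trans (V-scalar⊗ _ _) (R.*-congˡ (V-⊗ _ _))))

private
  -- Multiplying the cubic equation of Y by uⁱ / Y³ and using u Y = q V b.
  Vnorm-Y-times : ∀ w → w ⊗ cube (V b) ≈ V G⁴ ⊗ (w ⊗ (cube Y ⊕ scalar (ℤ.+ 3) ⊗ (q^ 1 ⊗ V b ⊗ (Y ⊗ Y))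
      ⊕ scalar (ℤ.+ 9) ⊗ (q^ 1 ⊗ q^ 1 ⊗ (V b ⊗ V b) ⊗ Y)))
  Vnorm-Y-times w = R.trans (R.*-congˡ (R.sym VG⁴-Vnorm-Y)) (R.trans
    (solve 3 (λ w g n → w :* (g :* n) := g :* (w :* n)) R.refl w (V G⁴) (V (norm Y)))
    (R.*-congˡ (R.*-congˡ (R.sym Y-cubic))))

-- One factor u absorbs one Y from the cubic, leaving only powers of Y, whose sections are known, on
-- the right.
u-equation₁ : V (b ⊗ b) ⊗ u ≈ V G⁴ ⊗ (q^ 1 ⊗ (Y ⊗ Y) ⊕ V (scalar (ℤ.+ 3) ⊗ b) ⊗ (q^ 1 ⊗ (q^ 1 ⊗ Y))
    ⊕ V (scalar (ℤ.+ 9) ⊗ (q^ 1 ⊗ (b ⊗ b))))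
u-equation₁ = ⊗-cancelˡ (V b) Vb-constant (begin
  V b ⊗ (V (b ⊗ b) ⊗ u)
    ≈⟨ R.*-congˡ (R.*-congʳ (V-⊗ b b)) ⟩
  V b ⊗ (V b ⊗ V b ⊗ u)
    ≈⟨ solve 2 (λ b u → b :* (b :* b :* u) := u :* (b :* b :* b)) R.refl (V b) u ⟩
  u ⊗ cube (V b)
    ≈⟨ Vnorm-Y-times u ⟩
  V G⁴ ⊗ (u ⊗ (cube Y ⊕ scalar (ℤ.+ 3) ⊗ (q^ 1 ⊗ V b ⊗ (Y ⊗ Y)) ⊕ scalar (ℤ.+ 9) ⊗ (q^ 1 ⊗ q^ 1 ⊗ (V b ⊗ V b) ⊗ Y)))
    ≈⟨ R.*-congˡ (solve 4 (λ u y q b → u :* (y :* y :* y :+ con (ℤ.+ 3) :* (q :* b :* (y :* y))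
        :+ con (ℤ.+ 9) :* (q :* q :* (b :* b) :* y))
         := (u :* y) :* (y :* y :+ con (ℤ.+ 3) :* (q :* b :* y) :+ con (ℤ.+ 9) :* (q :* q :* (b :* b))))
             R.refl u Y (q^ 1) (V b)) ⟩
  V G⁴ ⊗ (u ⊗ Y ⊗ (Y ⊗ Y ⊕ scalar (ℤ.+ 3) ⊗ (q^ 1 ⊗ V b ⊗ Y) ⊕ scalar (ℤ.+ 9) ⊗ (q^ 1 ⊗ q^ 1 ⊗ (V b ⊗ V b))))
    ≈⟨ R.*-congˡ (R.*-congʳ uY≈qVb) ⟩
  V G⁴ ⊗ (q^ 1 ⊗ V b ⊗ (Y ⊗ Y ⊕ scalar (ℤ.+ 3) ⊗ (q^ 1 ⊗ V b ⊗ Y) ⊕ scalar (ℤ.+ 9) ⊗ (q^ 1 ⊗ q^ 1 ⊗ (V b ⊗ V b))))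
    ≈⟨ solve 4 (λ g y q b → g :* (q :* b :* (y :* y :+ con (ℤ.+ 3) :* (q :* b :* y)
        :+ con (ℤ.+ 9) :* (q :* q :* (b :* b))))
         := b :* (g :* (q :* (y :* y) :+ con (ℤ.+ 3) :* b :* (q :* (q :* y))
             :+ con (ℤ.+ 9) :* (q :* q :* q :* (b :* b))))) R.refl (V G⁴) Y (q^ 1) (V b) ⟩
  V b ⊗ (V G⁴ ⊗ (q^ 1 ⊗ (Y ⊗ Y) ⊕ scalar (ℤ.+ 3) ⊗ V b ⊗ (q^ 1 ⊗ (q^ 1 ⊗ Y))
      ⊕ scalar (ℤ.+ 9) ⊗ (q^ 1 ⊗ q^ 1 ⊗ q^ 1 ⊗ (V b ⊗ V b))))
    ≈⟨ R.*-congˡ (R.*-congˡ (R.+-cong (R.+-congˡ (R.*-congʳ (V-scalar⊗ _ _)))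
         (R.trans (V-scalar⊗ _ _) (R.*-congˡ (R.trans (V-⊗ _ _) (R.*-cong V-q-cube (V-⊗ _ _))))))) ⟨
  V b ⊗ (V G⁴ ⊗ (q^ 1 ⊗ (Y ⊗ Y) ⊕ V (scalar (ℤ.+ 3) ⊗ b) ⊗ (q^ 1 ⊗ (q^ 1 ⊗ Y))
      ⊕ V (scalar (ℤ.+ 9) ⊗ (q^ 1 ⊗ (b ⊗ b))))) ∎)
  where open ≈R

-- Two factors u leave Y and a single u, whose section `D₀-u` provides.
u-equation₂ : V b ⊗ (u ⊗ u) ≈ V G⁴ ⊗ (q^ 1 ⊗ (q^ 1 ⊗ Y) ⊕ V (scalar (ℤ.+ 3) ⊗ (q^ 1 ⊗ b))
    ⊕ V (scalar (ℤ.+ 9) ⊗ (q^ 1 ⊗ b)) ⊗ u)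
u-equation₂ = ⊗-cancelˡ (V b ⊗ V b) (⊗-constant (V b) (V b) Vb-constant Vb-constant) (begin
  V b ⊗ V b ⊗ (V b ⊗ (u ⊗ u))
    ≈⟨ solve 2 (λ b u → b :* b :* (b :* (u :* u)) := u :* u :* (b :* b :* b)) R.refl (V b) u ⟩
  u ⊗ u ⊗ cube (V b)
    ≈⟨ Vnorm-Y-times (u ⊗ u) ⟩
  V G⁴ ⊗ (u ⊗ u ⊗ (cube Y ⊕ scalar (ℤ.+ 3) ⊗ (q^ 1 ⊗ V b ⊗ (Y ⊗ Y))
      ⊕ scalar (ℤ.+ 9) ⊗ (q^ 1 ⊗ q^ 1 ⊗ (V b ⊗ V b) ⊗ Y)))
    ≈⟨ R.*-congˡ (solve 4 (λ u y q b → u :* u :* (y :* y :* y :+ con (ℤ.+ 3) :* (q :* b :* (y :* y))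
        :+ con (ℤ.+ 9) :* (q :* q :* (b :* b) :* y))
         := (u :* y) :* (u :* y) :* y :+ con (ℤ.+ 3) :* (q :* b :* ((u :* y) :* (u :* y)))
             :+ con (ℤ.+ 9) :* (q :* q :* (b :* b) :* (u :* (u :* y)))) R.refl u Y (q^ 1) (V b)) ⟩
  V G⁴ ⊗ (u ⊗ Y ⊗ (u ⊗ Y) ⊗ Y ⊕ scalar (ℤ.+ 3) ⊗ (q^ 1 ⊗ V b ⊗ (u ⊗ Y ⊗ (u ⊗ Y)))
      ⊕ scalar (ℤ.+ 9) ⊗ (q^ 1 ⊗ q^ 1 ⊗ (V b ⊗ V b) ⊗ (u ⊗ (u ⊗ Y))))
    ≈⟨ R.*-congˡ (R.+-cong (R.+-cong (R.*-congʳ (R.*-cong uY≈qVb uY≈qVb)) (R.*-congˡ (R.*-congˡ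
        (R.*-cong uY≈qVb uY≈qVb)))) (R.*-congˡ (R.*-congˡ (R.*-congˡ uY≈qVb)))) ⟩
  V G⁴ ⊗ (q^ 1 ⊗ V b ⊗ (q^ 1 ⊗ V b) ⊗ Y ⊕ scalar (ℤ.+ 3) ⊗ (q^ 1 ⊗ V b ⊗ (q^ 1 ⊗ V b ⊗ (q^ 1 ⊗ V b)))
      ⊕ scalar (ℤ.+ 9) ⊗ (q^ 1 ⊗ q^ 1 ⊗ (V b ⊗ V b) ⊗ (u ⊗ (q^ 1 ⊗ V b))))
    ≈⟨ solve 5 (λ g u y q b → g :* (q :* b :* (q :* b) :* y :+ con (ℤ.+ 3) :* (q :* b :* (q :* b :* (q :* b)))
        :+ con (ℤ.+ 9) :* (q :* q :* (b :* b) :* (u :* (q :* b))))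
         := b :* b :* (g :* (q :* (q :* y) :+ con (ℤ.+ 3) :* (q :* q :* q :* b)
             :+ con (ℤ.+ 9) :* (q :* q :* q :* b) :* u))) R.refl (V G⁴) u Y (q^ 1) (V b) ⟩
  V b ⊗ V b ⊗ (V G⁴ ⊗ (q^ 1 ⊗ (q^ 1 ⊗ Y) ⊕ scalar (ℤ.+ 3) ⊗ (q^ 1 ⊗ q^ 1 ⊗ q^ 1 ⊗ V b)
      ⊕ scalar (ℤ.+ 9) ⊗ (q^ 1 ⊗ q^ 1 ⊗ q^ 1 ⊗ V b) ⊗ u))
    ≈⟨ R.*-congˡ (R.*-congˡ (R.+-cong (R.+-congˡ (R.trans (V-scalar⊗ _ _) (R.*-congˡ (R.trans (V-⊗ _ _)
        (R.*-congʳ V-q-cube)))))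
         (R.*-congʳ (R.trans (V-scalar⊗ _ _) (R.*-congˡ (R.trans (V-⊗ _ _) (R.*-congʳ V-q-cube))))))) ⟨
  V b ⊗ V b ⊗ (V G⁴ ⊗ (q^ 1 ⊗ (q^ 1 ⊗ Y) ⊕ V (scalar (ℤ.+ 3) ⊗ (q^ 1 ⊗ b)) ⊕ V (scalar (ℤ.+ 9) ⊗ (q^ 1 ⊗ b)) ⊗ u)) ∎)
  where open ≈R

-- Three factors u absorb every Y.
u-cubic : cube u ≈ V t ⊗ (𝟙 ⊕ scalar (ℤ.+ 3) ⊗ u ⊕ scalar (ℤ.+ 9) ⊗ (u ⊗ u))
u-cubic = ⊗-cancelˡ (V b ⊗ V b ⊗ V b)
  (⊗-constant (V b ⊗ V b) (V b) (⊗-constant (V b) (V b) Vb-constant Vb-constant) Vb-constant) (begin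
  cube (V b) ⊗ cube u
    ≈⟨ R.*-comm _ _ ⟩
  cube u ⊗ cube (V b)
    ≈⟨ Vnorm-Y-times (cube u) ⟩
  V G⁴ ⊗ (cube u ⊗ (cube Y ⊕ scalar (ℤ.+ 3) ⊗ (q^ 1 ⊗ V b ⊗ (Y ⊗ Y))
      ⊕ scalar (ℤ.+ 9) ⊗ (q^ 1 ⊗ q^ 1 ⊗ (V b ⊗ V b) ⊗ Y)))
    ≈⟨ R.*-congˡ (solve 4 (λ u y q b → u :* u :* u :* (y :* y :* y :+ con (ℤ.+ 3) :* (q :* b :* (y :* y))
        :+ con (ℤ.+ 9) :* (q :* q :* (b :* b) :* y))
         := (u :* y) :* (u :* y) :* (u :* y) :+ con (ℤ.+ 3) :* (q :* b :* ((u :* y) :* (u :* y)) :* u)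
             :+ con (ℤ.+ 9) :* (q :* q :* (b :* b) :* (u :* u :* (u :* y)))) R.refl u Y (q^ 1) (V b)) ⟩
  V G⁴ ⊗ (cube (u ⊗ Y) ⊕ scalar (ℤ.+ 3) ⊗ (q^ 1 ⊗ V b ⊗ (u ⊗ Y ⊗ (u ⊗ Y)) ⊗ u)
      ⊕ scalar (ℤ.+ 9) ⊗ (q^ 1 ⊗ q^ 1 ⊗ (V b ⊗ V b) ⊗ (u ⊗ u ⊗ (u ⊗ Y))))
    ≈⟨ R.*-congˡ (R.+-cong (R.+-cong (R.*-cong (R.*-cong uY≈qVb uY≈qVb) uY≈qVb) (R.*-congˡ (R.*-congʳ (R.*-congˡ
        (R.*-cong uY≈qVb uY≈qVb))))) (R.*-congˡ (R.*-congˡ (R.*-congˡ uY≈qVb)))) ⟩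
  V G⁴ ⊗ (cube (q^ 1 ⊗ V b) ⊕ scalar (ℤ.+ 3) ⊗ (q^ 1 ⊗ V b ⊗ (q^ 1 ⊗ V b ⊗ (q^ 1 ⊗ V b)) ⊗ u)
      ⊕ scalar (ℤ.+ 9) ⊗ (q^ 1 ⊗ q^ 1 ⊗ (V b ⊗ V b) ⊗ (u ⊗ u ⊗ (q^ 1 ⊗ V b))))
    ≈⟨ solve 4 (λ g u q b → g :* (q :* b :* (q :* b) :* (q :* b)
        :+ con (ℤ.+ 3) :* (q :* b :* (q :* b :* (q :* b)) :* u)
        :+ con (ℤ.+ 9) :* (q :* q :* (b :* b) :* (u :* u :* (q :* b))))
         := b :* b :* b :* (q :* q :* q :* g :* (con 1ℤ :+ con (ℤ.+ 3) :* u :+ con (ℤ.+ 9) :* (u :* u))))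
             R.refl (V G⁴) u (q^ 1) (V b) ⟩
  cube (V b) ⊗ (q^ 1 ⊗ q^ 1 ⊗ q^ 1 ⊗ V G⁴ ⊗ (𝟙 ⊕ scalar (ℤ.+ 3) ⊗ u ⊕ scalar (ℤ.+ 9) ⊗ (u ⊗ u)))
    ≈⟨ R.*-congˡ (R.*-congʳ (R.trans (V-⊗ _ _) (R.*-congʳ V-q-cube))) ⟨
  cube (V b) ⊗ (V t ⊗ (𝟙 ⊕ scalar (ℤ.+ 3) ⊗ u ⊕ scalar (ℤ.+ 9) ⊗ (u ⊗ u))) ∎)
  where open ≈R

D₀-⊕₃ : ∀ F G H → D₀ (F ⊕ G ⊕ H) ≈ D₀ F ⊕ D₀ G ⊕ D₀ H
D₀-⊕₃ F G H = R.trans (D₀-⊕ _ _) (R.+-congʳ (D₀-⊕ _ _))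

-- The 3 arises as -3 - 3 + 9 in multiples of b²: the section of Y² gives b² - 2ac = -3b², that of Y
-- gives -3b², and the constant term 9b².
D₀-u : D₀ u ≈ scalar (ℤ.+ 3) ⊗ t
D₀-u = ⊗-cancelˡ (b ⊗ b) (⊗-constant b b b-constant b-constant) (begin
  b ⊗ b ⊗ D₀ u
    ≈⟨ D₀-V⊗ (b ⊗ b) u ⟨
  D₀ (V (b ⊗ b) ⊗ u)
    ≈⟨ D₀-cong u-equation₁ ⟩
  D₀ (V G⁴ ⊗ (q^ 1 ⊗ (Y ⊗ Y) ⊕ V (scalar (ℤ.+ 3) ⊗ b) ⊗ (q^ 1 ⊗ (q^ 1 ⊗ Y)) ⊕ V (scalar (ℤ.+ 9) ⊗ (q^ 1 ⊗ (b ⊗ b)))))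
    ≈⟨ R.trans (D₀-V⊗ G⁴ _) (R.*-congˡ (D₀-⊕₃ _ _ _)) ⟩
  G⁴ ⊗ (D₀ (q^ 1 ⊗ (Y ⊗ Y)) ⊕ D₀ (V (scalar (ℤ.+ 3) ⊗ b) ⊗ (q^ 1 ⊗ (q^ 1 ⊗ Y)))
      ⊕ D₀ (V (scalar (ℤ.+ 9) ⊗ (q^ 1 ⊗ (b ⊗ b)))))
    ≈⟨ R.*-congˡ (R.+-cong (R.+-cong
         (R.trans (D₀-q⊗ _) (R.*-congˡ (R.trans (D₂-⊗ Y Y) (R.+-cong (R.+-cong (R.*-cong D₀-Y D₂-Y)
             (R.*-cong D₁-Y D₁-Y)) (R.*-cong D₂-Y D₀-Y)))))
         (R.trans (D₀-V⊗ _ _) (R.*-congˡ (R.trans (D₀-q⊗ _) (R.*-congˡ (R.trans (D₂-q⊗ Y) D₁-Y))))))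
         (D₀V _)) ⟩
  G⁴ ⊗ (q^ 1 ⊗ (a ⊗ (⊝ c) ⊕ (⊝ b) ⊗ (⊝ b) ⊕ (⊝ c) ⊗ a) ⊕ scalar (ℤ.+ 3) ⊗ b ⊗ (q^ 1 ⊗ (⊝ b))
      ⊕ scalar (ℤ.+ 9) ⊗ (q^ 1 ⊗ (b ⊗ b)))
    ≈⟨ solve 5 (λ a b c q g → g :* (q :* (a :* (:- c) :+ (:- b) :* (:- b) :+ (:- c) :* a)
        :+ con (ℤ.+ 3) :* b :* (q :* (:- b)) :+ con (ℤ.+ 9) :* (q :* (b :* b)))
         := g :* (q :* (con (ℤ.+ 7) :* (b :* b) :- con (ℤ.+ 2) :* (a :* c)))) R.refl a b c (q^ 1) G⁴ ⟩
  G⁴ ⊗ (q^ 1 ⊗ (scalar (ℤ.+ 7) ⊗ (b ⊗ b) ⊖ scalar (ℤ.+ 2) ⊗ (a ⊗ c)))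
    ≈⟨ R.*-congˡ (R.*-congˡ (R.+-congˡ (R.-‿cong (R.*-congˡ ac≈2b²)))) ⟩
  G⁴ ⊗ (q^ 1 ⊗ (scalar (ℤ.+ 7) ⊗ (b ⊗ b) ⊖ scalar (ℤ.+ 2) ⊗ (scalar (ℤ.+ 2) ⊗ (b ⊗ b))))
    ≈⟨ solve 3 (λ b q g → g :* (q :* (con (ℤ.+ 7) :* (b :* b) :- con (ℤ.+ 2) :* (con (ℤ.+ 2) :* (b :* b))))
        := b :* b :* (con (ℤ.+ 3) :* (q :* g))) R.refl b (q^ 1) G⁴ ⟩
  b ⊗ b ⊗ (scalar (ℤ.+ 3) ⊗ t) ∎)
  where open ≈R

D₀-u² : D₀ (u ⊗ u) ≈ scalar (ℤ.+ 2) ⊗ t ⊕ scalar (ℤ.+ 27) ⊗ (t ⊗ t)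
D₀-u² = ⊗-cancelˡ b b-constant (begin
  b ⊗ D₀ (u ⊗ u)
    ≈⟨ D₀-V⊗ b (u ⊗ u) ⟨
  D₀ (V b ⊗ (u ⊗ u))
    ≈⟨ D₀-cong u-equation₂ ⟩
  D₀ (V G⁴ ⊗ (q^ 1 ⊗ (q^ 1 ⊗ Y) ⊕ V (scalar (ℤ.+ 3) ⊗ (q^ 1 ⊗ b)) ⊕ V (scalar (ℤ.+ 9) ⊗ (q^ 1 ⊗ b)) ⊗ u))
    ≈⟨ R.trans (D₀-V⊗ G⁴ _) (R.*-congˡ (D₀-⊕₃ _ _ _)) ⟩
  G⁴ ⊗ (D₀ (q^ 1 ⊗ (q^ 1 ⊗ Y)) ⊕ D₀ (V (scalar (ℤ.+ 3) ⊗ (q^ 1 ⊗ b))) ⊕ D₀ (V (scalar (ℤ.+ 9) ⊗ (q^ 1 ⊗ b)) ⊗ u))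
    ≈⟨ R.*-congˡ (R.+-cong (R.+-cong (R.trans (D₀-q⊗ _) (R.*-congˡ (R.trans (D₂-q⊗ Y) D₁-Y))) (D₀V _))
        (R.trans (D₀-V⊗ _ u) (R.*-congˡ D₀-u))) ⟩
  G⁴ ⊗ (q^ 1 ⊗ (⊝ b) ⊕ scalar (ℤ.+ 3) ⊗ (q^ 1 ⊗ b) ⊕ scalar (ℤ.+ 9) ⊗ (q^ 1 ⊗ b) ⊗ (scalar (ℤ.+ 3) ⊗ t))
    ≈⟨ solve 3 (λ b q g → g :* (q :* (:- b) :+ con (ℤ.+ 3) :* (q :* b)
        :+ con (ℤ.+ 9) :* (q :* b) :* (con (ℤ.+ 3) :* (q :* g)))
         := b :* (con (ℤ.+ 2) :* (q :* g) :+ con (ℤ.+ 27) :* (q :* g :* (q :* g)))) R.refl b (q^ 1) G⁴ ⟩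
  b ⊗ (scalar (ℤ.+ 2) ⊗ t ⊕ scalar (ℤ.+ 27) ⊗ (t ⊗ t)) ∎)
  where open ≈R

u↑-recurrence : ∀ i → D₀ (u ↑ (3 + i)) ≈ t ⊗ (D₀ (u ↑ i) ⊕ scalar (ℤ.+ 3) ⊗ D₀ (u ↑ (1 + i))
    ⊕ scalar (ℤ.+ 9) ⊗ D₀ (u ↑ (2 + i)))
u↑-recurrence i = begin
  D₀ (u ⊗ (u ⊗ (u ⊗ u ↑ i)))
    ≈⟨ D₀-cong (solve 2 (λ u x → u :* (u :* (u :* x)) := u :* u :* u :* x) R.refl u (u ↑ i)) ⟩
  D₀ (cube u ⊗ u ↑ i)
    ≈⟨ D₀-cong (R.*-congʳ u-cubic) ⟩
  D₀ (V t ⊗ (𝟙 ⊕ scalar (ℤ.+ 3) ⊗ u ⊕ scalar (ℤ.+ 9) ⊗ (u ⊗ u)) ⊗ u ↑ i)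
    ≈⟨ D₀-cong (solve 3 (λ t u x → t :* (con 1ℤ :+ con (ℤ.+ 3) :* u :+ con (ℤ.+ 9) :* (u :* u)) :* x
         := t :* (x :+ con (ℤ.+ 3) :* (u :* x) :+ con (ℤ.+ 9) :* (u :* (u :* x)))) R.refl (V t) u (u ↑ i)) ⟩
  D₀ (V t ⊗ (u ↑ i ⊕ scalar (ℤ.+ 3) ⊗ u ↑ (1 + i) ⊕ scalar (ℤ.+ 9) ⊗ u ↑ (2 + i)))
    ≈⟨ R.trans (D₀-V⊗ t _) (R.*-congˡ (R.trans (D₀-⊕₃ _ _ _) (R.+-cong
        (R.+-congˡ (D₀-scalar⊗ _ _)) (D₀-scalar⊗ _ _)))) ⟩
  t ⊗ (D₀ (u ↑ i) ⊕ scalar (ℤ.+ 3) ⊗ D₀ (u ↑ (1 + i)) ⊕ scalar (ℤ.+ 9) ⊗ D₀ (u ↑ (2 + i))) ∎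
  where open ≈R

-- Finite sums

partial-cong : ∀ {s r} n → (∀ k → k < n → s k ≈ r k) → partial s n ≈ partial r n
partial-cong zero    s≈r = R.refl
partial-cong (suc n) s≈r = R.+-cong (partial-cong n λ k k<n → s≈r k (m≤n⇒m≤1+n k<n)) (s≈r n ≤-refl)

partial-⊕ : ∀ s r n → partial (λ k → s k ⊕ r k) n ≈ partial s n ⊕ partial r n
partial-⊕ s r zero    = R.sym (R.+-identityʳ 𝟘)
partial-⊕ s r (suc n) = R.trans (R.+-congʳ (partial-⊕ s r n)) (⊕-interchange _ _ _ _)

⊗-partial : ∀ F s n → F ⊗ partial s n ≈ partial (λ k → F ⊗ s k) n
⊗-partial F s zero    = R.zeroʳ F
⊗-partial F s (suc n) = R.trans (R.distribˡ F _ _) (R.+-congʳ (⊗-partial F s n))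

partial-≡0 : ∀ {s} n → (∀ k → k < n → s k ≈ 𝟘) → partial s n ≈ 𝟘
partial-≡0 zero    s≈0 = R.refl
partial-≡0 (suc n) s≈0 = R.trans (R.+-cong (partial-≡0 n λ k k<n
    → s≈0 k (m≤n⇒m≤1+n k<n)) (s≈0 n ≤-refl)) (R.+-identityʳ 𝟘)

partial-+ : ∀ s j n → partial s (j + n) ≈ partial s j ⊕ partial (λ k → s (j + k)) n
partial-+ s j zero    = R.trans (R.reflexive (cong (partial s) (ℕ.+-identityʳ j))) (R.sym (R.+-identityʳ _))
partial-+ s j (suc n) = R.trans (R.reflexive (cong (partial s) (ℕ.+-suc j n)))
  (R.trans (R.+-congʳ (partial-+ s j n)) (R.+-assoc _ _ _))

partial-extend : ∀ {N s} K n → (∀ k → s (K + k) ≈[ N ] 𝟘) → partial s (K + n) ≈[ N ] partial s K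
partial-extend K zero    s≈0 = ≈⇒≈[] (R.reflexive (cong (partial _) (ℕ.+-identityʳ K)))
partial-extend {s = s} K (suc n) s≈0 = ≈[]-trans (≈⇒≈[] (R.reflexive (cong (partial s) (ℕ.+-suc K n))))
  (≈[]-≈ (⊕-cong[] (partial-extend K n s≈0) (s≈0 n)) (R.+-identityʳ _))

scalar⊗𝟘 : ∀ {c} F → c ≡ 0ℤ → scalar c ⊗ F ≈ 𝟘
scalar⊗𝟘 F refl = R.zeroˡ F

-- Interchange of summation: the inner sums that appear are the entries of a vector-matrix product,
-- in the form in which `x` is defined.
partial-swap : ∀ (y : ℕ → ℤ) (z : ℕ → ℕ → ℤ) (H : ℕ → Series) J K →
  partial (λ k → scalar (y k) ⊗ partial (λ j → scalar (z k j) ⊗ H j) J) K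
  ≈ partial (λ j → scalar (∑[ k < K ] (y (toℕ k) ℤ.* z (toℕ k) j)) ⊗ H j) J
partial-swap y z H J zero    = R.sym (partial-≡0 J λ j _ → R.zeroˡ (H j))
partial-swap y z H J (suc K) = begin
  partial (λ k → scalar (y k) ⊗ partial (λ j → scalar (z k j) ⊗ H j) J) K ⊕ scalar (y K) ⊗ partial (λ j
      → scalar (z K j) ⊗ H j) J
    ≈⟨ R.+-cong (partial-swap y z H J K) (⊗-partial _ _ J) ⟩
  partial (λ j → scalar (∑[ k < K ] (y (toℕ k) ℤ.* z (toℕ k) j)) ⊗ H j) J ⊕ partial (λ j
      → scalar (y K) ⊗ (scalar (z K j) ⊗ H j)) J
    ≈⟨ partial-⊕ _ _ J ⟨
  partial (λ j → scalar (∑[ k < K ] (y (toℕ k) ℤ.* z (toℕ k) j)) ⊗ H j ⊕ scalar (y K) ⊗ (scalar (z K j) ⊗ H j)) J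
    ≈⟨ partial-cong J (λ j _ → collect j) ⟩
  partial (λ j → scalar (∑[ k < suc K ] (y (toℕ k) ℤ.* z (toℕ k) j)) ⊗ H j) J ∎
  where
  open ≈R
  collect : ∀ j → scalar (∑[ k < K ] (y (toℕ k) ℤ.* z (toℕ k) j)) ⊗ H j ⊕ scalar (y K) ⊗ (scalar (z K j) ⊗ H j)
            ≈ scalar (∑[ k < suc K ] (y (toℕ k) ℤ.* z (toℕ k) j)) ⊗ H j
  collect j = R.trans (R.+-congˡ (R.sym (R.*-assoc _ _ _))) (R.trans (R.sym (R.distribʳ (H j) _ _))
    (R.*-congʳ (R.trans (R.+-congˡ (R.sym (scalar-* _ _))) (R.trans (R.sym (scalar-+ _ _))
      (R.reflexive (cong scalar (sym (∑-last (λ k → y k ℤ.* z k j) K))))))))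

-- D₀ (uⁱ) as a polynomial in t

m-polynomial : ℕ → ℕ → Series
m-polynomial i = partial (λ j → scalar (m i (suc j)) ⊗ t ↑ suc j)

-- `m` is lower triangular, so the bound is immaterial from i on; leaving it free lets rows of
-- different length share one bound in the recurrence.
m-polynomial-extend : ∀ i {J} → i ≤ J → m-polynomial i J ≈ m-polynomial i i
m-polynomial-extend i {J} i≤J = R.trans (R.reflexive (cong (m-polynomial i) (sym (ℕ.m+[n∸m]≡n i≤J))))
  (≈[]⇒≈ λ N → partial-extend i (J ∸ i) λ k → ≈⇒≈[] (scalar⊗𝟘 _ (m-upper i (suc (i + k)) (s≤s (ℕ.m≤m+n i k)))))

m-polynomial-recurrence : ∀ i J → m-polynomial (4 + i) (suc J) ≈
  t ⊗ (m-polynomial (1 + i) J ⊕ scalar (ℤ.+ 3) ⊗ m-polynomial (2 + i) J ⊕ scalar (ℤ.+ 9) ⊗ m-polynomial (3 + i) J)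
m-polynomial-recurrence i zero    =
  solve 1 (λ t → con 0ℤ :+ con 0ℤ :* (t :* con 1ℤ) := t :* (con 0ℤ :+ con (ℤ.+ 3) :* con 0ℤ :+ con (ℤ.+ 9) :* con 0ℤ))
      R.refl t
m-polynomial-recurrence i (suc J) = begin
  m-polynomial (4 + i) (suc J) ⊕ scalar (ℤ.+ 9 ℤ.* m₃ ℤ.+ ℤ.+ 3 ℤ.* m₂ ℤ.+ m₁) ⊗ (t ⊗ T)
    ≈⟨ R.+-cong (m-polynomial-recurrence i J) (R.*-congʳ
         (R.trans (scalar-+ _ _) (R.+-congʳ (R.trans (scalar-+ _ _) (R.+-cong (scalar-* _ _) (scalar-* _ _)))))) ⟩
  t ⊗ (p₁ ⊕ scalar (ℤ.+ 3) ⊗ p₂ ⊕ scalar (ℤ.+ 9) ⊗ p₃)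
    ⊕ (scalar (ℤ.+ 9) ⊗ scalar m₃ ⊕ scalar (ℤ.+ 3) ⊗ scalar m₂ ⊕ scalar m₁) ⊗ (t ⊗ T)
    ≈⟨ solve 8 (λ t p₁ p₂ p₃ m₁ m₂ m₃ T → t :* (p₁ :+ con (ℤ.+ 3) :* p₂ :+ con (ℤ.+ 9) :* p₃)
           :+ (con (ℤ.+ 9) :* m₃ :+ con (ℤ.+ 3) :* m₂ :+ m₁) :* (t :* T)
         := t :* (p₁ :+ m₁ :* T :+ con (ℤ.+ 3) :* (p₂ :+ m₂ :* T) :+ con (ℤ.+ 9) :* (p₃ :+ m₃ :* T)))
         R.refl t p₁ p₂ p₃ (scalar m₁) (scalar m₂) (scalar m₃) T ⟩
  t ⊗ (p₁ ⊕ scalar m₁ ⊗ T ⊕ scalar (ℤ.+ 3) ⊗ (p₂ ⊕ scalar m₂ ⊗ T) ⊕ scalar (ℤ.+ 9) ⊗ (p₃ ⊕ scalar m₃ ⊗ T)) ∎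
  where
  open ≈R
  m₁ m₂ m₃ : ℤ
  m₁ = m (1 + i) (suc J)
  m₂ = m (2 + i) (suc J)
  m₃ = m (3 + i) (suc J)
  p₁ p₂ p₃ T : Series
  p₁ = m-polynomial (1 + i) J
  p₂ = m-polynomial (2 + i) J
  p₃ = m-polynomial (3 + i) J
  T = t ↑ suc J

-- Row 3 is a base case, because its recurrence involves D₀ (u⁰) = 1, which is not a row of `m`.
D₀-u↑ : ∀ i J → suc i ≤ J → D₀ (u ↑ suc i) ≈ m-polynomial (suc i) J
D₀-u↑ 0 J i≤J = R.trans (R.trans (D₀-cong (R.*-identityʳ u)) D₀-u) (R.trans
  (solve 1 (λ t → con (ℤ.+ 3) :* t := con 0ℤ :+ con (ℤ.+ 3) :* (t :* con 1ℤ)) R.refl t)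
  (R.sym (m-polynomial-extend 1 i≤J)))
D₀-u↑ 1 J i≤J = R.trans (R.trans (D₀-cong (R.*-congˡ (R.*-identityʳ u))) D₀-u²) (R.trans
  (solve 1 (λ t → con (ℤ.+ 2) :* t :+ con (ℤ.+ 27) :* (t :* t)
     := con 0ℤ :+ con (ℤ.+ 2) :* (t :* con 1ℤ) :+ con (ℤ.+ 27) :* (t :* (t :* con 1ℤ))) R.refl t)
  (R.sym (m-polynomial-extend 2 i≤J)))
D₀-u↑ 2 J i≤J = R.trans (u↑-recurrence 0) (R.trans
  (R.*-congˡ (R.+-cong (R.+-cong D₀-𝟙 (R.*-congˡ (D₀-u↑ 0 1 ≤-refl))) (R.*-congˡ (D₀-u↑ 1 2 ≤-refl)))) (R.trans
  (solve 1 (λ t → t :* (con 1ℤ :+ con (ℤ.+ 3) :* (con 0ℤ :+ con (ℤ.+ 3) :* (t :* con 1ℤ))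
       :+ con (ℤ.+ 9) :* (con 0ℤ :+ con (ℤ.+ 2) :* (t :* con 1ℤ) :+ con (ℤ.+ 27) :* (t :* (t :* con 1ℤ))))
     := con 0ℤ :+ con 1ℤ :* (t :* con 1ℤ) :+ con (ℤ.+ 27) :* (t :* (t :* con 1ℤ))
         :+ con (ℤ.+ 243) :* (t :* (t :* (t :* con 1ℤ)))) R.refl t)
  (R.sym (m-polynomial-extend 3 i≤J))))
D₀-u↑ (suc (suc (suc i))) (suc J) (s≤s 3+i≤J) = R.trans (u↑-recurrence (suc i)) (R.trans
  (R.*-congˡ (R.+-cong (R.+-cong (D₀-u↑ i J (≤-trans (m≤n⇒m≤1+n (m≤n⇒m≤1+n ≤-refl)) 3+i≤J))
    (R.*-congˡ (D₀-u↑ (1 + i) J (≤-trans (m≤n⇒m≤1+n ≤-refl) 3+i≤J)))) (R.*-congˡ (D₀-u↑ (2 + i) J 3+i≤J))))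
  (R.sym (m-polynomial-recurrence i J)))

-- As u is divisible by q, the section of uⁱ starts at t^⌈i/3⌉. In terms of `m`, one column back
-- means at most three rows back. This empties the first k columns, which the index i + j - 1 in `A`
-- and `B` skips.
m-lower : ∀ i j → j * 3 < i → m i j ≡ 0ℤ
m-lower 1 zero _ = refl
m-lower 2 zero _ = refl
m-lower 3 zero _ = refl
m-lower (suc (suc (suc (suc i)))) zero _ = refl
m-lower (suc (suc (suc (suc i)))) (suc zero) _ = refl
m-lower (suc (suc (suc (suc i)))) (suc (suc j)) (s≤s (s≤s (s≤s 3+3j≤i))) = recurrence-zero
  (m-lower (suc (suc (suc i))) (suc j) (≤-trans 3+3j≤i (m≤n⇒m≤1+n (m≤n⇒m≤1+n ≤-refl))))
  (m-lower (suc (suc i)) (suc j) (≤-trans 3+3j≤i (m≤n⇒m≤1+n ≤-refl)))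
  (m-lower (suc i) (suc j) 3+3j≤i)
  where
  recurrence-zero : ∀ {a b c} → a ≡ 0ℤ → b ≡ 0ℤ → c ≡ 0ℤ → ℤ.+ 9 ℤ.* a ℤ.+ ℤ.+ 3 ℤ.* b ℤ.+ c ≡ 0ℤ
  recurrence-zero refl refl refl = refl
m-lower 1 (suc j) (s≤s ())
m-lower 2 (suc j) (s≤s (s≤s ()))
m-lower 3 (suc j) (s≤s (s≤s (s≤s ())))

-- Extraction from the basis series and the matrices

-- The series in the theorem, with e = 1 for even α and e = 3 for odd α.
basis : ℕ → ℕ → Series
basis e k = q^ k ⊗ G ↑ (e + 4 * k)

t↑ : ∀ k → t ↑ k ≈ q^ k ⊗ G ↑ (4 * k)
t↑ k = R.trans (↑-⊗ (q^ 1) G⁴ k) (R.*-cong (q↑k k) (G⁴↑k k))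
  where
  q↑k : ∀ k → q^ 1 ↑ k ≈ q^ k
  q↑k zero    = R.sym q^0
  q↑k (suc k) = R.trans (R.*-congˡ (q↑k k)) (R.sym (q^-suc k))
  G⁴↑k : ∀ k → G⁴ ↑ k ≈ G ↑ (4 * k)
  G⁴↑k zero    = R.refl
  G⁴↑k (suc k) = R.trans (R.*-congˡ (G⁴↑k k)) (R.trans
    (solve 2 (λ g y → g :* (g :* g :* g) :* y := g :* (g :* (g :* (g :* y)))) R.refl G (G ↑ (4 * k)))
    (R.reflexive (cong (G ↑_) (sym (ℕ.*-suc 4 k)))))

G↑-constant : ∀ k → (G ↑ k) 0 ≡ 1ℤ
G↑-constant zero    = refl
G↑-constant (suc k) = ⊗-constant G (G ↑ k) G-constant (G↑-constant k)

-- The exponents of G in two basis series add up to a multiple of 4 exactly when e + e′ is one; this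
-- is why extraction alternates between e = 1 and e = 3.
basis⊗basis : ∀ e e′ → e + e′ ≡ 4 → ∀ k j → t ↑ (suc (k + j)) ≈ q^ 1 ⊗ basis e k ⊗ basis e′ j
basis⊗basis e e′ e+e′≡4 k j = begin
  t ↑ (suc (k + j))
    ≈⟨ t↑ (suc (k + j)) ⟩
  q^ (suc (k + j)) ⊗ G ↑ (4 * suc (k + j))
    ≈⟨ R.*-cong (R.trans (q^-suc (k + j)) (R.*-congˡ (q^-+ k j))) (R.trans (R.reflexive
        (cong (G ↑_) exponents)) (↑-+ G (e + 4 * k) (e′ + 4 * j))) ⟩
  q^ 1 ⊗ (q^ k ⊗ q^ j) ⊗ (G ↑ (e + 4 * k) ⊗ G ↑ (e′ + 4 * j))
    ≈⟨ solve 5 (λ q x y g h → q :* (x :* y) :* (g :* h) := q :* (x :* g) :* (y :* h)) R.refl _ _ _ _ _ ⟩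
  q^ 1 ⊗ basis e k ⊗ basis e′ j ∎
  where
  open ≈R
  exponents : 4 * suc (k + j) ≡ e + 4 * k + (e′ + 4 * j)
  exponents = trans (lemma k j) (trans (cong (_+ (4 * k + 4 * j)) (sym e+e′≡4)) (lemma′ e e′ (4 * k) (4 * j)))
    where
    lemma : ∀ k j → 4 * suc (k + j) ≡ 4 + (4 * k + 4 * j)
    lemma = ℕ.solve-∀
    lemma′ : ∀ a b c d → a + b + (c + d) ≡ a + c + (b + d)
    lemma′ = ℕ.solve-∀

u↑-basis : ∀ e k → u ↑ (e + 4 * k) ≈ q^ (e + 4 * k) ⊗ (G ↑ (e + 4 * k) ⊗ V (G ↑ (e + 4 * k)))
u↑-basis e k = u↑ (e + 4 * k)
  where
  u↑ : ∀ n → u ↑ n ≈ q^ n ⊗ (G ↑ n ⊗ V (G ↑ n))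
  u↑ zero    = R.sym (R.trans (R.*-cong q^0 (R.trans (R.*-identityˡ _) V-𝟙)) (R.*-identityˡ 𝟙))
  u↑ (suc n) = R.trans (R.*-congˡ (u↑ n)) (R.trans
    (solve 6 (λ q g v x y z → q :* (g :* v) :* (x :* (y :* z)) := q :* x :* (g :* y :* (v :* z))) R.refl _ _ _ _ _ _)
    (R.*-cong (R.sym (q^-suc n)) (R.*-congˡ (R.sym (V-⊗ G (G ↑ n))))))

-- Each remaining power of t in the section of u^(e+4k) contains q · `basis e k`, which cancels and
-- leaves a basis series of the other kind. The bound is the degree: e + 4k is at most k + 3(k + 1),
-- and k columns are dropped.
expand : ∀ {e e′} → e + e′ ≡ 4 → .{{_ : NonZero e}} → e ≤ 3 → ∀ k J → 3 * suc k ≤ J → ∀ {F} →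
  q^ 1 ⊗ basis e k ⊗ F ≈ D₀ (u ↑ (e + 4 * k)) →
  F ≈ partial (λ j → scalar (m (e + 4 * k) (k + suc j)) ⊗ basis e′ j) J
expand {e@(suc e-1)} {e′} e+e′≡4 e≤3 k J 3k≤J {F} eq = q^⊗-cancel (suc k)
    (⊗-cancelˡ (G ↑ (e + 4 * k)) (G↑-constant (e + 4 * k)) (begin
  G ↑ (e + 4 * k) ⊗ (q^ (suc k) ⊗ F)
    ≈⟨ regroup F ⟩
  q^ 1 ⊗ basis e k ⊗ F
    ≈⟨ eq ⟩
  D₀ (u ↑ (e + 4 * k))
    ≈⟨ D₀-u↑ (e-1 + 4 * k) (k + J) large ⟩
  m-polynomial (e + 4 * k) (k + J)
    ≈⟨ partial-+ _ k J ⟩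
  partial (λ j → scalar (m (e + 4 * k) (suc j)) ⊗ t ↑ suc j) k ⊕ partial (λ j
      → scalar (m (e + 4 * k) (suc (k + j))) ⊗ t ↑ suc (k + j)) J
    ≈⟨ R.trans (R.+-congʳ (partial-≡0 k λ j j<k → scalar⊗𝟘 _ (m-lower (e + 4 * k) (suc j) (small j j<k))))
        (R.+-identityˡ _) ⟩
  partial (λ j → scalar (m (e + 4 * k) (suc (k + j))) ⊗ t ↑ suc (k + j)) J
    ≈⟨ partial-cong J (λ j _ → R.trans (R.*-cong (R.reflexive (cong (scalar ∘ m (e + 4 * k)) (sym
        (ℕ.+-suc k j)))) (basis⊗basis e e′ e+e′≡4 k j))
         (solve 3 (λ a b c → a :* (b :* c) := b :* (a :* c)) R.refl _ _ _)) ⟩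
  partial (λ j → q^ 1 ⊗ basis e k ⊗ (scalar (m (e + 4 * k) (k + suc j)) ⊗ basis e′ j)) J
    ≈⟨ ⊗-partial _ _ J ⟨
  q^ 1 ⊗ basis e k ⊗ partial (λ j → scalar (m (e + 4 * k) (k + suc j)) ⊗ basis e′ j) J
    ≈⟨ regroup _ ⟨
  G ↑ (e + 4 * k) ⊗ (q^ (suc k) ⊗ partial (λ j → scalar (m (e + 4 * k) (k + suc j)) ⊗ basis e′ j) J) ∎))
  where
  open ≈R
  regroup : ∀ F → G ↑ (e + 4 * k) ⊗ (q^ (suc k) ⊗ F) ≈ q^ 1 ⊗ basis e k ⊗ F
  regroup F = R.trans (R.*-congˡ (R.*-congʳ (q^-suc k)))
    (solve 4 (λ g q x f → g :* (q :* x :* f) := q :* (x :* g) :* f) R.refl _ _ _ F)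
  large : suc (e-1 + 4 * k) ≤ k + J
  large = ≤-trans (ℕ.+-monoˡ-≤ (4 * k) e≤3) (≤-trans (ℕ.≤-reflexive (lemma k)) (ℕ.+-monoʳ-≤ k 3k≤J))
    where
    lemma : ∀ k → 3 + 4 * k ≡ k + 3 * suc k
    lemma = ℕ.solve-∀
  small : ∀ j → j < k → suc j * 3 < e + 4 * k
  small j j<k = s≤s (≤-trans (ℕ.*-monoˡ-≤ 3 j<k) (≤-trans (ℕ.≤-reflexive (ℕ.*-comm k 3))
    (≤-trans (ℕ.*-monoˡ-≤ k {3} {4} (s≤s (s≤s (s≤s z≤n)))) (ℕ.m≤n+m (4 * k) e-1))))

-- For F = `basis 1 k` the product V F · q F is u^(1+4k), the power of q being 3k + 1 + k. The
-- factor V F passes through the extraction, and q turns residue 2 into residue 0.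
D₂-basis : ∀ k J → 3 * suc k ≤ J → D₂ (basis 1 k) ≈ partial (λ j → scalar (A (suc k) (suc j)) ⊗ basis 3 j) J
D₂-basis k J 3k≤J = R.trans (expand {1} {3} refl (s≤s z≤n) k J 3k≤J (begin
  q^ 1 ⊗ F ⊗ D₂ F                ≈⟨ solve 3 (λ q x y → q :* x :* y := x :* (q :* y)) R.refl _ _ _ ⟩
  F ⊗ (q^ 1 ⊗ D₂ F)              ≈⟨ R.*-congˡ (D₀-q⊗ F) ⟨
  F ⊗ D₀ (q^ 1 ⊗ F)              ≈⟨ D₀-V⊗ F (q^ 1 ⊗ F) ⟨
  D₀ (V F ⊗ (q^ 1 ⊗ F))          ≈⟨ D₀-cong VF⊗qF ⟩
  D₀ (u ↑ (1 + 4 * k))           ∎))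
  (partial-cong J λ j _ → R.*-congʳ (R.reflexive (cong (λ i → scalar (m i (k + suc j))) (sym (cong (_∸ 3)
      (ℕ.*-suc 4 k))))))
  where
  open ≈R
  F = basis 1 k
  reindex : ∀ k → k * 3 + (1 + k) ≡ 1 + 4 * k
  reindex = ℕ.solve-∀
  VF⊗qF : V F ⊗ (q^ 1 ⊗ F) ≈ u ↑ (1 + 4 * k)
  VF⊗qF = R.trans (R.*-congʳ (R.trans (V-⊗ _ _) (R.*-congʳ (V-q^ k)))) (R.trans
    (solve 5 (λ x v q y g → x :* v :* (q :* (y :* g)) := x :* (q :* y) :* (g :* v)) R.refl _ _ _ _ _)
    (R.trans (R.*-congʳ (R.trans (R.*-congˡ (R.sym (q^-suc k))) (R.trans
        (R.sym (q^-+ (k * 3) (1 + k))) (q^-≡ (reindex k)))))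
             (R.sym (u↑-basis 1 k))))

-- For F = `basis 3 k` the powers qᵏ and q³ᵏ fall 3 short of 3 + 4k. The missing q³ is `V (q^ 1)`,
-- so the residue stays 0.
D₀-basis : ∀ k J → 3 * suc k ≤ J → D₀ (basis 3 k) ≈ partial (λ j → scalar (B (suc k) (suc j)) ⊗ basis 1 j) J
D₀-basis k J 3k≤J = R.trans (expand {3} {1} refl ≤-refl k J 3k≤J (begin
  q^ 1 ⊗ F ⊗ D₀ F                ≈⟨ D₀-V⊗ (q^ 1 ⊗ F) F ⟨
  D₀ (V (q^ 1 ⊗ F) ⊗ F)          ≈⟨ D₀-cong VqF⊗F ⟩
  D₀ (u ↑ (3 + 4 * k))           ∎))
  (partial-cong J λ j _ → R.*-congʳ (R.reflexive (cong (λ i → scalar (m i (k + suc j))) (sym (cong (_∸ 1)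
      (ℕ.*-suc 4 k))))))
  where
  open ≈R
  F = basis 3 k
  reindex : ∀ k → 3 + k * 3 + k ≡ 3 + 4 * k
  reindex = ℕ.solve-∀
  VqF⊗F : V (q^ 1 ⊗ F) ⊗ F ≈ u ↑ (3 + 4 * k)
  VqF⊗F = R.trans (R.*-congʳ (R.trans (V-⊗ _ _) (R.*-cong V-q (R.trans (V-⊗ _ _) (R.*-congʳ (V-q^ k)))))) (R.trans
    (solve 5 (λ q x v y g → q :* (x :* v) :* (y :* g) := q :* x :* y :* (g :* v)) R.refl _ _ _ _ _)
    (R.trans (R.*-congʳ (R.trans (R.*-congʳ (R.sym (q^-+ 3 (k * 3)))) (R.trans
        (R.sym (q^-+ (3 + k * 3) k)) (q^-≡ (reindex k)))))
             (R.sym (u↑-basis 3 k))))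

x-sum : ℕ → ℕ → Series
x-sum α e = partial (λ k → scalar (x α (suc k)) ⊗ basis e k) (3 ^ α)

sections-partial : (D : Series → Series) → D 𝟘 ≈ 𝟘 → (∀ F G → D (F ⊕ G) ≈ D F ⊕ D G) → (∀ c F → D (scalar c ⊗ F)
    ≈ scalar c ⊗ D F) →
  ∀ (y : ℕ → ℤ) (s : ℕ → Series) n → D (partial (λ k → scalar (y k) ⊗ s k) n) ≈ partial (λ k
      → scalar (y k) ⊗ D (s k)) n
sections-partial D D𝟘 D⊕ D-scalar y s zero    = D𝟘
sections-partial D D𝟘 D⊕ D-scalar y s (suc n) =
  R.trans (D⊕ _ _) (R.+-cong (sections-partial D D𝟘 D⊕ D-scalar y s n) (D-scalar (y n) (s n)))

D₀-𝟘 : D₀ 𝟘 ≈ 𝟘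
D₀-𝟘 = R.trans (D₀-cong (R.sym V-𝟘)) (D₀V 𝟘)

D₂-𝟘 : D₂ 𝟘 ≈ 𝟘
D₂-𝟘 = R.trans (D₂-cong (R.sym V-𝟘)) (D₂V 𝟘)

-- By linearity the extraction acts on the coefficient vector. Row k + 1 needs the bound 3(k + 1),
-- so 3 · 3^α serves all rows, and it is the length of the next vector.
x-step : ∀ (D : Series → Series) → D 𝟘 ≈ 𝟘 → (∀ F G → D (F ⊕ G) ≈ D F ⊕ D G) → (∀ c F → D (scalar c ⊗ F)
    ≈ scalar c ⊗ D F) →
  ∀ α e e′ → (∀ k J → 3 * suc k ≤ J → D (basis e k) ≈ partial (λ j
      → scalar (step α (suc k) (suc j)) ⊗ basis e′ j) J) →
  D (x-sum α e) ≈ x-sum (suc α) e′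
x-step D D𝟘 D⊕ D-scalar α e e′ D-basis = begin
  D (x-sum α e)
    ≈⟨ sections-partial D D𝟘 D⊕ D-scalar xₖ (basis e) K ⟩
  partial (λ k → scalar (xₖ k) ⊗ D (basis e k)) K
    ≈⟨ partial-cong K (λ k k<K → R.*-congˡ (D-basis k J (ℕ.*-monoʳ-≤ 3 k<K))) ⟩
  partial (λ k → scalar (xₖ k) ⊗ partial (λ j → scalar (stepₖ k j) ⊗ basis e′ j) J) K
    ≈⟨ partial-swap xₖ stepₖ (basis e′) J K ⟩
  partial (λ j → scalar (∑[ k < K ] (xₖ (toℕ k) ℤ.* stepₖ (toℕ k) j)) ⊗ basis e′ j) J
    ≈⟨ partial-cong J (λ j _ → R.*-congʳ (R.reflexive (cong scalar (x-suc j)))) ⟩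
  x-sum (suc α) e′ ∎
  where
  open ≈R
  J K : ℕ
  J = 3 ^ suc α
  K = 3 ^ α
  xₖ : ℕ → ℤ
  xₖ k = x α (suc k)
  stepₖ : ℕ → ℕ → ℤ
  stepₖ k j = step α (suc k) (suc j)
  x-suc : ∀ j → ∑[ k < K ] (xₖ (toℕ k) ℤ.* stepₖ (toℕ k) j) ≡ x (suc α) (suc j)
  x-suc j = refl

step-A : ∀ α → parity α ≡ 0ℙ → step α ≡ A
step-A α eq rewrite eq = refl

step-B : ∀ α → parity α ≡ 1ℙ → step α ≡ B
step-B α eq rewrite eq = refl

parity-even : ∀ α → parity (2 * α) ≡ 0ℙ
parity-even zero    = refl
parity-even (suc α) = trans (cong parity (ℕ.*-suc 2 α)) (parity-even α)

parity-odd : ∀ α → parity (suc (2 * α)) ≡ 1ℙ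
parity-odd zero    = refl
parity-odd (suc α) = trans (cong (parity ∘ suc) (ℕ.*-suc 2 α)) (parity-odd α)

D₂-x-sum : ∀ α → D₂ (x-sum (2 * α) 1) ≈ x-sum (suc (2 * α)) 3
D₂-x-sum α = x-step D₂ D₂-𝟘 D₂-⊕ D₂-scalar⊗ (2 * α) 1 3 λ k J 3k≤J →
  subst (λ s → D₂ (basis 1 k) ≈ partial (λ j → scalar (s (suc k) (suc j)) ⊗ basis 3 j) J)
        (sym (step-A (2 * α) (parity-even α))) (D₂-basis k J 3k≤J)

D₀-x-sum : ∀ α → D₀ (x-sum (suc (2 * α)) 3) ≈ x-sum (2 * suc α) 1
D₀-x-sum α = R.trans (x-step D₀ D₀-𝟘 D₀-⊕ D₀-scalar⊗ (suc (2 * α)) 3 1 λ k J 3k≤J →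
  subst (λ s → D₀ (basis 3 k) ≈ partial (λ j → scalar (s (suc k) (suc j)) ⊗ basis 1 j) J)
        (sym (step-B (suc (2 * α)) (parity-odd α))) (D₀-basis k J 3k≤J))
  (R.reflexive (cong (λ α → x-sum α 1) (sym (ℕ.*-suc 2 α))))

-- At qⁿ one side has n + 1 terms and the other 3^α. Both extend to n + 1 + 3^α terms: the first by
-- divisibility of the terms by powers of q, the second by `x-support`.
∑ˢ₁-x-sum : ∀ α e (s : ℕ → Series) → (∀ k → s (suc k) ≈ scalar (x α (suc k)) ⊗ basis e k) → ∑ˢ₁ s ≈ x-sum α e
∑ˢ₁-x-sum α e s s≈ = coefficientwise λ n → begin
  ∑ˢ₁ s n                                  ≡⟨ partial-at (s ∘ suc) (suc n) n ⟨
  partial (s ∘ suc) (suc n) n              ≡⟨ at (partial-cong (suc n) λ k _ → s≈ k) n ⟩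
  partial r (suc n) n                      ≡⟨ below (partial-extend {suc n} {r} (suc n) (3 ^ α) (λ k
      → divisible (suc n) k)) n ≤-refl ⟨
  partial r (suc n + 3 ^ α) n              ≡⟨ cong (λ M → partial r M n) (ℕ.+-comm (suc n) (3 ^ α)) ⟩
  partial r (3 ^ α + suc n) n              ≡⟨ below (partial-extend {suc n} {r} (3 ^ α) (suc n) (λ k
      → ≈⇒≈[] (scalar⊗𝟘 _ (x-support α _ (s≤s (ℕ.m≤m+n (3 ^ α) k)))))) n ≤-refl ⟩
  x-sum α e n                              ∎
  where
  open ≡-Reasoning
  r : ℕ → Series
  r k = scalar (x α (suc k)) ⊗ basis e k
  divisible : ∀ N k → r (N + k) ≈[ N ] 𝟘
  divisible N k = ≈[]-≈ (⊗-cong[] ≈[]-refl (⊗-cong[] (q^-small (ℕ.m≤m+n N k)) ≈[]-refl))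
    (R.trans (R.*-congˡ (R.zeroˡ _)) (R.zeroʳ _))

summand-≈ : ∀ c k e e′ → e ≡ e′ → c ·ˢ (q ^ˢ k *ˢ G ^ˢ e) ≈ scalar c ⊗ (q^ k ⊗ G ↑ e′)
summand-≈ c k e e′ refl = R.trans (·-scalar c _) (R.*-congˡ
  (R.trans (R.reflexive (*ˢ-≡ _ _)) (R.*-cong (q↑ k) (^ˢ-≈ G e))))

-- The progressions of indices

-- The exact quotient (9^α - 1) / 4, by recursion from 9(1 + 4κ) = 1 + 4(9κ + 2), so that truncated
-- division stays out of the index arithmetic.
offset : ℕ → ℕ
offset zero    = 0
offset (suc α) = 9 * offset α + 2

3^2[1+α] : ∀ α → 3 ^ (2 * suc α) ≡ 9 * 3 ^ (2 * α)
3^2[1+α] α = trans (cong (3 ^_) (ℕ.*-suc 2 α)) (sym (ℕ.*-assoc 3 3 (3 ^ (2 * α))))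

3^2α : ∀ α → 3 ^ (2 * α) ≡ 1 + offset α * 4
3^2α zero    = refl
3^2α (suc α) = trans (3^2[1+α] α) (trans (cong (9 *_) (3^2α α)) (lemma (offset α)))
  where
  lemma : ∀ κ → 9 * (1 + κ * 4) ≡ 1 + (9 * κ + 2) * 4
  lemma = ℕ.solve-∀

offset-≡ : ∀ α → (3 ^ (2 * α) ∸ 1) / 4 ≡ offset α
offset-≡ α = trans (cong (λ k → (k ∸ 1) / 4) (3^2α α)) (m*n/n≡m (offset α) 4)

-- An opaque copy of a₃, because comparing two of its values by unfolding is infeasible.
opaque
  coefficient : ℕ → ℤ
  coefficient = a₃

  coefficient≡a₃ : ∀ n → coefficient n ≡ a₃ n
  coefficient≡a₃ n = refl

  coefficient-≈ : coefficient ≈ G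
  coefficient-≈ = R.refl

even odd : ℕ → Series
even α n = coefficient (3 ^ (2 * α) * n + offset α)
odd  α n = coefficient (3 * 3 ^ (2 * α) * n + offset (suc α))

even-zero : even 0 ≈ coefficient
even-zero = coefficientwise λ n → cong coefficient (trans (ℕ.+-identityʳ (n + 0)) (ℕ.+-identityʳ n))

-- With κ = `offset α` and 9^α = 1 + 4κ, residue 2 shifts the index by 2(1 + 4κ) to 9κ + 2, which is
-- the next offset; the following extraction at residue 0 then leaves it fixed.
D₂-even : ∀ α → D₂ (even α) ≈ odd α
D₂-even α = coefficientwise λ n → trans (D₂-at (even α) n) (cong coefficient (index n))
  where
  lemma : ∀ n κ → (1 + κ * 4) * (2 + n * 3) + κ ≡ 3 * (1 + κ * 4) * n + (9 * κ + 2)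
  lemma = ℕ.solve-∀
  index : ∀ n → 3 ^ (2 * α) * (2 + n * 3) + offset α ≡ 3 * 3 ^ (2 * α) * n + offset (suc α)
  index n = begin
    3 ^ (2 * α) * (2 + n * 3) + offset α                ≡⟨ cong (λ k → k * (2 + n * 3) + offset α) (3^2α α) ⟩
    (1 + offset α * 4) * (2 + n * 3) + offset α         ≡⟨ lemma n (offset α) ⟩
    3 * (1 + offset α * 4) * n + offset (suc α)         ≡⟨ cong (λ k → 3 * k * n + offset (suc α)) (3^2α α) ⟨
    3 * 3 ^ (2 * α) * n + offset (suc α)                ∎
    where open ≡-Reasoning

D₀-odd : ∀ α → D₀ (odd α) ≈ even (suc α)
D₀-odd α = coefficientwise λ n → trans (D₀-at (odd α) n) (cong coefficient (index n))
  where
  lemma : ∀ k n → 3 * k * (n * 3) ≡ 9 * k * n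
  lemma = ℕ.solve-∀
  index : ∀ n → 3 * 3 ^ (2 * α) * (n * 3) + offset (suc α) ≡ 3 ^ (2 * suc α) * n + offset (suc α)
  index n = cong (_+ offset (suc α)) (trans (lemma (3 ^ (2 * α)) n) (cong (_* n) (sym (3^2[1+α] α))))

even-≈ : ∀ α → even α ≈ x-sum (2 * α) 1
even-≈ zero    = begin
  even 0                                    ≈⟨ even-zero ⟩
  coefficient                               ≈⟨ coefficient-≈ ⟩
  G                                         ≈⟨ solve 1 (λ g → g := con 0ℤ :+ con 1ℤ :* (con 1ℤ :* (g :* con 1ℤ)))
      R.refl G ⟩
  𝟘 ⊕ scalar 1ℤ ⊗ (𝟙 ⊗ G ↑ 1)               ≈⟨ R.+-congˡ (R.*-congˡ (R.*-congʳ q^0)) ⟨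
  𝟘 ⊕ scalar 1ℤ ⊗ (q^ 0 ⊗ G ↑ 1)            ∎
  where open ≈R
even-≈ (suc α) = begin
  even (suc α)                              ≈⟨ D₀-odd α ⟨
  D₀ (odd α)                                ≈⟨ D₀-cong (D₂-even α) ⟨
  D₀ (D₂ (even α))                          ≈⟨ D₀-cong (D₂-cong (even-≈ α)) ⟩
  D₀ (D₂ (x-sum (2 * α) 1))                 ≈⟨ D₀-cong (D₂-x-sum α) ⟩
  D₀ (x-sum (suc (2 * α)) 3)                ≈⟨ D₀-x-sum α ⟩
  x-sum (2 * suc α) 1                       ∎
  where open ≈R

odd-≈ : ∀ α → odd α ≈ x-sum (suc (2 * α)) 3
odd-≈ α = R.trans (R.sym (D₂-even α)) (R.trans (D₂-cong (even-≈ α)) (D₂-x-sum α))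

theorem3p1 : (α : ℕ) →
    ((λ n → a₃ (3 ^ (2 * α) * n + (3 ^ (2 * α) ∸ 1) / 4))
    ≈ˢ ∑ˢ₁ (λ i → x (2 * α) i ·ˢ (q ^ˢ (i ∸ 1) *ˢ G ^ˢ (4 * i ∸ 3))))
    ×
    ((λ n → a₃ (3 ^ (2 * α + 1) * n + (3 ^ (2 * α + 2) ∸ 1) / 4))
    ≈ˢ ∑ˢ₁ (λ i → x (2 * α + 1) i ·ˢ (q ^ˢ (i ∸ 1) *ˢ G ^ˢ (4 * i ∸ 1))))
theorem3p1 α = even-series , odd-series
  where
  open ≡-Reasoning
  2α+2≡ : 2 * α + 2 ≡ 2 * suc α
  2α+2≡ = trans (ℕ.+-comm (2 * α) 2) (sym (ℕ.*-suc 2 α))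
  even-term odd-term : ℕ → Series
  even-term i = x (2 * α) i ·ˢ (q ^ˢ (i ∸ 1) *ˢ G ^ˢ (4 * i ∸ 3))
  odd-term  i = x (2 * α + 1) i ·ˢ (q ^ˢ (i ∸ 1) *ˢ G ^ˢ (4 * i ∸ 1))
  even-index : ∀ n → 3 ^ (2 * α) * n + (3 ^ (2 * α) ∸ 1) / 4 ≡ 3 ^ (2 * α) * n + offset α
  even-index n = cong (3 ^ (2 * α) * n +_) (offset-≡ α)
  odd-index : ∀ n → 3 ^ (2 * α + 1) * n + (3 ^ (2 * α + 2) ∸ 1) / 4 ≡ 3 * 3 ^ (2 * α) * n + offset (suc α)
  odd-index n = cong₂ (λ k l → 3 ^ k * n + l) (ℕ.+-comm (2 * α) 1)
    (trans (cong (λ k → (3 ^ k ∸ 1) / 4) 2α+2≡) (offset-≡ (suc α)))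
  even-series : ∀ n → a₃ (3 ^ (2 * α) * n + (3 ^ (2 * α) ∸ 1) / 4) ≡ ∑ˢ₁ even-term n
  even-series n = begin
    a₃ (3 ^ (2 * α) * n + (3 ^ (2 * α) ∸ 1) / 4)             ≡⟨ coefficient≡a₃ _ ⟨
    coefficient (3 ^ (2 * α) * n + (3 ^ (2 * α) ∸ 1) / 4)    ≡⟨ cong coefficient (even-index n) ⟩
    even α n                                                 ≡⟨ at (even-≈ α) n ⟩
    x-sum (2 * α) 1 n                                        ≡⟨ at (∑ˢ₁-x-sum (2 * α) 1 even-term λ k →
                                                                  summand-≈ (x (2 * α) (suc k)) k (4 * suc k ∸ 3) (1 + 4 * k) (cong (_∸ 3) (ℕ.*-suc 4 k))) n ⟨
    ∑ˢ₁ even-term n                                          ∎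
  odd-series : ∀ n → a₃ (3 ^ (2 * α + 1) * n + (3 ^ (2 * α + 2) ∸ 1) / 4) ≡ ∑ˢ₁ odd-term n
  odd-series n = begin
    a₃ (3 ^ (2 * α + 1) * n + (3 ^ (2 * α + 2) ∸ 1) / 4)            ≡⟨ coefficient≡a₃ _ ⟨
    coefficient (3 ^ (2 * α + 1) * n + (3 ^ (2 * α + 2) ∸ 1) / 4)   ≡⟨ cong coefficient (odd-index n) ⟩
    odd α n                                                         ≡⟨ at (odd-≈ α) n ⟩
    x-sum (suc (2 * α)) 3 n                                         ≡⟨ cong (λ β → x-sum β 3 n) (ℕ.+-comm 1 (2 * α)) ⟩
    x-sum (2 * α + 1) 3 n                                           ≡⟨ at (∑ˢ₁-x-sum (2 * α + 1) 3 odd-term λ k →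
                                                                         summand-≈ (x (2 * α + 1) (suc k)) k (4 * suc k ∸ 1) (3 + 4 * k) (cong (_∸ 1) (ℕ.*-suc 4 k))) n ⟨
    ∑ˢ₁ odd-term n                                                  ∎
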